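{- Binary free-connex conjunctive queries and $\mathsf{FO}^{\wedge}_2$ queries are equally expressive: every binary free-connex CQ is equivalent to an $\mathsf{FO}^{\wedge}_2$ query, and every $\mathsf{FO}^{\wedge}_2$ query is equivalent to a binary free-connex CQ (equivalent meaning the same output on every database over every commutative semiring).
   Context: Fix a commutative semiring $(K,\oplus,\odot,\mathbb{0},\mathbb{1})$ with $\mathbb{0}\neq\mathbb{1}$. Databases map relation symbols to $K$-relations (functions $(\mathbb{N}_{>0})^a\to K$ with finite support) and constant symbols to positive integers. Formulas are built from relational atoms $R(\bar x)$ and comparison atoms $x\le c$ ($c$ a constant symbol) by $\exists$, $\wedge$ (and $\vee$ for $\mathsf{FO}^+$), evaluated with semiring semantics ($\wedge\mapsto\odot$, $\exists\mapsto\bigoplus$, $x\le c\mapsto\mathbb{1}$ iff $\nu(x)\le c^{db}$ else $\mathbb{0}$). A query is $H(\bar x)\leftarrow\varphi$ with $\bar x$ a sequence of free variables of $\varphi$ (possibly repeated) containing all of them; it outputs $H(\bar d)=$ value of $\varphi$ on $\bar x\mapsto\bar d$ if $\bar d$ respects the repetitions, else $\mathbb{0}$. A query is binary if all relational atoms (body and head) have arity at most two. $\mathsf{FO}^{\wedge}$ is the disjunction-free fragment; $\mathsf{FO}^{\wedge}_2$ consists of the $\mathsf{FO}^{\wedge}$ formulas using at most two distinct variables overall (free or bound, variables may be re-quantified); an $\mathsf{FO}^{\wedge}_2$ query is a binary query whose body is in $\mathsf{FO}^{\wedge}_2$. A conjunctive query (CQ) is $H(\bar x)\leftarrow\exists\bar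 y.a_1\wedge\dots\wedge a_n$ with $a_i$ relational or comparison atoms. It is acyclic if there is an undirected tree whose nodes are the atoms $a_1,\dots,a_n$ (comparison atoms treated as unary atoms) such that for each variable $z$ the atoms mentioning $z$ induce a connected subtree. It is free-connex if it is acyclic and the query obtained by adding the head atom $H(\bar x)$ to the body is also acyclic. -}

module Defs where

open import Level using (Level; _⊔_)
open import Agda.Primitive using (Setω)
open import Data.Nat using (ℕ; zero; suc; _≤_; _≤ᵇ_; _≡ᵇ_)
open import Data.Bool using (Bool; true; false; if_then_else_; _∧_; _∨_; not)
open import Data.Fin using (Fin)
open import Data.Vec using (Vec; []; _∷_; lookup; toList)
import Data.Vec as Vec
open import Data.List using (List; []; _∷_; _++_; map; filter; length; allFin; foldr)
import Data.List as List
open import Data.List.Membership.Propositional using (_∈_)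
open import Data.List.Relation.Unary.All using (All)
open import Data.Product using (Σ; _×_; _,_; ∃)
open import Data.Sum using (_⊎_)
open import Data.Unit using (⊤)
open import Relation.Binary.PropositionalEquality using (_≡_)
open import Relation.Nullary using (¬_; ¬?)
open import Algebra.Bundles using (CommutativeSemiring)

-- Syntax
-- Positive integers n are encoded by the natural number n - 1
-- (an order-preserving bijection ℕ>0 ≅ ℕ).

Var : Set
Var = ℕ

ConstSym : Set
ConstSym = ℕ

record RelSym : Set where
  constructor relSym
  field
    name  : ℕ
    arity : ℕ
open RelSym public

data Atom : Set where
  relA : (R : RelSym) → Vec Var (arity R) → Atom
  leqA : Var → ConstSym → Atom

data Formula : Set where
  atom : Atom → Formula
  and  : Formula → Formula → Formula
  ex   : Var → Formula → Formula

atomVars : Atom → List Var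
atomVars (relA R xs) = toList xs
atomVars (leqA x c)  = x ∷ []

free : Formula → List Var
free (atom a)  = atomVars a
free (and φ ψ) = free φ ++ free ψ
free (ex x φ)  = filter (λ y → ¬? (y Data.Nat.≟ x)) (free φ)

allVars : Formula → List Var
allVars (atom a)  = atomVars a
allVars (and φ ψ) = allVars φ ++ allVars ψ
allVars (ex x φ)  = x ∷ allVars φ

relArities : Formula → List ℕ
relArities (atom (relA R xs)) = arity R ∷ []
relArities (atom (leqA x c))  = []
relArities (and φ ψ)          = relArities φ ++ relArities ψ
relArities (ex x φ)           = relArities φ

-- Well-definedness: ∃x.φ only when x is free in φ, so that the sum
-- ⊕_{d} over all domain elements is finitely supported.
WF : Formula → Set
WF (atom a)  = ⊤
WF (and φ ψ) = WF φ × WF ψ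
WF (ex x φ)  = (x ∈ free φ) × WF φ

module Semantics {c ℓ : Level} (K : CommutativeSemiring c ℓ) where
  open CommutativeSemiring K

  record DB : Set (c ⊔ ℓ) where
    field
      rel     : (R : RelSym) → Vec ℕ (arity R) → Carrier
      const   : ConstSym → ℕ
      bound   : RelSym → ℕ
      support : ∀ R (t : Vec ℕ (arity R)) →
                (∃ λ i → bound R ≤ lookup t i) → rel R t ≈ 0#
  open DB public

  sumBelow : ℕ → (ℕ → Carrier) → Carrier
  sumBelow zero    f = 0#
  sumBelow (suc n) f = sumBelow n f + f n

  update : (Var → ℕ) → Var → ℕ → Var → ℕ
  update ν x d y = if y ≡ᵇ x then d else ν y

  -- a bound beyond which (for well-formed formulas) a free variable
  -- makes the value 𝟘
  bnd : DB → Formula → ℕ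
  bnd db (atom (relA R xs)) = bound db R
  bnd db (atom (leqA x k))  = suc (const db k)
  bnd db (and φ ψ)          = bnd db φ Data.Nat.⊔ bnd db ψ
  bnd db (ex x φ)           = bnd db φ

  ⟦_⟧ : Formula → DB → (Var → ℕ) → Carrier
  ⟦ atom (relA R xs) ⟧ db ν = rel db R (Vec.map ν xs)
  ⟦ atom (leqA x k)  ⟧ db ν = if ν x ≤ᵇ const db k then 1# else 0#
  ⟦ and φ ψ ⟧ db ν = ⟦ φ ⟧ db ν * ⟦ ψ ⟧ db ν
  ⟦ ex x φ ⟧  db ν = sumBelow (bnd db φ) (λ d → ⟦ φ ⟧ db (update ν x d))

record Query (k : ℕ) : Set where
  field
    body     : Formula
    head     : Vec Var k
    headFree : ∀ x → x ∈ toList head → x ∈ free body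
    freeHead : ∀ x → x ∈ free body → x ∈ toList head
    wf       : WF body
open Query public

allB : {A : Set} → (A → Bool) → List A → Bool
allB p = foldr (λ a b → p a ∧ b) true

respects : {k : ℕ} → Vec Var k → Vec ℕ k → Bool
respects {k} xs ds =
  allB (λ i → allB (λ j → not (lookup xs i ≡ᵇ lookup xs j) ∨ (lookup ds i ≡ᵇ lookup ds j))
                 (allFin k))
      (allFin k)

assign : {k : ℕ} → Vec Var k → Vec ℕ k → Var → ℕ
assign []       []       y = 0
assign (x ∷ xs) (d ∷ ds) y = if y ≡ᵇ x then d else assign xs ds y

output : {c ℓ : Level} (K : CommutativeSemiring c ℓ) {k : ℕ} → Query k →
         Semantics.DB K → Vec ℕ k → CommutativeSemiring.Carrier K
output K q db ds =
  if respects (head q) ds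
  then Semantics.⟦_⟧ K (body q) db (assign (head q) ds)
  else CommutativeSemiring.0# K

Equivalent : {k : ℕ} → Query k → Query k → Setω
Equivalent {k} q q' =
  ∀ {c ℓ : Level} (K : CommutativeSemiring c ℓ) →
  ¬ (CommutativeSemiring._≈_ K (CommutativeSemiring.0# K) (CommutativeSemiring.1# K)) →
  (db : Semantics.DB K) (ds : Vec ℕ k) →
  CommutativeSemiring._≈_ K (output K q db ds) (output K q' db ds)

BinaryQuery : {k : ℕ} → Query k → Set
BinaryQuery {k} q = (k ≤ 2) × All (_≤ 2) (relArities (body q))

FO2 : Formula → Set
FO2 φ = Σ Var λ a → Σ Var λ b → All (λ v → v ≡ a ⊎ v ≡ b) (allVars φ)

FO2Query : {k : ℕ} → Query k → Set
FO2Query q = BinaryQuery q × FO2 (body q)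

record CQShape : Set where
  constructor cqShape
  field
    exVars    : List Var
    firstAtom : Atom
    moreAtoms : List Atom
open CQShape public

conjFrom : Atom → List Atom → Formula
conjFrom a []       = atom a
conjFrom a (b ∷ bs) = and (atom a) (conjFrom b bs)

exs : List Var → Formula → Formula
exs []       φ = φ
exs (y ∷ ys) φ = ex y (exs ys φ)

cqFormula : CQShape → Formula
cqFormula s = exs (exVars s) (conjFrom (firstAtom s) (moreAtoms s))

cqAtoms : CQShape → List Atom
cqAtoms s = firstAtom s ∷ moreAtoms s

Edges : ℕ → Set
Edges n = List (Fin n × Fin n)

data PathIn {n : ℕ} (E : Edges n) (S : Fin n → Set) : Fin n → Fin n → Set where
  here : ∀ {u} → PathIn E S u u
  step : ∀ {u v w} → ((u , v) ∈ E ⊎ (v , u) ∈ E) → S v → PathIn E S v w → PathIn E S u w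

ConnectedIn : {n : ℕ} → Edges n → (Fin n → Set) → Set
ConnectedIn {n} E S = ∀ (u v : Fin n) → S u → S v → PathIn E S u v

IsTree : (n : ℕ) → Edges n → Set
IsTree n E = (suc (length E) ≡ n) × ConnectedIn E (λ _ → ⊤)

-- acyclicity of a list of atoms, each given by its list of variables
-- (a join tree exists)
Acyclic : List (List Var) → Set
Acyclic hs = Σ (Edges (length hs)) λ E →
  IsTree (length hs) E × (∀ (z : Var) → ConnectedIn E (λ i → z ∈ List.lookup hs i))

AcyclicCQ : CQShape → Set
AcyclicCQ s = Acyclic (map atomVars (cqAtoms s))

FreeConnex : {k : ℕ} → CQShape → Vec Var k → Set
FreeConnex s hd = AcyclicCQ s × Acyclic (toList hd ∷ map atomVars (cqAtoms s))

FreeConnexCQ : {k : ℕ} → Query k → Set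
FreeConnexCQ q = Σ CQShape λ s → (body q ≡ cqFormula s) × FreeConnex s (head q)

BinaryFreeConnexCQ : {k : ℕ} → Query k → Set
BinaryFreeConnexCQ q = BinaryQuery q × FreeConnexCQ q

record EquivalentIn {k : ℕ} (P : Query k → Set) (q : Query k) : Setω where
  constructor witness
  field
    query : Query k
    inP   : P query
    equiv : Equivalent q query

record _×ω_ (A B : Setω) : Setω where
  constructor _,ω_
  field
    fst : A
    snd : B

module Submission where

-- Free-connex CQ to FO²: a join tree of the atoms in which the head is a node can be
-- dismantled leaf by leaf. Each removed leaf ("ear") is conjoined to the node it is
-- attached to, after existentially quantifying the variables it shares with no other
-- node. Every node has at most two variables, so every subformula built in this way has
-- at most two free variables, and the variables can then be renamed onto {0, 1}, each
-- quantified variable getting the name not used by the other variable free in its scope.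
--
-- FO² to free-connex CQ: renaming every quantified variable apart and pulling the
-- quantifiers to the front gives a CQ. A fresh variable gets as parent the other
-- variable free in its scope, which is older, so every atom consists of its largest
-- variable and possibly that variable's parent. Added in order of increasing largest
-- variable, each atom attaches along the parent pointer to an earlier atom or to the
-- head, which yields join trees with and without the head.
--
-- Equivalence over every semiring is distributivity: a quantifier commutes with a
-- conjunct not mentioning its variable, once all quantifiers range over one common
-- bounded domain (⟦_⟧[_] below).

open import Defs
open import Algebra.Bundles using (CommutativeSemiring)
import Algebra.Properties.CommutativeSemigroup as CommutativeSemigroupProperties
open import Data.Bool using (Bool; true; false; if_then_else_; not; _∧_; _∨_; T)
import Data.Bool.Properties as BP
open import Data.Empty using (⊥; ⊥-elim)
open import Data.Fin as F using (Fin)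
import Data.Fin.Properties as FP
open import Data.List as List using (List; []; _∷_; _++_; _∷ʳ_; filter; concat; map; length; allFin)
import Data.List.Properties as LP
open import Data.List.Membership.Propositional using (_∈_; _∉_; find)
open import Data.List.Membership.Propositional.Properties
open import Data.List.Relation.Unary.All as All using (All; []; _∷_)
import Data.List.Relation.Unary.All.Properties as AllP
open import Data.List.Relation.Unary.Any as Any using (Any; here; there; any?)
import Data.List.Relation.Unary.Any.Properties as AnyP
open import Data.List.Relation.Binary.Permutation.Propositional as Perm using (_↭_)
import Data.List.Relation.Binary.Permutation.Propositional.Properties as PermP
open import Data.Maybe using (Maybe; just; nothing)
open import Data.Nat as ℕ using (ℕ; zero; suc; _≤_; _<_; _⊔_; _⊓_; _≡ᵇ_; _≤ᵇ_; _<ᵇ_; z≤n; s≤s)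
import Data.Nat.Properties as ℕP
open import Data.List.Membership.DecPropositional ℕ._≟_ using (_∈?_)
open import Data.Product using (Σ; _×_; _,_; proj₁; proj₂)
open import Data.Sum as Sum using (_⊎_; inj₁; inj₂)
open import Function using (_∘_; id)
open import Data.Unit using (⊤; tt)
open import Data.Vec as Vec using (Vec; []; _∷_; lookup; toList)
import Data.Vec.Properties as VecP
import Data.Vec.Membership.Propositional.Properties as VecMemP
import Algebra.Properties.CommutativeMonoid.Sum ℕP.+-0-commutativeMonoid as ℕΣ
open import Relation.Binary.Definitions using (tri<; tri≈; tri>)
open import Relation.Binary.PropositionalEquality as P using (_≡_; _≗_)
import Relation.Binary.Reasoning.Setoid as SetoidReasoning
open import Relation.Nullary using (¬_; yes; no; ¬?; Dec)
open import Relation.Nullary.Decidable using (_×-dec_; decidable-stable)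

≡ᵇ-refl : ∀ n → (n ≡ᵇ n) ≡ true
≡ᵇ-refl zero = P.refl
≡ᵇ-refl (suc n) = ≡ᵇ-refl n

≡ᵇ-true⇒≡ : ∀ m n → (m ≡ᵇ n) ≡ true → m ≡ n
≡ᵇ-true⇒≡ m n e = ℕP.≡ᵇ⇒≡ m n (P.subst T (P.sym e) tt)

≢⇒≡ᵇ-false : ∀ m n → ¬ m ≡ n → (m ≡ᵇ n) ≡ false
≢⇒≡ᵇ-false m n m≢n with m ≡ᵇ n in eq
... | false = P.refl
... | true = ⊥-elim (m≢n (≡ᵇ-true⇒≡ m n eq))

-- Defs' update is the instance A = ℕ, definitionally.
_[_≔_] : {A : Set} → (Var → A) → Var → A → Var → A
(ρ [ x ≔ a ]) v = if v ≡ᵇ x then a else ρ v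

≔-same : ∀ {A : Set} (ρ : Var → A) x a → (ρ [ x ≔ a ]) x ≡ a
≔-same ρ x a rewrite ≡ᵇ-refl x = P.refl

≔-other : ∀ {A : Set} (ρ : Var → A) x a v → ¬ v ≡ x → (ρ [ x ≔ a ]) v ≡ ρ v
≔-other ρ x a v v≢x rewrite ≢⇒≡ᵇ-false v x v≢x = P.refl

free-ex⁺ : ∀ x φ v → v ∈ free φ → ¬ v ≡ x → v ∈ free (ex x φ)
free-ex⁺ x φ v m ne = ∈-filter⁺ (λ y → ¬? (y ℕ.≟ x)) m ne

free-ex⁻ : ∀ x φ v → v ∈ free (ex x φ) → v ∈ free φ × ¬ v ≡ x
free-ex⁻ x φ v m = ∈-filter⁻ (λ y → ¬? (y ℕ.≟ x)) m

∈-toList⇒lookup : ∀ {A : Set} {n} (xs : Vec A n) x → x ∈ toList xs → Σ (Fin n) λ i → lookup xs i ≡ x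
∈-toList⇒lookup (y ∷ xs) x (here P.refl) = F.zero , P.refl
∈-toList⇒lookup (y ∷ xs) x (there m) with ∈-toList⇒lookup xs x m
... | i , e = F.suc i , e

module Evaluation {c ℓ} (K : CommutativeSemiring c ℓ) where

  open CommutativeSemiring K
  open CommutativeSemigroupProperties +-commutativeSemigroup using (interchange)
  open SetoidReasoning setoid
  open Semantics K

  Val : Set c
  Val = (Var → ℕ) → Carrier

  sumBelow-cong : ∀ n {f g : ℕ → Carrier} → (∀ d → f d ≈ g d) → sumBelow n f ≈ sumBelow n g
  sumBelow-cong zero e = refl
  sumBelow-cong (suc n) e = +-cong (sumBelow-cong n e) (e n)

  sumBelow-zero : ∀ n {f : ℕ → Carrier} → (∀ d → f d ≈ 0#) → sumBelow n f ≈ 0#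
  sumBelow-zero zero e = refl
  sumBelow-zero (suc n) e = trans (+-cong (sumBelow-zero n e) (e n)) (+-identityˡ 0#)

  sumBelow-+ : ∀ n (f g : ℕ → Carrier) → sumBelow n (λ d → f d + g d) ≈ sumBelow n f + sumBelow n g
  sumBelow-+ zero f g = sym (+-identityˡ 0#)
  sumBelow-+ (suc n) f g = trans (+-cong (sumBelow-+ n f g) refl) (interchange _ _ _ _)

  sumBelow-*ˡ : ∀ n a (f : ℕ → Carrier) → a * sumBelow n f ≈ sumBelow n (λ d → a * f d)
  sumBelow-*ˡ zero a f = zeroʳ a
  sumBelow-*ˡ (suc n) a f = trans (distribˡ a _ _) (+-cong (sumBelow-*ˡ n a f) refl)

  sumBelow-*ʳ : ∀ n a (f : ℕ → Carrier) → sumBelow n f * a ≈ sumBelow n (λ d → f d * a)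
  sumBelow-*ʳ n a f = trans (*-comm _ a) (trans (sumBelow-*ˡ n a f) (sumBelow-cong n (λ d → *-comm a (f d))))

  sumBelow-swap : ∀ n m (g : ℕ → ℕ → Carrier) →
    sumBelow n (λ d → sumBelow m (g d)) ≈ sumBelow m (λ e → sumBelow n (λ d → g d e))
  sumBelow-swap zero m g = sym (sumBelow-zero m (λ _ → refl))
  sumBelow-swap (suc n) m g = begin
    sumBelow n (λ d → sumBelow m (g d)) + sumBelow m (g n) ≈⟨ +-cong (sumBelow-swap n m g) refl ⟩
    sumBelow m (λ e → sumBelow n (λ d → g d e)) + sumBelow m (g n) ≈⟨ sym (sumBelow-+ m _ _) ⟩
    sumBelow m (λ e → sumBelow n (λ d → g d e) + g n e) ∎

  sumBelow-vanishing : ∀ n m (f : ℕ → Carrier) → (∀ d → n ≤ d → f d ≈ 0#) → n ≤ m →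
    sumBelow m f ≈ sumBelow n f
  sumBelow-vanishing n m f vanish n≤m with ℕP.m≤n⇒∃[o]m+o≡n n≤m
  ... | k , P.refl rewrite ℕP.+-comm n k = pad k
    where
    pad : ∀ k → sumBelow (k ℕ.+ n) f ≈ sumBelow n f
    pad zero = refl
    pad (suc k) = trans (+-cong (pad k) (vanish (k ℕ.+ n) (ℕP.m≤n+m n k))) (+-identityʳ _)

  update-same : ∀ ν x d → update ν x d x ≡ d
  update-same = ≔-same

  update-other : ∀ ν x d y → ¬ y ≡ x → update ν x d y ≡ ν y
  update-other = ≔-other

  update-cases : ∀ ν x d y → (y ≡ x × update ν x d y ≡ d) ⊎ (¬ y ≡ x × update ν x d y ≡ ν y)
  update-cases ν x d y with y ℕ.≟ x
  ... | yes P.refl = inj₁ (P.refl , update-same ν x d)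
  ... | no ne = inj₂ (ne , update-other ν x d y ne)

  update-comm : ∀ ν x d y e → ¬ x ≡ y → update (update ν x d) y e ≗ update (update ν y e) x d
  update-comm ν x d y e ne v with update-cases ν x d v | update-cases ν y e v
  ... | inj₁ (P.refl , a) | inj₁ (P.refl , b) = ⊥-elim (ne P.refl)
  ... | inj₁ (P.refl , a) | inj₂ (n2 , b) =
    P.trans (update-other (update ν x d) y e v n2) (P.trans a (P.sym (update-same (update ν y e) x d)))
  ... | inj₂ (n1 , a) | inj₁ (P.refl , b) =
    P.trans (update-same (update ν x d) y e) (P.sym (P.trans (update-other (update ν y e) x d v n1) b))
  ... | inj₂ (n1 , a) | inj₂ (n2 , b) =
    P.trans (update-other (update ν x d) y e v n2) (P.trans a (P.sym (P.trans (update-other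
        (update ν y e) x d v n1) b)))

  update-cong : ∀ {ν ν′ : Var → ℕ} x d → ν ≗ ν′ → update ν x d ≗ update ν′ x d
  update-cong {ν} {ν′} x d e v with update-cases ν x d v | update-cases ν′ x d v
  ... | inj₁ (_ , p) | inj₁ (_ , q) = P.trans p (P.sym q)
  ... | inj₁ (a , _) | inj₂ (b , _) = ⊥-elim (b a)
  ... | inj₂ (b , _) | inj₁ (a , _) = ⊥-elim (b a)
  ... | inj₂ (_ , p) | inj₂ (_ , q) = P.trans p (P.trans (e v) (P.sym q))

  -- Every quantifier ranges over [0, N). Defs' ⟦_⟧ instead bounds each quantifier by bnd
  -- of its own body, which is not preserved by the translations; for N ≥ bnd the two
  -- agree (⟦⟧≈⟦⟧[]).
  ⟦_⟧[_] : Formula → ℕ → DB → Val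
  ⟦ atom (relA R xs) ⟧[ N ] db ν = rel db R (Vec.map ν xs)
  ⟦ atom (leqA x k)  ⟧[ N ] db ν = if ν x ≤ᵇ const db k then 1# else 0#
  ⟦ and φ ψ ⟧[ N ] db ν = ⟦ φ ⟧[ N ] db ν * ⟦ ψ ⟧[ N ] db ν
  ⟦ ex x φ ⟧[ N ] db ν = sumBelow N (λ d → ⟦ φ ⟧[ N ] db (update ν x d))

  AgreeOn : List Var → (Var → ℕ) → (Var → ℕ) → Set
  AgreeOn vs ν ν′ = ∀ v → v ∈ vs → ν v ≡ ν′ v

  map-agreeOn : ∀ {n} (xs : Vec Var n) ν ν′ → AgreeOn (toList xs) ν ν′ → Vec.map ν xs ≡ Vec.map ν′ xs
  map-agreeOn [] ν ν′ a = P.refl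
  map-agreeOn (x ∷ xs) ν ν′ a = P.cong₂ _∷_ (a x (here P.refl)) (map-agreeOn xs ν ν′ (λ v m → a v (there m)))

  update-agreeOn : ∀ vs x d ν ν′ → AgreeOn (filter (λ y → ¬? (y ℕ.≟ x)) vs) ν ν′ →
    AgreeOn vs (update ν x d) (update ν′ x d)
  update-agreeOn vs x d ν ν′ a v m with update-cases ν x d v | update-cases ν′ x d v
  ... | inj₁ (_ , p) | inj₁ (_ , q) = P.trans p (P.sym q)
  ... | inj₁ (e , _) | inj₂ (n , _) = ⊥-elim (n e)
  ... | inj₂ (n , _) | inj₁ (e , _) = ⊥-elim (n e)
  ... | inj₂ (n , p) | inj₂ (_ , q) = P.trans p (P.trans (a v (∈-filter⁺ (λ y → ¬? (y ℕ.≟ x)) m n)) (P.sym q))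

  ⟦⟧[]-agreeOn : ∀ φ N db ν ν′ → AgreeOn (free φ) ν ν′ → ⟦ φ ⟧[ N ] db ν ≈ ⟦ φ ⟧[ N ] db ν′
  ⟦⟧[]-agreeOn (atom (relA R xs)) N db ν ν′ a = reflexive (P.cong (rel db R) (map-agreeOn xs ν ν′ a))
  ⟦⟧[]-agreeOn (atom (leqA x k)) N db ν ν′ a rewrite a x (here P.refl) = refl
  ⟦⟧[]-agreeOn (and φ ψ) N db ν ν′ a =
    *-cong (⟦⟧[]-agreeOn φ N db ν ν′ (λ v m → a v (∈-++⁺ˡ m)))
           (⟦⟧[]-agreeOn ψ N db ν ν′ (λ v m → a v (∈-++⁺ʳ (free φ) m)))
  ⟦⟧[]-agreeOn (ex x φ) N db ν ν′ a =
    sumBelow-cong N (λ d → ⟦⟧[]-agreeOn φ N db _ _ (update-agreeOn (free φ) x d ν ν′ a))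

  ⟦⟧[]-cong : ∀ φ N db {ν ν′} → ν ≗ ν′ → ⟦ φ ⟧[ N ] db ν ≈ ⟦ φ ⟧[ N ] db ν′
  ⟦⟧[]-cong φ N db {ν} {ν′} e = ⟦⟧[]-agreeOn φ N db ν ν′ (λ v _ → e v)

  ≤ᵇ-false : ∀ m n → n ℕ.< m → (m ≤ᵇ n) ≡ false
  ≤ᵇ-false m n lt with m ≤ᵇ n in eq
  ... | false = P.refl
  ... | true = ⊥-elim (ℕP.<⇒≱ lt (ℕP.≤ᵇ⇒≤ m n (P.subst T (P.sym eq) tt)))

  ⟦⟧[]-vanishes-beyond-bnd : ∀ φ N db ν x d → WF φ → x ∈ free φ → bnd db φ ≤ d →
    ⟦ φ ⟧[ N ] db (update ν x d) ≈ 0#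
  ⟦⟧[]-vanishes-beyond-bnd (atom (relA R xs)) N db ν x d w m le with ∈-toList⇒lookup xs x m
  ... | i , e = support db R (Vec.map (update ν x d) xs)
    (i , P.subst (bound db R ≤_) (P.sym (P.trans (VecP.lookup-map i (update ν x d) xs)
                                   (P.trans (P.cong (update ν x d) e) (update-same ν x d)))) le)
  ⟦⟧[]-vanishes-beyond-bnd (atom (leqA y k)) N db ν x d w (here P.refl) le
    rewrite update-same ν y d | ≤ᵇ-false d (const db k) le = refl
  ⟦⟧[]-vanishes-beyond-bnd (and φ ψ) N db ν x d (w1 , w2) m le with ∈-++⁻ (free φ) m
  ... | inj₁ m1 = trans (*-cong (⟦⟧[]-vanishes-beyond-bnd φ N db ν x d w1 m1 (ℕP.≤-trans
      (ℕP.m≤m⊔n _ _) le)) refl) (zeroˡ _)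
  ... | inj₂ m2 = trans (*-cong refl (⟦⟧[]-vanishes-beyond-bnd ψ N db ν x d w2 m2 (ℕP.≤-trans
      (ℕP.m≤n⊔m _ _) le))) (zeroʳ _)
  ⟦⟧[]-vanishes-beyond-bnd (ex y φ) N db ν x d (_ , w) m le with free-ex⁻ y φ x m
  ... | m1 , ne = sumBelow-zero N (λ e → trans (⟦⟧[]-cong φ N db (update-comm ν x d y e ne))
                                        (⟦⟧[]-vanishes-beyond-bnd φ N db (update ν y e) x d w m1 le))

  ⟦⟧≈⟦⟧[] : ∀ φ N db ν → WF φ → bnd db φ ≤ N → ⟦ φ ⟧ db ν ≈ ⟦ φ ⟧[ N ] db ν
  ⟦⟧≈⟦⟧[] (atom (relA R xs)) N db ν w le = refl
  ⟦⟧≈⟦⟧[] (atom (leqA x k)) N db ν w le = refl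
  ⟦⟧≈⟦⟧[] (and φ ψ) N db ν (w1 , w2) le =
    *-cong (⟦⟧≈⟦⟧[] φ N db ν w1 (ℕP.≤-trans (ℕP.m≤m⊔n _ _) le)) (⟦⟧≈⟦⟧[] ψ N db ν w2 (ℕP.≤-trans (ℕP.m≤n⊔m _ _) le))
  ⟦⟧≈⟦⟧[] (ex x φ) N db ν (m , w) le = begin
    sumBelow (bnd db φ) (λ d → ⟦ φ ⟧ db (update ν x d))
      ≈⟨ sumBelow-cong (bnd db φ) (λ d → ⟦⟧≈⟦⟧[] φ N db (update ν x d) w le) ⟩
    sumBelow (bnd db φ) (λ d → ⟦ φ ⟧[ N ] db (update ν x d))
      ≈⟨ sym (sumBelow-vanishing (bnd db φ) N _ (λ d le2 → ⟦⟧[]-vanishes-beyond-bnd φ N db ν x d w m le2) le) ⟩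
    sumBelow N (λ d → ⟦ φ ⟧[ N ] db (update ν x d)) ∎

  Extensional : Val → Set ℓ
  Extensional f = ∀ {ν ν′} → ν ≗ ν′ → f ν ≈ f ν′

  sumVars : ℕ → List Var → Val → Val
  sumVars N [] f ν = f ν
  sumVars N (x ∷ xs) f ν = sumBelow N (λ d → sumVars N xs f (update ν x d))

  sumVars-extensional : ∀ N xs f → Extensional f → Extensional (sumVars N xs f)
  sumVars-extensional N [] f r e = r e
  sumVars-extensional N (x ∷ xs) f r e = sumBelow-cong N (λ d → sumVars-extensional N xs f r (update-cong x d e))

  sumVars-cong : ∀ N xs {f g} → (∀ ν → f ν ≈ g ν) → ∀ ν → sumVars N xs f ν ≈ sumVars N xs g ν
  sumVars-cong N [] e ν = e ν
  sumVars-cong N (x ∷ xs) e ν = sumBelow-cong N (λ d → sumVars-cong N xs e _)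

  sumVars-++ : ∀ N xs ys f ν → sumVars N (xs ++ ys) f ν ≈ sumVars N xs (sumVars N ys f) ν
  sumVars-++ N [] ys f ν = refl
  sumVars-++ N (x ∷ xs) ys f ν = sumBelow-cong N (λ d → sumVars-++ N xs ys f _)

  sumVars-swap : ∀ N x y xs f → Extensional f → ∀ ν → sumVars N (x ∷ y ∷ xs) f ν ≈ sumVars N (y ∷ x ∷ xs) f ν
  sumVars-swap N x y xs f r ν with x ℕ.≟ y
  ... | yes P.refl = refl
  ... | no ne = trans (sumBelow-swap N N _)
     (sumBelow-cong N (λ e → sumBelow-cong N (λ d → sumVars-extensional N xs f r (update-comm ν x d y e ne))))

  sumVars-↭ : ∀ N {xs ys} f → Extensional f → xs ↭ ys → ∀ ν → sumVars N xs f ν ≈ sumVars N ys f ν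
  sumVars-↭ N f r Perm.refl ν = refl
  sumVars-↭ N f r (Perm.prep x p) ν = sumBelow-cong N (λ d → sumVars-↭ N f r p _)
  sumVars-↭ N f r (Perm.swap {xs} {ys} x y p) ν =
    trans (sumVars-swap N x y xs f r ν)
          (sumBelow-cong N (λ d → sumBelow-cong N (λ e → sumVars-↭ N f r p _)))
  sumVars-↭ N f r (Perm.trans p q) ν = trans (sumVars-↭ N f r p ν) (sumVars-↭ N f r q ν)

  sumVars-factorˡ : ∀ N xs (A B : Val) → Extensional B → (∀ ν x d → x ∈ xs → A (update ν x d) ≈ A ν) →
    ∀ ν → sumVars N xs (λ μ → A μ * B μ) ν ≈ A ν * sumVars N xs B ν
  sumVars-factorˡ N [] A B rB inv ν = refl
  sumVars-factorˡ N (x ∷ xs) A B rB inv ν = begin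
    sumBelow N (λ d → sumVars N xs (λ μ → A μ * B μ) (update ν x d))
      ≈⟨ sumBelow-cong N (λ d → sumVars-factorˡ N xs A B rB (λ μ y e m → inv μ y e (there m)) _) ⟩
    sumBelow N (λ d → A (update ν x d) * sumVars N xs B (update ν x d))
      ≈⟨ sumBelow-cong N (λ d → *-cong (inv ν x d (here P.refl)) refl) ⟩
    sumBelow N (λ d → A ν * sumVars N xs B (update ν x d))
      ≈⟨ sym (sumBelow-*ˡ N (A ν) _) ⟩
    A ν * sumVars N (x ∷ xs) B ν ∎

  ⟦exs⟧ : ∀ N db ys φ ν → ⟦ exs ys φ ⟧[ N ] db ν ≈ sumVars N ys (⟦ φ ⟧[ N ] db) ν
  ⟦exs⟧ N db [] φ ν = refl
  ⟦exs⟧ N db (y ∷ ys) φ ν = sumBelow-cong N (λ d → ⟦exs⟧ N db ys φ _)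

  prodOver : {A : Set} → (A → Val) → List A → Val
  prodOver g [] ν = 1#
  prodOver g (a ∷ as) ν = g a ν * prodOver g as ν

  prodOver-++ : {A : Set} (g : A → Val) (xs ys : List A) (ν : Var → ℕ) →
    prodOver g (xs ++ ys) ν ≈ prodOver g xs ν * prodOver g ys ν
  prodOver-++ g [] ys ν = sym (*-identityˡ _)
  prodOver-++ g (x ∷ xs) ys ν = trans (*-cong refl (prodOver-++ g xs ys ν)) (sym (*-assoc _ _ _))

  prodOver-↭ : {A : Set} (g : A → Val) {xs ys : List A} → xs ↭ ys → ∀ ν → prodOver g xs ν ≈ prodOver g ys ν
  prodOver-↭ g Perm.refl ν = refl
  prodOver-↭ g (Perm.prep x p) ν = *-cong refl (prodOver-↭ g p ν)
  prodOver-↭ g (Perm.swap x y p) ν = trans (sym (*-assoc _ _ _))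
    (trans (*-cong (*-comm _ _) (prodOver-↭ g p ν)) (*-assoc _ _ _))
  prodOver-↭ g (Perm.trans p q) ν = trans (prodOver-↭ g p ν) (prodOver-↭ g q ν)

  prodOver-extensional : {A : Set} (g : A → Val) → (∀ a → Extensional (g a)) → (xs : List A) →
    Extensional (prodOver g xs)
  prodOver-extensional g r [] e = refl
  prodOver-extensional g r (x ∷ xs) e = *-cong (r x e) (prodOver-extensional g r xs e)

  atomValue : ℕ → DB → Atom → Val
  atomValue N db a = ⟦ atom a ⟧[ N ] db

  ⟦conjFrom⟧ : ∀ N db a as ν → ⟦ conjFrom a as ⟧[ N ] db ν ≈ prodOver (atomValue N db) (a ∷ as) ν
  ⟦conjFrom⟧ N db a [] ν = sym (*-identityʳ _)
  ⟦conjFrom⟧ N db a (b ∷ bs) ν = *-cong refl (⟦conjFrom⟧ N db b bs ν)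

module JoinTree where

  path-++ : ∀ {n} {E : Edges n} {S} {u v w} → PathIn E S u v → PathIn E S v w → PathIn E S u w
  path-++ here q = q
  path-++ (step e s p) q = step e s (path-++ p q)

  path-map : ∀ {n m} {E : Edges n} {E′ : Edges m} {S : Fin n → Set} {S′ : Fin m → Set}
    (f : Fin n → Fin m) →
    (∀ {a b} → (a , b) ∈ E → (f a , f b) ∈ E′) → (∀ {a} → S a → S′ (f a)) →
    ∀ {u v} → PathIn E S u v → PathIn E′ S′ (f u) (f v)
  path-map f fe fs here = here
  path-map f fe fs (step (inj₁ e) s p) = step (inj₁ (fe e)) (fs s) (path-map f fe fs p)
  path-map f fe fs (step (inj₂ e) s p) = step (inj₂ (fe e)) (fs s) (path-map f fe fs p)

  ∈-lookup-concat : ∀ (hs : List (List Var)) i {v} → v ∈ List.lookup hs i → v ∈ concat hs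
  ∈-lookup-concat hs i m = ∈-concat⁺′ m (∈-lookup {xs = hs} i)

  -- Ears H L: the lists of L, added oldest (last) first, each attach to an earlier node
  -- containing all of their variables that occur so far; a GYO reduction read backwards.
  Attach : List Var → List (List Var) → List Var → Set
  Attach H L h = Σ (List Var) λ n → n ∈ (H ∷ L) × (∀ v → v ∈ h → v ∈ concat (H ∷ L) → v ∈ n)

  data Ears (H : List Var) : List (List Var) → Set where
    nil  : Ears H []
    snoc : ∀ {L h} → Ears H L → Attach H L h → Ears H (h ∷ L)

  emb : ∀ {n} → Fin (suc n) → Fin (suc (suc n))
  emb F.zero = F.zero
  emb (F.suc i) = F.suc (F.suc i)

  emb-map : ∀ {n} → Fin (suc n) × Fin (suc n) → Fin (suc (suc n)) × Fin (suc (suc n))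
  emb-map (a , b) = emb a , emb b

  module _ (H : List Var) (L : List (List Var)) (h : List Var) where
    private
      hs hs′ : List (List Var)
      hs = H ∷ L
      hs′ = H ∷ h ∷ L
    lookup-emb : ∀ i → List.lookup hs′ (emb i) ≡ List.lookup hs i
    lookup-emb F.zero = P.refl
    lookup-emb (F.suc i) = P.refl

    addLeaf : Acyclic hs → (i : Fin (length hs)) →
      (∀ v → v ∈ h → v ∈ concat hs → v ∈ List.lookup hs i) → Acyclic hs′
    addLeaf (E , (len , conn) , runningIntersection) i att = E′ , (len′ , conn′) , runningIntersection′
      where
      E′ : Edges (length hs′)
      E′ = (F.suc F.zero , emb i) ∷ map emb-map E
      len′ : suc (length E′) ≡ length hs′
      len′ = P.cong suc (P.trans (P.cong suc (LP.length-map emb-map E)) len)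
      fe : ∀ {a b} → (a , b) ∈ E → (emb a , emb b) ∈ E′
      fe m = there (∈-map⁺ emb-map m)
      lift : ∀ {S : Fin (length hs) → Set} {S′ : Fin (length hs′) → Set} →
        (∀ {a} → S a → S′ (emb a)) → ∀ {u v} → PathIn E S u v → PathIn E′ S′ (emb u) (emb v)
      lift fs = path-map emb fe fs
      connE : ∀ u v → PathIn E′ (λ _ → ⊤) (emb u) v
      connE u F.zero = lift {S = λ _ → ⊤} (λ _ → tt) (conn u F.zero tt tt)
      connE u (F.suc F.zero) = path-++ (lift {S = λ _ → ⊤} (λ _ → tt) (conn u i tt tt))
                                           (step (inj₂ (here P.refl)) tt here)
      connE u (F.suc (F.suc v)) = lift {S = λ _ → ⊤} (λ _ → tt) (conn u (F.suc v) tt tt)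
      conn′ : ConnectedIn E′ (λ _ → ⊤)
      conn′ F.zero v _ _ = connE F.zero v
      conn′ (F.suc F.zero) v _ _ = step (inj₁ (here P.refl)) tt (connE i v)
      conn′ (F.suc (F.suc u)) v _ _ = connE (F.suc u) v
      runningIntersection′ : ∀ z → ConnectedIn E′ (λ k → z ∈ List.lookup hs′ k)
      runningIntersection′ z = go
        where
        S : Fin (length hs) → Set
        S k = z ∈ List.lookup hs k
        S′ : Fin (length hs′) → Set
        S′ k = z ∈ List.lookup hs′ k
        fs′ : ∀ a → S a → S′ (emb a)
        fs′ a s = P.subst (z ∈_) (P.sym (lookup-emb a)) s
        old : ∀ u v → S u → S v → PathIn E′ S′ (emb u) (emb v)
        old u v su sv = lift {S = S} {S′ = S′} (λ {a} → fs′ a) (runningIntersection z u v su sv)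
        zi : z ∈ h → ∀ u → S u → S (i)
        zi zh u su = att z zh (∈-lookup-concat hs u su)
        go : ∀ u v → S′ u → S′ v → PathIn E′ S′ u v
        go (F.suc F.zero) (F.suc F.zero) su sv = here
        go (F.suc F.zero) F.zero su sv =
          step (inj₁ (here P.refl)) (fs′ i (zi su F.zero sv)) (old i F.zero (zi su F.zero sv) sv)
        go (F.suc F.zero) (F.suc (F.suc v)) su sv =
          step (inj₁ (here P.refl)) (fs′ i (zi su (F.suc v) sv)) (old i (F.suc v) (zi su (F.suc v) sv) sv)
        go F.zero (F.suc F.zero) su sv =
          path-++ (old F.zero i su (zi sv F.zero su)) (step (inj₂ (here P.refl)) sv here)
        go (F.suc (F.suc u)) (F.suc F.zero) su sv =
          path-++ (old (F.suc u) i su (zi sv (F.suc u) su)) (step (inj₂ (here P.refl)) sv here)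
        go F.zero F.zero su sv = old F.zero F.zero su sv
        go F.zero (F.suc (F.suc v)) su sv = old F.zero (F.suc v) su sv
        go (F.suc (F.suc u)) F.zero su sv = old (F.suc u) F.zero su sv
        go (F.suc (F.suc u)) (F.suc (F.suc v)) su sv = old (F.suc u) (F.suc v) su sv

  acyclic-single : ∀ H → Acyclic (H ∷ [])
  acyclic-single H = [] , (P.refl , (λ { F.zero F.zero _ _ → here })) , (λ z → λ { F.zero F.zero _ _ → here })

  Ears⇒Acyclic : ∀ H L → Ears H L → Acyclic (H ∷ L)
  Ears⇒Acyclic H [] nil = acyclic-single H
  Ears⇒Acyclic H (h ∷ L) (snoc e (n , nm , att)) =
    addLeaf H L h (Ears⇒Acyclic H L e) (Any.index nm)
      (λ v vh vc → P.subst (v ∈_) (AnyP.lookup-index nm) (att v vh vc))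

  record IndexBijection {A : Set} (xs ys : List A) : Set where
    field
      to : Fin (length xs) → Fin (length ys)
      from : Fin (length ys) → Fin (length xs)
      to-from : ∀ j → to (from j) ≡ j
      lookup-to : ∀ i → List.lookup ys (to i) ≡ List.lookup xs i
  open IndexBijection

  ↭⇒IndexBijection : {A : Set} {xs ys : List A} → xs ↭ ys → IndexBijection xs ys
  ↭⇒IndexBijection Perm.refl =
    record { to = λ i → i ; from = λ i → i ; to-from = λ _ → P.refl ; lookup-to = λ _ → P.refl }
  ↭⇒IndexBijection {xs = x ∷ xs} {x ∷ ys} (Perm.prep x p) =
    record { to = to′ ; from = from′ ; to-from = to-from′ ; lookup-to = lookup-to′ }
    where
    q : IndexBijection xs ys
    q = ↭⇒IndexBijection p
    to′ : Fin (suc (length xs)) → Fin (suc (length ys))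
    to′ F.zero = F.zero
    to′ (F.suc i) = F.suc (to q i)
    from′ : Fin (suc (length ys)) → Fin (suc (length xs))
    from′ F.zero = F.zero
    from′ (F.suc i) = F.suc (from q i)
    to-from′ : ∀ j → to′ (from′ j) ≡ j
    to-from′ F.zero = P.refl
    to-from′ (F.suc j) = P.cong F.suc (to-from q j)
    lookup-to′ : ∀ i → List.lookup (x ∷ ys) (to′ i) ≡ List.lookup (x ∷ xs) i
    lookup-to′ F.zero = P.refl
    lookup-to′ (F.suc i) = lookup-to q i
  ↭⇒IndexBijection {xs = x ∷ y ∷ xs} {y ∷ x ∷ ys} (Perm.swap x y p) =
    record { to = to′ ; from = from′ ; to-from = to-from′ ; lookup-to = lookup-to′ }
    where
    q : IndexBijection xs ys
    q = ↭⇒IndexBijection p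
    to′ : Fin (suc (suc (length xs))) → Fin (suc (suc (length ys)))
    to′ F.zero = F.suc F.zero
    to′ (F.suc F.zero) = F.zero
    to′ (F.suc (F.suc i)) = F.suc (F.suc (to q i))
    from′ : Fin (suc (suc (length ys))) → Fin (suc (suc (length xs)))
    from′ F.zero = F.suc F.zero
    from′ (F.suc F.zero) = F.zero
    from′ (F.suc (F.suc i)) = F.suc (F.suc (from q i))
    to-from′ : ∀ j → to′ (from′ j) ≡ j
    to-from′ F.zero = P.refl
    to-from′ (F.suc F.zero) = P.refl
    to-from′ (F.suc (F.suc j)) = P.cong (λ k → F.suc (F.suc k)) (to-from q j)
    lookup-to′ : ∀ i → List.lookup (y ∷ x ∷ ys) (to′ i) ≡ List.lookup (x ∷ y ∷ xs) i
    lookup-to′ F.zero = P.refl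
    lookup-to′ (F.suc F.zero) = P.refl
    lookup-to′ (F.suc (F.suc i)) = lookup-to q i
  ↭⇒IndexBijection {xs = xs} {zs} (Perm.trans {ys = ys} p₁ p₂) = record
    { to = λ i → to q₂ (to q₁ i) ; from = λ j → from q₁ (from q₂ j)
    ; to-from = λ j → P.trans (P.cong (to q₂) (to-from q₁ (from q₂ j))) (to-from q₂ j)
    ; lookup-to = λ i → P.trans (lookup-to q₂ (to q₁ i)) (lookup-to q₁ i) }
    where
    q₁ : IndexBijection xs ys
    q₁ = ↭⇒IndexBijection p₁
    q₂ : IndexBijection ys zs
    q₂ = ↭⇒IndexBijection p₂

  Acyclic-↭ : ∀ {xs ys} → xs ↭ ys → Acyclic xs → Acyclic ys
  Acyclic-↭ {xs} {ys} p (E , (len , conn) , runningIntersection) = E′ , (len′ , conn′) , runningIntersection′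
    where
    q : IndexBijection xs ys
    q = ↭⇒IndexBijection p
    to² : Fin (length xs) × Fin (length xs) → Fin (length ys) × Fin (length ys)
    to² (a , b) = to q a , to q b
    E′ : Edges (length ys)
    E′ = map to² E
    len′ : suc (length E′) ≡ length ys
    len′ = P.trans (P.cong suc (LP.length-map to² E)) (P.trans len (PermP.↭-length p))
    edge : ∀ {a b} → (a , b) ∈ E → (to q a , to q b) ∈ E′
    edge m = ∈-map⁺ to² m
    conn′ : ConnectedIn E′ (λ _ → ⊤)
    conn′ u v _ _ = P.subst₂ (PathIn E′ (λ _ → ⊤)) (to-from q u) (to-from q v)
      (path-map (to q) edge (λ _ → tt) (conn (from q u) (from q v) tt tt))
    runningIntersection′ : ∀ z → ConnectedIn E′ (λ k → z ∈ List.lookup ys k)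
    runningIntersection′ z u v su sv = P.subst₂ (PathIn E′ S′) (to-from q u) (to-from q v)
      (path-map {S = S} {S′} (to q) edge (λ {a} s → P.subst (z ∈_) (P.sym (lookup-to q a)) s)
        (runningIntersection z (from q u) (from q v) (back u su) (back v sv)))
      where
      S : Fin (length xs) → Set
      S k = z ∈ List.lookup xs k
      S′ : Fin (length ys) → Set
      S′ k = z ∈ List.lookup ys k
      back : ∀ u → S′ u → S (from q u)
      back u s = P.subst (z ∈_) (P.trans (P.cong (List.lookup ys) (P.sym (to-from q u))) (lookup-to q (from q u))) s

  open import Data.Nat using (_+_)

  AcyclicFamily : (n : ℕ) → (Fin n → List Var) → Set
  AcyclicFamily n node = Σ (Edges n) λ E → IsTree n E × (∀ z → ConnectedIn E (λ i → z ∈ node i))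

  Adj : ∀ {m} → Edges m → Fin m → Fin m → Set
  Adj E u w = (u , w) ∈ E ⊎ (w , u) ∈ E

  indicator : ∀ {m} → Fin m → Fin m → ℕ
  indicator a v with a F.≟ v
  ... | yes _ = 1
  ... | no _ = 0

  deg : ∀ {m} → Edges m → Fin m → ℕ
  deg [] v = 0
  deg ((a , b) ∷ E) v = indicator a v + indicator b v + deg E v

  indicator-suc : ∀ {m} (a v : Fin m) → indicator (F.suc a) (F.suc v) ≡ indicator a v
  indicator-suc a v with a F.≟ v
  ... | yes P.refl = P.refl
  ... | no ne = P.refl

  indicator-self : ∀ {m} (a : Fin m) → indicator a a ≡ 1
  indicator-self a with a F.≟ a
  ... | yes _ = P.refl
  ... | no ne = ⊥-elim (ne P.refl)

  sum-indicator : ∀ {m} (a : Fin m) → ℕΣ.sum (indicator a) ≡ 1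
  sum-indicator {suc m} F.zero = P.cong suc (ℕΣ.sum-replicate-zero m)
  sum-indicator (F.suc a) = P.trans (ℕΣ.sum-cong-≗ (indicator-suc a)) (sum-indicator a)

  handshake : ∀ {m} (E : Edges m) → ℕΣ.sum (deg E) ≡ length E + length E
  handshake {m} [] = ℕΣ.sum-replicate-zero m
  handshake ((a , b) ∷ E) = begin
    ℕΣ.sum (λ v → indicator a v + indicator b v + deg E v)
      ≡⟨ ℕΣ.∑-distrib-+ (λ v → indicator a v + indicator b v) (deg E) ⟩
    ℕΣ.sum (λ v → indicator a v + indicator b v) + ℕΣ.sum (deg E)
      ≡⟨ P.cong₂ _+_ (P.trans (ℕΣ.∑-distrib-+ (indicator a) (indicator b))
                              (P.cong₂ _+_ (sum-indicator a) (sum-indicator b)))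
                     (handshake E) ⟩
    2 + (length E + length E)
      ≡⟨ P.cong suc (P.sym (ℕP.+-suc (length E) (length E))) ⟩
    suc (length E) + suc (length E) ∎
    where open P.≡-Reasoning

  sum-lower : ∀ m (f : Fin (suc m) → ℕ) → 1 ≤ f F.zero → (∀ v → 2 ≤ f (F.suc v)) → suc (m + m) ≤ ℕΣ.sum f
  sum-lower m f f0≥1 fs≥2 = ℕP.+-mono-≤ f0≥1 (all≥2 m (λ v → f (F.suc v)) fs≥2)
    where
    all≥2 : ∀ k (g : Fin k → ℕ) → (∀ v → 2 ≤ g v) → k + k ≤ ℕΣ.sum g
    all≥2 zero g h = z≤n
    all≥2 (suc k) g h rewrite ℕP.+-suc k k =
      ℕP.+-mono-≤ (h F.zero) (all≥2 k (λ v → g (F.suc v)) (λ v → h (F.suc v)))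

  deg-adj : ∀ {m} (E : Edges m) {u w} → Adj E u w → 1 ≤ deg E u
  deg-adj ((a , b) ∷ E) (inj₁ (here P.refl)) rewrite indicator-self a = s≤s z≤n
  deg-adj ((a , b) ∷ E) (inj₂ (here P.refl)) rewrite indicator-self b = ℕP.≤-trans (ℕP.m≤n+m 1
      (indicator a b)) (ℕP.m≤m+n _ (deg E b))
  deg-adj ((a , b) ∷ E) {u} (inj₁ (there m)) = ℕP.≤-trans (deg-adj E (inj₁ m)) (ℕP.m≤n+m _
      (indicator a u + indicator b u))
  deg-adj ((a , b) ∷ E) {u} (inj₂ (there m)) = ℕP.≤-trans (deg-adj E (inj₂ m)) (ℕP.m≤n+m _
      (indicator a u + indicator b u))

  dropEdgesAt : ∀ {m} → Edges m → Fin m → Edges m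
  dropEdgesAt [] l = []
  dropEdgesAt ((a , b) ∷ E) l with a F.≟ l | b F.≟ l
  ... | no _ | no _ = (a , b) ∷ dropEdgesAt E l
  ... | yes _ | _ = dropEdgesAt E l
  ... | no _ | yes _ = dropEdgesAt E l

  dropEdgesAt-∈ : ∀ {m} (E : Edges m) l {a b} → (a , b) ∈ E → ¬ a ≡ l → ¬ b ≡ l → (a , b) ∈ dropEdgesAt E l
  dropEdgesAt-∈ ((a , b) ∷ E) l (here P.refl) na nb with a F.≟ l | b F.≟ l
  ... | no _ | no _ = here P.refl
  ... | yes e | _ = ⊥-elim (na e)
  ... | no _ | yes e = ⊥-elim (nb e)
  dropEdgesAt-∈ ((a , b) ∷ E) l (there m) na nb with a F.≟ l | b F.≟ l
  ... | no _ | no _ = there (dropEdgesAt-∈ E l m na nb)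
  ... | yes e | _ = dropEdgesAt-∈ E l m na nb
  ... | no _ | yes e = dropEdgesAt-∈ E l m na nb

  deg0⇒isolated : ∀ {m} (E : Edges m) l {w} → deg E l ≡ 0 → ¬ Adj E l w
  deg0⇒isolated E l d a with deg-adj E a
  ... | le rewrite d = ℕP.<⇒≱ le z≤n

  deg0⇒dropEdgesAt-length : ∀ {m} (E : Edges m) l → deg E l ≡ 0 → length (dropEdgesAt E l) ≡ length E
  deg0⇒dropEdgesAt-length [] l d = P.refl
  deg0⇒dropEdgesAt-length ((a , b) ∷ E) l d with a F.≟ l | b F.≟ l
  ... | no _ | no _ = P.cong suc (deg0⇒dropEdgesAt-length E l d)
  ... | yes _ | _ = ⊥-elim (ℕP.<⇒≱ (s≤s z≤n) (P.subst (_≤ 0) P.refl (ℕP.≤-reflexive d)))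
  ... | no _ | yes _ = ⊥-elim (ℕP.<⇒≱ (s≤s z≤n) (ℕP.≤-reflexive d))

  dropEdgesAt-hitˡ : ∀ {m} (E : Edges m) a b l → a ≡ l → dropEdgesAt ((a , b) ∷ E) l ≡ dropEdgesAt E l
  dropEdgesAt-hitˡ E a b l e with a F.≟ l | b F.≟ l
  ... | no n | _ = ⊥-elim (n e)
  ... | yes _ | _ = P.refl

  dropEdgesAt-hitʳ : ∀ {m} (E : Edges m) a b l → ¬ a ≡ l → b ≡ l →
    dropEdgesAt ((a , b) ∷ E) l ≡ dropEdgesAt E l
  dropEdgesAt-hitʳ E a b l na e with a F.≟ l | b F.≟ l
  ... | yes x | _ = ⊥-elim (na x)
  ... | no _ | no n = ⊥-elim (n e)
  ... | no _ | yes _ = P.refl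

  dropEdgesAt-miss : ∀ {m} (E : Edges m) a b l → ¬ a ≡ l → ¬ b ≡ l →
    dropEdgesAt ((a , b) ∷ E) l ≡ (a , b) ∷ dropEdgesAt E l
  dropEdgesAt-miss E a b l na nb with a F.≟ l | b F.≟ l
  ... | yes x | _ = ⊥-elim (na x)
  ... | no _ | yes x = ⊥-elim (nb x)
  ... | no _ | no _ = P.refl

  record Leaf {m} (E : Edges m) (l : Fin m) : Set where
    field
      neighbour : Fin m
      neighbour≢leaf : ¬ neighbour ≡ l
      adjacent : Adj E l neighbour
      only-neighbour : ∀ w → Adj E l w → w ≡ neighbour
      dropEdgesAt-length : suc (length (dropEdgesAt E l)) ≡ length E

  deg1⇒Leaf : ∀ {m} (E : Edges m) l → deg E l ≡ 1 → Leaf E l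
  deg1⇒Leaf [] l ()
  deg1⇒Leaf ((a , b) ∷ E) l d with a F.≟ l | b F.≟ l
  ... | yes P.refl | yes _ = ⊥-elim (ℕP.<⇒≱ (s≤s (s≤s z≤n)) (ℕP.≤-reflexive d))
  ... | yes P.refl | no nb = record
    { neighbour = b ; neighbour≢leaf = nb ; adjacent = inj₁ (here P.refl)
    ; only-neighbour = un ; dropEdgesAt-length = P.cong suc (P.trans (P.cong length
        (dropEdgesAt-hitˡ E a b a P.refl)) (deg0⇒dropEdgesAt-length E a d0)) }
    where
    d0 : deg E a ≡ 0
    d0 = ℕP.suc-injective d
    un : ∀ w → Adj ((a , b) ∷ E) a w → w ≡ b
    un w (inj₁ (here P.refl)) = P.refl
    un w (inj₂ (here P.refl)) = ⊥-elim (nb P.refl)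
    un w (inj₁ (there m)) = ⊥-elim (deg0⇒isolated E a d0 (inj₁ m))
    un w (inj₂ (there m)) = ⊥-elim (deg0⇒isolated E a d0 (inj₂ m))
  ... | no na | yes P.refl = record
    { neighbour = a ; neighbour≢leaf = na ; adjacent = inj₂ (here P.refl)
    ; only-neighbour = un ; dropEdgesAt-length = P.cong suc (P.trans (P.cong length
        (dropEdgesAt-hitʳ E a b b na P.refl)) (deg0⇒dropEdgesAt-length E b d0)) }
    where
    d0 : deg E b ≡ 0
    d0 = ℕP.suc-injective d
    un : ∀ w → Adj ((a , b) ∷ E) b w → w ≡ a
    un w (inj₁ (here P.refl)) = ⊥-elim (na P.refl)
    un w (inj₂ (here P.refl)) = P.refl
    un w (inj₁ (there m)) = ⊥-elim (deg0⇒isolated E b d0 (inj₁ m))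
    un w (inj₂ (there m)) = ⊥-elim (deg0⇒isolated E b d0 (inj₂ m))
  ... | no na | no nb = record
    { neighbour = Leaf.neighbour r ; neighbour≢leaf = Leaf.neighbour≢leaf r ; adjacent = Sum.map there there (Leaf.adjacent r)
    ; only-neighbour = un ; dropEdgesAt-length = P.cong suc (P.trans (P.cong length
        (dropEdgesAt-miss E a b l na nb)) (Leaf.dropEdgesAt-length r)) }
    where
    r : Leaf E l
    r = deg1⇒Leaf E l d
    un : ∀ w → Adj ((a , b) ∷ E) l w → w ≡ Leaf.neighbour r
    un w (inj₁ (here P.refl)) = ⊥-elim (na P.refl)
    un w (inj₂ (here P.refl)) = ⊥-elim (nb P.refl)
    un w (inj₁ (there m)) = Leaf.only-neighbour r w (inj₁ m)
    un w (inj₂ (there m)) = Leaf.only-neighbour r w (inj₂ m)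

  removeIndex : ∀ {m} (l : Fin (suc (suc m))) → Fin (suc (suc m)) → Fin (suc m)
  removeIndex l j with l F.≟ j
  ... | yes _ = F.zero
  ... | no ne = F.punchOut ne

  removeIndex-punchIn : ∀ {m} (l : Fin (suc (suc m))) k → removeIndex l (F.punchIn l k) ≡ k
  removeIndex-punchIn l k with l F.≟ F.punchIn l k
  ... | yes e = ⊥-elim (FP.punchInᵢ≢i l k (P.sym e))
  ... | no ne = P.trans (FP.punchOut-cong l P.refl) (FP.punchOut-punchIn l)

  punchIn-removeIndex : ∀ {m} (l : Fin (suc (suc m))) j → ¬ j ≡ l → F.punchIn l (removeIndex l j) ≡ j
  punchIn-removeIndex l j nj with l F.≟ j
  ... | yes e = ⊥-elim (nj (P.sym e))
  ... | no ne = FP.punchIn-punchOut ne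

  module RemoveLeaf {m} (E : Edges (suc (suc m))) (l : Fin (suc (suc m))) (leaf : Leaf E l) where
    open Leaf leaf
    dm : Fin (suc (suc m)) × Fin (suc (suc m)) → Fin (suc m) × Fin (suc m)
    dm (a , b) = removeIndex l a , removeIndex l b
    E′ : Edges (suc m)
    E′ = map dm (dropEdgesAt E l)

    adj′ : ∀ {u w} → Adj E u w → ¬ u ≡ l → ¬ w ≡ l → Adj E′ (removeIndex l u) (removeIndex l w)
    adj′ (inj₁ e) nu nw = inj₁ (∈-map⁺ dm (dropEdgesAt-∈ E l e nu nw))
    adj′ (inj₂ e) nu nw = inj₂ (∈-map⁺ dm (dropEdgesAt-∈ E l e nw nu))

    module _ {S : Fin (suc (suc m)) → Set} where
      S′ : Fin (suc m) → Set
      S′ k = S (F.punchIn l k)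
      mutual
        shorten : ∀ {u v} → PathIn E S u v → ¬ u ≡ l → ¬ v ≡ l →
          PathIn E′ S′ (removeIndex l u) (removeIndex l v)
        shorten here nu nv = here
        shorten (step {u} {w} e s rest) nu nv with w F.≟ l
        ... | no nw = step (adj′ e nu nw) (P.subst S (P.sym (punchIn-removeIndex l w nw)) s) (shorten rest nw nv)
        ... | yes P.refl = through (only-neighbour u (Sum.swap e)) rest nv
        through : ∀ {u v} → u ≡ neighbour → PathIn E S l v → ¬ v ≡ l →
          PathIn E′ S′ (removeIndex l u) (removeIndex l v)
        through eu here nv = ⊥-elim (nv P.refl)
        through eu (step {_} {w2} e2 s2 rest2) nv =
          P.subst (λ x → PathIn E′ S′ (removeIndex l x) _) (P.trans (only-neighbour w2 e2) (P.sym eu))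
            (shorten rest2 (λ q → neighbour≢leaf (P.trans (P.sym (only-neighbour w2 e2)) q)) nv)

    acyclic-without-leaf : ∀ (node : Fin (suc (suc m)) → List Var) → IsTree (suc (suc m)) E →
      (∀ z → ConnectedIn E (λ i → z ∈ node i)) → AcyclicFamily (suc m) (λ k → node (F.punchIn l k))
    acyclic-without-leaf node (len , conn) runningIntersection = E′ , (len′ , conn′) , runningIntersection′
      where
      len′ : suc (length E′) ≡ suc m
      len′ = P.trans (P.cong suc (LP.length-map dm (dropEdgesAt E l))) (ℕP.suc-injective (P.trans
          (P.cong suc dropEdgesAt-length) len))
      fix : ∀ {S : Fin (suc (suc m)) → Set} u v →
        PathIn E′ (S′ {S}) (removeIndex l (F.punchIn l u)) (removeIndex l (F.punchIn l v)) →
        PathIn E′ (S′ {S}) u v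
      fix {S} u v p = P.subst₂ (PathIn E′ (S′ {S})) (removeIndex-punchIn l u) (removeIndex-punchIn l v) p
      conn′ : ConnectedIn E′ (λ _ → ⊤)
      conn′ u v _ _ = fix u v (shorten (conn (F.punchIn l u) (F.punchIn l v) tt tt) (FP.punchInᵢ≢i l u)
          (FP.punchInᵢ≢i l v))
      runningIntersection′ : ∀ z → ConnectedIn E′ (λ k → z ∈ node (F.punchIn l k))
      runningIntersection′ z u v su sv = fix {λ i → z ∈ node i} u v
        (shorten (runningIntersection z (F.punchIn l u) (F.punchIn l v) su sv) (FP.punchInᵢ≢i l u) (FP.punchInᵢ≢i l v))

  tabulate-remove : ∀ {A : Set} n (f : Fin (suc n) → A) i →
    List.tabulate f ↭ f i ∷ List.tabulate (λ k → f (F.punchIn i k))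
  tabulate-remove n f F.zero = Perm.refl
  tabulate-remove (suc n) f (F.suc i) =
    Perm.trans (Perm.prep (f F.zero) (tabulate-remove n (λ k → f (F.suc k)) i)) (Perm.swap (f F.zero) (f
        (F.suc i)) Perm.refl)

  -- If every node but 0 had degree ≥ 2, the degrees would sum to more than 2 |E|.
  tree-has-leaf : ∀ m (E : Edges (suc (suc m))) → IsTree (suc (suc m)) E → Σ (Fin (suc m)) λ j →
    deg E (F.suc j) ≡ 1
  tree-has-leaf m E (len , conn) with FP.¬∀⟶∃¬ (suc m) (λ j → 2 ≤ deg E (F.suc j)) (λ j → 2 ℕ.≤? deg E (F.suc j)) contra
    where
    d0 : 1 ≤ deg E F.zero
    d0 with conn F.zero (F.suc F.zero) tt tt
    ... | step e _ _ = deg-adj E e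
    lenE : length E ≡ suc m
    lenE = ℕP.suc-injective len
    contra : ¬ (∀ j → 2 ≤ deg E (F.suc j))
    contra all = ℕP.<-irrefl P.refl (ℕP.≤-trans (sum-lower (suc m) (deg E) d0 all)
                   (ℕP.≤-reflexive (P.trans (handshake E) (P.cong₂ _+_ lenE lenE))))
  ... | j , n2 = j , ℕP.≤-antisym (ℕP.≤-pred (ℕP.≰⇒> n2)) leaf≥1
    where
    leaf≥1 : 1 ≤ deg E (F.suc j)
    leaf≥1 with conn (F.suc j) F.zero tt tt
    ... | step e _ _ = deg-adj E e

  earsFromJoinTree : ∀ m (node : Fin (suc m) → List Var) → AcyclicFamily (suc m) node →
    Σ (List (List Var)) λ L′ → (L′ ↭ List.tabulate (λ i → node (F.suc i))) × Ears (node F.zero) L′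
  earsFromJoinTree zero node a = [] , Perm.refl , nil
  earsFromJoinTree (suc m) node (E , tree , runningIntersection) = (node l ∷ L′′) , perm , snoc ears
      (node neighbour , memNode neighbour neighbour≢leaf , cond)
    where
    lj : Σ (Fin (suc m)) λ j → deg E (F.suc j) ≡ 1
    lj = tree-has-leaf m E tree
    j : Fin (suc m)
    j = proj₁ lj
    l : Fin (suc (suc m))
    l = F.suc j
    leaf : Leaf E l
    leaf = deg1⇒Leaf E l (proj₂ lj)
    open Leaf leaf
    rec : Σ (List (List Var)) λ L′ → (L′ ↭ List.tabulate (λ i →
      node (F.punchIn l (F.suc i)))) × Ears (node F.zero) L′
    rec = earsFromJoinTree m (λ k → node (F.punchIn l k))
        (RemoveLeaf.acyclic-without-leaf E l leaf node tree runningIntersection)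
    L′′ : List (List Var)
    L′′ = proj₁ rec
    p : L′′ ↭ List.tabulate (λ i → node (F.punchIn l (F.suc i)))
    p = proj₁ (proj₂ rec)
    ears : Ears (node F.zero) L′′
    ears = proj₂ (proj₂ rec)
    perm : node l ∷ L′′ ↭ List.tabulate (λ i → node (F.suc i))
    perm = Perm.trans (Perm.prep (node l) p) (Perm.↭-sym (tabulate-remove m (λ i → node (F.suc i)) j))
    memNode : ∀ k → ¬ k ≡ l → node k ∈ (node F.zero ∷ L′′)
    memNode k nk = P.subst (λ x → node x ∈ (node F.zero ∷ L′′)) (punchIn-removeIndex l k nk) (go (removeIndex l k))
      where
      go : ∀ k₀ → node (F.punchIn l k₀) ∈ (node F.zero ∷ L′′)
      go F.zero = here P.refl
      go (F.suc k₁) = there (PermP.∈-resp-↭ (Perm.↭-sym p) (∈-tabulate⁺ {f = λ i → node (F.punchIn l (F.suc i))} k₁))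
    which : ∀ xs → xs ∈ (node F.zero ∷ L′′) → Σ (Fin (suc (suc m))) λ k → ¬ k ≡ l × xs ≡ node k
    which xs (here e) = F.zero , (λ ()) , e
    which xs (there mm) with ∈-tabulate⁻ (PermP.∈-resp-↭ p mm)
    ... | k₁ , e = F.punchIn l (F.suc k₁) , FP.punchInᵢ≢i l (F.suc k₁) , e
    cond : ∀ v → v ∈ node l → v ∈ concat (node F.zero ∷ L′′) → v ∈ node neighbour
    cond v vl vc with ∈-concat⁻′ (node F.zero ∷ L′′) vc
    ... | xs , vxs , xsm with which xs xsm
    ... | k , nk , P.refl with runningIntersection v l k vl vxs
    ... | here = ⊥-elim (nk P.refl)
    ... | step {_} {w} e s _ = P.subst (λ x → v ∈ node x) (only-neighbour w e) s

  Acyclic⇒Ears : ∀ H L → Acyclic (H ∷ L) → Σ (List (List Var)) λ L′ → (L′ ↭ L) × Ears H L′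
  Acyclic⇒Ears H L a with earsFromJoinTree (length L) (List.lookup (H ∷ L)) a
  ... | L′ , p , e = L′ , P.subst (L′ ↭_) (LP.tabulate-lookup L) p , e

module Elimination where

  open JoinTree

  data Distinct : List Var → Set where
    []  : Distinct []
    _∷_ : ∀ {x xs} → x ∉ xs → Distinct xs → Distinct (x ∷ xs)

  filter-distinct : ∀ {p} {Q : Var → Set p} (Q? : ∀ v → Dec (Q v)) {xs} → Distinct xs →
    Distinct (filter Q? xs)
  filter-distinct Q? [] = []
  filter-distinct Q? {x ∷ xs} (nx ∷ u) with Q? x
  ... | yes _ = (λ m → nx (proj₁ (∈-filter⁻ Q? m))) ∷ filter-distinct Q? u
  ... | no _ = filter-distinct Q? u

  partition-↭ : ∀ {p} {Q : Var → Set p} (Q? : ∀ v → Dec (Q v)) xs →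
    xs ↭ filter (λ v → ¬? (Q? v)) xs ++ filter Q? xs
  partition-↭ Q? [] = Perm.refl
  partition-↭ Q? (x ∷ xs) with Q? x
  ... | yes q = Perm.trans (Perm.prep x (partition-↭ Q? xs))
                  (Perm.↭-sym (PermP.shift x (filter (λ v → ¬? (Q? v)) xs) (filter Q? xs)))
  ... | no nq = Perm.prep x (partition-↭ Q? xs)

  free-exs⁻ : ∀ P ψ v → v ∈ free (exs P ψ) → v ∈ free ψ × v ∉ P
  free-exs⁻ [] ψ v m = m , λ ()
  free-exs⁻ (p ∷ P) ψ v m with ∈-filter⁻ (λ y → ¬? (y ℕ.≟ p)) {xs = free (exs P ψ)} m
  ... | m1 , np with free-exs⁻ P ψ v m1
  ... | a , b = a , λ { (here e) → np e ; (there x) → b x }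

  free-exs⁺ : ∀ P ψ v → v ∈ free ψ → v ∉ P → v ∈ free (exs P ψ)
  free-exs⁺ [] ψ v m n = m
  free-exs⁺ (p ∷ P) ψ v m n =
    ∈-filter⁺ (λ y → ¬? (y ℕ.≟ p)) (free-exs⁺ P ψ v m (λ x → n (there x))) (λ e → n (here e))

  WF-exs : ∀ P ψ → Distinct P → (∀ p → p ∈ P → p ∈ free ψ) → WF ψ → WF (exs P ψ)
  WF-exs [] ψ u f w = w
  WF-exs (p ∷ P) ψ (np ∷ u) f w =
    free-exs⁺ P ψ p (f p (here P.refl)) np , WF-exs P ψ u (λ q m → f q (there m)) w

  relArities-exs : ∀ P ψ → relArities (exs P ψ) ≡ relArities ψ
  relArities-exs [] ψ = P.refl
  relArities-exs (p ∷ P) ψ = relArities-exs P ψ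

  AtMostTwo : List Var → Set
  AtMostTwo D = Σ Var λ a → Σ Var λ b → ∀ v → v ∈ D → v ≡ a ⊎ v ≡ b

  TwoVariableScopes : Formula → Set
  TwoVariableScopes (atom a) = ⊤
  TwoVariableScopes (and φ ψ) = TwoVariableScopes φ × TwoVariableScopes ψ
  TwoVariableScopes (ex x φ) = AtMostTwo (free φ) × TwoVariableScopes φ

  TwoVariableScopes-exs : ∀ P ψ D → AtMostTwo D → (∀ v → v ∈ free ψ → v ∈ D) → TwoVariableScopes ψ →
    TwoVariableScopes (exs P ψ)
  TwoVariableScopes-exs [] ψ D s sub t = t
  TwoVariableScopes-exs (p ∷ P) ψ D (a , b , s) sub t =
    (a , b , λ v m → s v (sub v (proj₁ (free-exs⁻ P ψ v m)))) , TwoVariableScopes-exs P ψ D (a , b , s) sub t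

  -- A node is labelled by the conjunction of everything absorbed into it so far;
  -- nothing is the empty conjunction.
  Label : Set
  Label = Maybe Formula

  freeᴸ : Label → List Var
  freeᴸ nothing = []
  freeᴸ (just φ) = free φ

  andᴸ : Label → Label → Label
  andᴸ nothing y = y
  andᴸ (just a) nothing = just a
  andᴸ (just a) (just b) = just (and a b)

  freeᴸ-andᴸ⁻ : ∀ x y v → v ∈ freeᴸ (andᴸ x y) → v ∈ freeᴸ x ⊎ v ∈ freeᴸ y
  freeᴸ-andᴸ⁻ nothing y v m = inj₂ m
  freeᴸ-andᴸ⁻ (just a) nothing v m = inj₁ m
  freeᴸ-andᴸ⁻ (just a) (just b) v m = ∈-++⁻ (free a) m

  freeᴸ-andᴸ⁺ˡ : ∀ x y v → v ∈ freeᴸ x → v ∈ freeᴸ (andᴸ x y)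
  freeᴸ-andᴸ⁺ˡ (just a) nothing v m = m
  freeᴸ-andᴸ⁺ˡ (just a) (just b) v m = ∈-++⁺ˡ m

  freeᴸ-andᴸ⁺ʳ : ∀ x y v → v ∈ freeᴸ y → v ∈ freeᴸ (andᴸ x y)
  freeᴸ-andᴸ⁺ʳ nothing y v m = m
  freeᴸ-andᴸ⁺ʳ (just a) (just b) v m = ∈-++⁺ʳ (free a) m

  exsᴸ : List Var → Label → Label
  exsᴸ P nothing = nothing
  exsᴸ P (just ψ) = just (exs P ψ)

  Admissible : List Var → Label → Set
  Admissible D nothing = ⊤
  Admissible D (just ψ) = WF ψ × TwoVariableScopes ψ × All (_≤ 2) (relArities ψ) × (∀ v → v ∈ free ψ → v ∈ D)

  Admissible-andᴸ : ∀ D x y → Admissible D x → Admissible D y → Admissible D (andᴸ x y)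
  Admissible-andᴸ D nothing y ox oy = oy
  Admissible-andᴸ D (just a) nothing ox oy = ox
  Admissible-andᴸ D (just a) (just b) (w1 , t1 , r1 , f1) (w2 , t2 , r2 , f2) =
    (w1 , w2) , (t1 , t2) , AllP.++⁺ r1 r2 , λ v m → Sum.[ f1 v , f2 v ] (∈-++⁻ (free a) m)

  Labels : List (List Var) → Set
  Labels hs = All (λ _ → Label) hs

  freeLabels : ∀ {hs} → Labels hs → List Var
  freeLabels [] = []
  freeLabels (f ∷ fs) = freeᴸ f ++ freeLabels fs

  AllAdmissible : ∀ {hs} → Labels hs → Set
  AllAdmissible {[]} [] = ⊤
  AllAdmissible {D ∷ hs} (f ∷ fs) = Admissible D f × AllAdmissible fs

  updateAt : ∀ {hs n} → n ∈ hs → (Label → Label) → Labels hs → Labels hs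
  updateAt (here P.refl) g (f ∷ fs) = g f ∷ fs
  updateAt (there m) g (f ∷ fs) = f ∷ updateAt m g fs

  Private : List Var → Label → Var → Set
  Private D f v = v ∈ freeᴸ f × v ∉ D

  private? : ∀ D f v → Dec (Private D f v)
  private? D f v = (v ∈? freeᴸ f) ×-dec (¬? (v ∈? D))

  privateVars : List Var → List Var → Label → List Var
  privateVars Y D f = filter (private? D f) Y

  remainingVars : List Var → List Var → Label → List Var
  remainingVars Y D f = filter (λ v → ¬? (private? D f v)) Y

  absorb : List Var → Label → Label → Label
  absorb P f old = andᴸ old (exsᴸ P f)

  -- Variables still to be quantified that occur in the newest ear but not in the node it
  -- attaches to occur in no other node (running intersection), so they are quantified
  -- inside the ear before it is absorbed.
  eliminate : ∀ {H L} → Ears H L → Labels (H ∷ L) → List Var → Label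
  eliminate nil (fH ∷ []) Y = fH
  eliminate (snoc e (n , nm , att)) (fH ∷ fh ∷ fs) Y =
    eliminate e (updateAt nm (absorb (privateVars Y n fh) fh) (fH ∷ fs)) (remainingVars Y n fh)

  record Invariant {H L} (fs : Labels (H ∷ L)) (Y : List Var) : Set where
    field
      admissible : AllAdmissible fs
      small : All AtMostTwo (H ∷ L)
      free⊆head∪Y : ∀ v → v ∈ freeLabels fs → v ∈ H ⊎ v ∈ Y
      Y⊆freeEars : ∀ v → v ∈ Y → v ∈ freeLabels (All.tail fs)
      head⊆free : ∀ v → v ∈ H → v ∈ freeLabels fs
      Y∉head : ∀ v → v ∈ Y → v ∉ H
      distinctY : Distinct Y

  freeLabels⊆nodes : ∀ {hs} (fs : Labels hs) → AllAdmissible fs → ∀ v → v ∈ freeLabels fs → v ∈ concat hs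
  freeLabels⊆nodes {D ∷ hs} (nothing ∷ fs) (_ , ok) v m = ∈-++⁺ʳ D (freeLabels⊆nodes fs ok v m)
  freeLabels⊆nodes {D ∷ hs} (just ψ ∷ fs) ((_ , _ , _ , sub) , ok) v m with ∈-++⁻ (free ψ) m
  ... | inj₁ m1 = ∈-++⁺ˡ (sub v m1)
  ... | inj₂ m2 = ∈-++⁺ʳ D (freeLabels⊆nodes fs ok v m2)

  freeᴸ⊆node : ∀ D f → Admissible D f → ∀ v → v ∈ freeᴸ f → v ∈ D
  freeᴸ⊆node D (just ψ) (_ , _ , _ , sub) v m = sub v m

  module _ (g : Label → Label) (X : List Var)
           (gfree⁻ : ∀ x v → v ∈ freeᴸ (g x) → v ∈ freeᴸ x ⊎ v ∈ X)
           (gfreeˡ : ∀ x v → v ∈ freeᴸ x → v ∈ freeᴸ (g x))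
           (gfreeʳ : ∀ x v → v ∈ X → v ∈ freeᴸ (g x)) where
    updateAt-free⁻ : ∀ {hs n} (nm : n ∈ hs) (fs : Labels hs) v → v ∈ freeLabels (updateAt nm g fs) →
      v ∈ freeLabels fs ⊎ v ∈ X
    updateAt-free⁻ (here P.refl) (f ∷ fs) v m with ∈-++⁻ (freeᴸ (g f)) m
    ... | inj₂ m2 = inj₁ (∈-++⁺ʳ (freeᴸ f) m2)
    ... | inj₁ m1 with gfree⁻ f v m1
    ...   | inj₁ a = inj₁ (∈-++⁺ˡ a)
    ...   | inj₂ b = inj₂ b
    updateAt-free⁻ (there nm) (f ∷ fs) v m with ∈-++⁻ (freeᴸ f) m
    ... | inj₁ m1 = inj₁ (∈-++⁺ˡ m1)
    ... | inj₂ m2 = Sum.map₁ (∈-++⁺ʳ (freeᴸ f)) (updateAt-free⁻ nm fs v m2)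

    updateAt-freeˡ : ∀ {hs n} (nm : n ∈ hs) (fs : Labels hs) v → v ∈ freeLabels fs →
      v ∈ freeLabels (updateAt nm g fs)
    updateAt-freeˡ (here P.refl) (f ∷ fs) v m with ∈-++⁻ (freeᴸ f) m
    ... | inj₁ m1 = ∈-++⁺ˡ (gfreeˡ f v m1)
    ... | inj₂ m2 = ∈-++⁺ʳ (freeᴸ (g f)) m2
    updateAt-freeˡ (there nm) (f ∷ fs) v m with ∈-++⁻ (freeᴸ f) m
    ... | inj₁ m1 = ∈-++⁺ˡ m1
    ... | inj₂ m2 = ∈-++⁺ʳ (freeᴸ f) (updateAt-freeˡ nm fs v m2)

    updateAt-freeʳ : ∀ {hs n} (nm : n ∈ hs) (fs : Labels hs) v → v ∈ X → v ∈ freeLabels (updateAt nm g fs)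
    updateAt-freeʳ (here P.refl) (f ∷ fs) v m = ∈-++⁺ˡ (gfreeʳ f v m)
    updateAt-freeʳ (there nm) (f ∷ fs) v m = ∈-++⁺ʳ (freeᴸ f) (updateAt-freeʳ nm fs v m)

  updateAt-admissible : ∀ {hs n} (nm : n ∈ hs) (g : Label → Label) → (∀ x → Admissible n x →
    Admissible n (g x)) →
    (fs : Labels hs) → AllAdmissible fs → AllAdmissible (updateAt nm g fs)
  updateAt-admissible (here P.refl) g gok (f ∷ fs) (o , os) = gok f o , os
  updateAt-admissible (there nm) g gok (f ∷ fs) (o , os) = o , updateAt-admissible nm g gok fs os

  freeᴸ-exsᴸ⁻ : ∀ P f v → v ∈ freeᴸ (exsᴸ P f) → v ∈ freeᴸ f × v ∉ P
  freeᴸ-exsᴸ⁻ P (just ψ) v m = free-exs⁻ P ψ v m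

  freeᴸ-exsᴸ⁺ : ∀ P f v → v ∈ freeᴸ f → v ∉ P → v ∈ freeᴸ (exsᴸ P f)
  freeᴸ-exsᴸ⁺ P (just ψ) v m np = free-exs⁺ P ψ v m np

  exsᴸ-admissible : ∀ P f D n → Distinct P → (∀ p → p ∈ P → p ∈ freeᴸ f) → AtMostTwo D → Admissible D f →
    (∀ v → v ∈ freeᴸ (exsᴸ P f) → v ∈ n) → Admissible n (exsᴸ P f)
  exsᴸ-admissible P nothing D n u pf sm ok sub = tt
  exsᴸ-admissible P (just ψ) D n u pf sm (w , t , r , s) sub =
    WF-exs P ψ u pf w , TwoVariableScopes-exs P ψ D sm s t , P.subst (All (_≤ 2)) (P.sym (relArities-exs P ψ)) r , sub

  updateAt-tail : ∀ {H L n} (nm : n ∈ (H ∷ L)) (g : Label → Label) (fH : Label) (fs : Labels L) →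
    (n ≡ H × All.tail (updateAt nm g (fH ∷ fs)) ≡ fs) ⊎
    (Σ (n ∈ L) λ nm′ → All.tail (updateAt nm g (fH ∷ fs)) ≡ updateAt nm′ g fs)
  updateAt-tail (here P.refl) g fH fs = inj₁ (P.refl , P.refl)
  updateAt-tail (there nm′) g fH fs = inj₂ (nm′ , P.refl)

  module EliminationStep {H h L} (fH fh : Label) (fs : Labels L) (Y : List Var)
              (n : List Var) (nm : n ∈ (H ∷ L))
              (att : ∀ v → v ∈ h → v ∈ concat (H ∷ L) → v ∈ n)
              (inv : Invariant {H} {h ∷ L} (fH ∷ fh ∷ fs) Y) where
    open Invariant inv
    rest : Labels (H ∷ L)
    rest = fH ∷ fs
    old : Labels (H ∷ h ∷ L)
    old = fH ∷ fh ∷ fs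
    Pv Y′ : List Var
    Pv = privateVars Y n fh
    Y′ = remainingVars Y n fh
    ear′ : Label
    ear′ = exsᴸ Pv fh
    merge : Label → Label
    merge = absorb Pv fh
    new : Labels (H ∷ L)
    new = updateAt nm merge rest

    ear-admissible : Admissible h fh
    ear-admissible = proj₁ (proj₂ admissible)

    ear⊆h : ∀ v → v ∈ freeᴸ fh → v ∈ h
    ear⊆h = freeᴸ⊆node h fh ear-admissible

    rest⊆nodes : ∀ v → v ∈ freeLabels rest → v ∈ concat (H ∷ L)
    rest⊆nodes = freeLabels⊆nodes rest (proj₁ admissible , proj₂ (proj₂ admissible))

    rest⊆old : ∀ v → v ∈ freeLabels rest → v ∈ freeLabels old
    rest⊆old v m with ∈-++⁻ (freeᴸ fH) m
    ... | inj₁ m1 = ∈-++⁺ˡ m1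
    ... | inj₂ m2 = ∈-++⁺ʳ (freeᴸ fH) (∈-++⁺ʳ (freeᴸ fh) m2)

    ear⊆old : ∀ v → v ∈ freeᴸ fh → v ∈ freeLabels old
    ear⊆old v m = ∈-++⁺ʳ (freeᴸ fH) (∈-++⁺ˡ m)

    outside-attach⇒quantified : ∀ v → v ∈ freeᴸ fh → v ∉ n → v ∈ Y
    outside-attach⇒quantified v m nn with free⊆head∪Y v (ear⊆old v m)
    ... | inj₂ y = y
    ... | inj₁ hH = ⊥-elim (nn (att v (ear⊆h v m) (∈-++⁺ˡ hH)))

    private-prop : ∀ v → v ∈ Pv → Private n fh v
    private-prop v m = proj₂ (∈-filter⁻ (private? n fh) {xs = Y} m)

    free-ear′⁻ : ∀ v → v ∈ freeᴸ ear′ → v ∈ freeᴸ fh × v ∉ Pv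
    free-ear′⁻ = freeᴸ-exsᴸ⁻ Pv fh

    free-ear′⁺ : ∀ v → v ∈ freeᴸ fh → v ∉ Pv → v ∈ freeᴸ ear′
    free-ear′⁺ = freeᴸ-exsᴸ⁺ Pv fh

    ear′⊆attach : ∀ v → v ∈ freeᴸ ear′ → v ∈ n
    ear′⊆attach v m with free-ear′⁻ v m
    ... | mh , np = decidable-stable (v ∈? n) (λ nn → np (∈-filter⁺ (private? n fh)
        (outside-attach⇒quantified v mh nn) (mh , nn)))

    private∉rest : ∀ v → v ∈ Pv → v ∉ freeLabels rest
    private∉rest v m mm with private-prop v m
    ... | mh , nn = nn (att v (ear⊆h v mh) (rest⊆nodes v mm))

    Y′-intro : ∀ v → v ∈ Y → v ∉ Pv → v ∈ Y′
    Y′-intro v y np = ∈-filter⁺ (λ w → ¬? (private? n fh w)) y (λ q → np (∈-filter⁺ (private? n fh) y q))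

    Y′-elim : ∀ v → v ∈ Y′ → v ∈ Y × ¬ Private n fh v
    Y′-elim v m = ∈-filter⁻ (λ w → ¬? (private? n fh w)) {xs = Y} m

    free-merge⁻ : ∀ x v → v ∈ freeᴸ (merge x) → v ∈ freeᴸ x ⊎ v ∈ freeᴸ ear′
    free-merge⁻ x v m = freeᴸ-andᴸ⁻ x ear′ v m
    free-mergeˡ : ∀ x v → v ∈ freeᴸ x → v ∈ freeᴸ (merge x)
    free-mergeˡ x v m = freeᴸ-andᴸ⁺ˡ x ear′ v m
    free-mergeʳ : ∀ x v → v ∈ freeᴸ ear′ → v ∈ freeᴸ (merge x)
    free-mergeʳ x v m = freeᴸ-andᴸ⁺ʳ x ear′ v m

    free-new⁻ : ∀ {hs n} (nm : n ∈ hs) (fs : Labels hs) v →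
      v ∈ freeLabels (updateAt nm merge fs) → v ∈ freeLabels fs ⊎ v ∈ freeᴸ ear′
    free-new⁻ = updateAt-free⁻ merge (freeᴸ ear′) free-merge⁻ free-mergeˡ free-mergeʳ

    free-newˡ : ∀ {hs n} (nm : n ∈ hs) (fs : Labels hs) v → v ∈ freeLabels fs →
      v ∈ freeLabels (updateAt nm merge fs)
    free-newˡ = updateAt-freeˡ merge (freeᴸ ear′) free-merge⁻ free-mergeˡ free-mergeʳ

    free-newʳ : ∀ {hs n} (nm : n ∈ hs) (fs : Labels hs) v → v ∈ freeᴸ ear′ →
      v ∈ freeLabels (updateAt nm merge fs)
    free-newʳ = updateAt-freeʳ merge (freeᴸ ear′) free-merge⁻ free-mergeˡ free-mergeʳ

    ear′-admissible : Admissible n ear′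
    ear′-admissible = exsᴸ-admissible Pv fh h n (filter-distinct (private? n fh) distinctY)
        (λ p m → proj₁ (private-prop p m))
             (All.head (All.tail small)) ear-admissible ear′⊆attach

    invariant′ : Invariant {H} {L} new Y′
    invariant′ = record
      { admissible = updateAt-admissible nm merge
          (λ x ox → Admissible-andᴸ n x ear′ ox ear′-admissible) rest (proj₁ admissible , proj₂ (proj₂ admissible))
      ; small = drop-ear small
      ; free⊆head∪Y = free⊆head∪Y′
      ; Y⊆freeEars = Y⊆freeEars′
      ; head⊆free = head⊆free′
      ; Y∉head = λ v m → Y∉head v (proj₁ (Y′-elim v m))
      ; distinctY = filter-distinct (λ w → ¬? (private? n fh w)) distinctY }
      where
      drop-ear : All AtMostTwo (H ∷ h ∷ L) → All AtMostTwo (H ∷ L)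
      drop-ear (a ∷ _ ∷ r) = a ∷ r
      free⊆head∪Y′ : ∀ v → v ∈ freeLabels new → v ∈ H ⊎ v ∈ Y′
      free⊆head∪Y′ v m with free-new⁻ nm rest v m
      ... | inj₁ mo with free⊆head∪Y v (rest⊆old v mo)
      ...   | inj₁ hH = inj₁ hH
      ...   | inj₂ y = inj₂ (Y′-intro v y (λ p → private∉rest v p mo))
      free⊆head∪Y′ v m | inj₂ mx with free-ear′⁻ v mx
      ... | mh , np with free⊆head∪Y v (ear⊆old v mh)
      ...   | inj₁ hH = inj₁ hH
      ...   | inj₂ y = inj₂ (Y′-intro v y np)
      Y⊆freeEars′ : ∀ v → v ∈ Y′ → v ∈ freeLabels (All.tail new)
      Y⊆freeEars′ v m with Y′-elim v m
      ... | y , nq with Y⊆freeEars v y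
      ...   | mt with ∈-++⁻ (freeᴸ fh) mt | updateAt-tail nm merge fH fs
      ...     | inj₂ mfs | inj₁ (_ , e) = P.subst (λ z → v ∈ freeLabels z) (P.sym e) mfs
      ...     | inj₂ mfs | inj₂ (nm′ , e) = P.subst (λ z → v ∈ freeLabels z) (P.sym e) (free-newˡ nm′ fs v mfs)
      ...     | inj₁ mh | inj₁ (P.refl , e) = ⊥-elim (Y∉head v y (decidable-stable (v ∈? n) (λ nn → nq (mh , nn))))
      ...     | inj₁ mh | inj₂ (nm′ , e) = P.subst (λ z → v ∈ freeLabels z) (P.sym e)
                  (free-newʳ nm′ fs v (free-ear′⁺ v mh (λ p → nq (private-prop v p))))
      head⊆free′ : ∀ v → v ∈ H → v ∈ freeLabels new
      head⊆free′ v hH with ∈-++⁻ (freeᴸ fH) (head⊆free v hH)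
      ... | inj₁ m1 = free-newˡ nm rest v (∈-++⁺ˡ m1)
      ... | inj₂ m2 with ∈-++⁻ (freeᴸ fh) m2
      ...   | inj₂ m3 = free-newˡ nm rest v (∈-++⁺ʳ (freeᴸ fH) m3)
      ...   | inj₁ mh = free-newʳ nm rest v
                (free-ear′⁺ v mh (λ p → proj₂ (private-prop v p) (att v (ear⊆h v mh) (∈-++⁺ˡ hH))))

  eliminate-admissible : ∀ {H L} (e : Ears H L) (fs : Labels (H ∷ L)) Y → Invariant fs Y →
    Admissible H (eliminate e fs Y) × (∀ v → v ∈ H → v ∈ freeᴸ (eliminate e fs Y))
  eliminate-admissible nil (fH ∷ []) Y inv =
    proj₁ (Invariant.admissible inv) , λ v m → P.subst (v ∈_) (LP.++-identityʳ (freeᴸ fH)) (Invariant.head⊆free inv v m)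
  eliminate-admissible (snoc e (n , nm , att)) (fH ∷ fh ∷ fs) Y inv =
    eliminate-admissible e _ _ (EliminationStep.invariant′ fH fh fs Y n nm att inv)

  Invariant-single⇒Y≡[] : ∀ {H} (fH : Label) Y → Invariant {H} {[]} (fH ∷ []) Y → Y ≡ []
  Invariant-single⇒Y≡[] fH [] inv = P.refl
  Invariant-single⇒Y≡[] fH (y ∷ Y) inv with Invariant.Y⊆freeEars inv y (here P.refl)
  ... | ()

module TwoVariableRenaming where

  open Elimination

  bitVar : Bool → Var
  bitVar false = 0
  bitVar true = 1

  bitVar-injective : ∀ {a b} → bitVar a ≡ bitVar b → a ≡ b
  bitVar-injective {false} {false} e = P.refl
  bitVar-injective {true} {true} e = P.refl
  bitVar-injective {false} {true} ()
  bitVar-injective {true} {false} ()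

  freshBit : (Var → Bool) → List Var → Bool
  freshBit ρ [] = false
  freshBit ρ (y ∷ _) = not (ρ y)

  -- A quantified variable is renamed to the bit not used by the at most one other
  -- variable free in its scope, so renaming never captures a free variable.
  rename01 : Formula → (Var → Bool) → Formula
  rename01 (atom (relA R xs)) ρ = atom (relA R (Vec.map (λ v → bitVar (ρ v)) xs))
  rename01 (atom (leqA x k)) ρ = atom (leqA (bitVar (ρ x)) k)
  rename01 (and φ ψ) ρ = and (rename01 φ ρ) (rename01 ψ ρ)
  rename01 (ex x φ) ρ = ex (bitVar b) (rename01 φ (ρ [ x ≔ b ]))
    where
    b : Bool
    b = freshBit ρ (free (ex x φ))

  two-same : ∀ {a b x v y : Var} → (x ≡ a ⊎ x ≡ b) → (v ≡ a ⊎ v ≡ b) → (y ≡ a ⊎ y ≡ b) →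
    ¬ v ≡ x → ¬ y ≡ x → v ≡ y
  two-same (inj₁ P.refl) (inj₁ P.refl) _ nv ny = ⊥-elim (nv P.refl)
  two-same (inj₁ P.refl) (inj₂ P.refl) (inj₁ P.refl) nv ny = ⊥-elim (ny P.refl)
  two-same (inj₁ P.refl) (inj₂ P.refl) (inj₂ P.refl) nv ny = P.refl
  two-same (inj₂ P.refl) (inj₂ P.refl) _ nv ny = ⊥-elim (nv P.refl)
  two-same (inj₂ P.refl) (inj₁ P.refl) (inj₂ P.refl) nv ny = ⊥-elim (ny P.refl)
  two-same (inj₂ P.refl) (inj₁ P.refl) (inj₁ P.refl) nv ny = P.refl

  not-≢ : ∀ b → ¬ not b ≡ b
  not-≢ false ()
  not-≢ true ()

  freshBit-differs : ∀ ρ ys v → v ∈ ys → (∀ u → u ∈ ys → u ≡ v) → ¬ ρ v ≡ freshBit ρ ys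
  freshBit-differs ρ (y ∷ ys) v v∈ all≡v e = not-≢ (ρ y) (P.sym (P.trans (P.cong ρ (all≡v y (here P.refl))) e))

  freshBit-fresh : ∀ x φ ρ → WF (ex x φ) → TwoVariableScopes (ex x φ) →
    ∀ v → v ∈ free (ex x φ) → ¬ ρ v ≡ freshBit ρ (free (ex x φ))
  freshBit-fresh x φ ρ (x∈φ , _) ((a , b , ab) , _) v v∈ =
    freshBit-differs ρ (free (ex x φ)) v v∈ λ u u∈ →
      let (u∈φ , u≢x) = free-ex⁻ x φ u u∈
          (v∈φ , v≢x) = free-ex⁻ x φ v v∈
      in two-same (ab x x∈φ) (ab u u∈φ) (ab v v∈φ) u≢x v≢x

  ∈-toList-map⁺ : ∀ {n} (f : Var → Var) (xs : Vec Var n) v → v ∈ toList xs → f v ∈ toList (Vec.map f xs)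
  ∈-toList-map⁺ f xs v m = P.subst (f v ∈_) (P.sym (VecP.toList-map f xs)) (∈-map⁺ f m)

  ∈-toList-map⁻ : ∀ {n} (f : Var → Var) (xs : Vec Var n) w → w ∈ toList (Vec.map f xs) → Σ Var λ v →
    v ∈ toList xs × w ≡ f v
  ∈-toList-map⁻ f xs w m = ∈-map⁻ f (P.subst (w ∈_) (VecP.toList-map f xs) m)

  rename01-free⁺ : ∀ φ ρ → WF φ → TwoVariableScopes φ → ∀ v → v ∈ free φ → bitVar (ρ v) ∈ free (rename01 φ ρ)
  rename01-free⁺ (atom (relA R xs)) ρ w t v m = ∈-toList-map⁺ (λ u → bitVar (ρ u)) xs v m
  rename01-free⁺ (atom (leqA x k)) ρ w t v (here P.refl) = here P.refl
  rename01-free⁺ (and φ ψ) ρ (w1 , w2) (t1 , t2) v m with ∈-++⁻ (free φ) m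
  ... | inj₁ m1 = ∈-++⁺ˡ (rename01-free⁺ φ ρ w1 t1 v m1)
  ... | inj₂ m2 = ∈-++⁺ʳ (free (rename01 φ ρ)) (rename01-free⁺ ψ ρ w2 t2 v m2)
  rename01-free⁺ (ex x φ) ρ (xf , w) (sm , t) v m with free-ex⁻ x φ v m
  ... | mφ , nx = free-ex⁺ (bitVar b) (rename01 φ ρ′) (bitVar (ρ v))
      (P.subst (λ z → bitVar z ∈ free (rename01 φ ρ′)) (≔-other ρ x b v nx) (rename01-free⁺ φ ρ′ w t v mφ))
      (λ e → freshBit-fresh x φ ρ (xf , w) (sm , t) v m (bitVar-injective e))
    where
    b : Bool
    b = freshBit ρ (free (ex x φ))
    ρ′ : Var → Bool
    ρ′ = ρ [ x ≔ b ]

  rename01-free⁻ : ∀ φ ρ m → m ∈ free (rename01 φ ρ) → Σ Var λ v → v ∈ free φ × m ≡ bitVar (ρ v)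
  rename01-free⁻ (atom (relA R xs)) ρ m mm = ∈-toList-map⁻ (λ u → bitVar (ρ u)) xs m mm
  rename01-free⁻ (atom (leqA x k)) ρ m (here P.refl) = x , here P.refl , P.refl
  rename01-free⁻ (and φ ψ) ρ m mm with ∈-++⁻ (free (rename01 φ ρ)) mm
  ... | inj₁ m1 = let (v , a , e) = rename01-free⁻ φ ρ m m1 in v , ∈-++⁺ˡ a , e
  ... | inj₂ m2 = let (v , a , e) = rename01-free⁻ ψ ρ m m2 in v , ∈-++⁺ʳ (free φ) a , e
  rename01-free⁻ (ex x φ) ρ m mm with free-ex⁻ (bitVar b) (rename01 φ ρ′) m mm
    where
    b : Bool
    b = freshBit ρ (free (ex x φ))
    ρ′ : Var → Bool
    ρ′ = ρ [ x ≔ b ]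
  ... | m1 , nb with rename01-free⁻ φ (ρ [ x ≔ freshBit ρ (free (ex x φ)) ]) m m1
  ... | v , vm , e with v ℕ.≟ x
  ... | yes P.refl = ⊥-elim (nb (P.trans e (P.cong bitVar (≔-same ρ x _))))
  ... | no nx = v , free-ex⁺ x φ v vm nx , P.trans e (P.cong bitVar (≔-other ρ x _ v nx))

  rename01-WF : ∀ φ ρ → WF φ → TwoVariableScopes φ → WF (rename01 φ ρ)
  rename01-WF (atom (leqA x k)) ρ w t = tt
  rename01-WF (atom (relA R xs)) ρ w t = tt
  rename01-WF (and φ ψ) ρ (w1 , w2) (t1 , t2) = rename01-WF φ ρ w1 t1 , rename01-WF ψ ρ w2 t2
  rename01-WF (ex x φ) ρ (xf , w) (sm , t) =
    P.subst (λ z → bitVar z ∈ free (rename01 φ ρ′)) (≔-same ρ x b) (rename01-free⁺ φ ρ′ w t x xf) ,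
    rename01-WF φ ρ′ w t
    where
    b : Bool
    b = freshBit ρ (free (ex x φ))
    ρ′ : Var → Bool
    ρ′ = ρ [ x ≔ b ]

  relArities-rename01 : ∀ φ ρ → relArities (rename01 φ ρ) ≡ relArities φ
  relArities-rename01 (atom (relA R xs)) ρ = P.refl
  relArities-rename01 (atom (leqA x k)) ρ = P.refl
  relArities-rename01 (and φ ψ) ρ = P.cong₂ _++_ (relArities-rename01 φ ρ) (relArities-rename01 ψ ρ)
  relArities-rename01 (ex x φ) ρ = relArities-rename01 φ _

  bitVar-01 : ∀ b → bitVar b ≡ 0 ⊎ bitVar b ≡ 1
  bitVar-01 false = inj₁ P.refl
  bitVar-01 true = inj₂ P.refl

  rename01-vars : ∀ φ ρ → All (λ v → v ≡ 0 ⊎ v ≡ 1) (allVars (rename01 φ ρ))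
  rename01-vars (atom (relA R xs)) ρ = All.tabulate (λ {w} m → let (v , _ , e) = ∈-toList-map⁻ (λ u → bitVar (ρ u)) xs w m in
                                                   P.subst (λ z → z ≡ 0 ⊎ z ≡ 1) (P.sym e) (bitVar-01 (ρ v)))
  rename01-vars (atom (leqA x k)) ρ = bitVar-01 (ρ x) ∷ []
  rename01-vars (and φ ψ) ρ = AllP.++⁺ (rename01-vars φ ρ) (rename01-vars ψ ρ)
  rename01-vars (ex x φ) ρ = bitVar-01 _ ∷ rename01-vars φ _

module EliminationSemantics {c ℓ} (K : CommutativeSemiring c ℓ) where

  open JoinTree
  open Elimination
  open Evaluation K

  open CommutativeSemiring K
  open SetoidReasoning setoid
  open Semantics K

  module _ (N : ℕ) (db : DB) where
    labelValue : Label → Val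
    labelValue nothing ν = 1#
    labelValue (just φ) ν = ⟦ φ ⟧[ N ] db ν

    labelValue-extensional : ∀ f → Extensional (labelValue f)
    labelValue-extensional nothing e = refl
    labelValue-extensional (just φ) e = ⟦⟧[]-cong φ N db e

    labelValue-agreeOn : ∀ f ν ν′ → AgreeOn (freeᴸ f) ν ν′ → labelValue f ν ≈ labelValue f ν′
    labelValue-agreeOn nothing ν ν′ a = refl
    labelValue-agreeOn (just φ) ν ν′ a = ⟦⟧[]-agreeOn φ N db ν ν′ a

    labelsProduct : ∀ {hs} → Labels hs → Val
    labelsProduct [] ν = 1#
    labelsProduct (f ∷ fs) ν = labelValue f ν * labelsProduct fs ν

    labelsProduct-extensional : ∀ {hs} (fs : Labels hs) → Extensional (labelsProduct fs)
    labelsProduct-extensional [] e = refl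
    labelsProduct-extensional (f ∷ fs) e = *-cong (labelValue-extensional f e) (labelsProduct-extensional fs e)

    labelsProduct-agreeOn : ∀ {hs} (fs : Labels hs) ν ν′ → AgreeOn (freeLabels fs) ν ν′ →
      labelsProduct fs ν ≈ labelsProduct fs ν′
    labelsProduct-agreeOn [] ν ν′ a = refl
    labelsProduct-agreeOn (f ∷ fs) ν ν′ a = *-cong (labelValue-agreeOn f ν ν′ (λ v m → a v (∈-++⁺ˡ m)))
                                      (labelsProduct-agreeOn fs ν ν′ (λ v m → a v (∈-++⁺ʳ (freeᴸ f) m)))

    labelValue-andᴸ : ∀ x y ν → labelValue (andᴸ x y) ν ≈ labelValue x ν * labelValue y ν
    labelValue-andᴸ nothing y ν = sym (*-identityˡ _)
    labelValue-andᴸ (just a) nothing ν = sym (*-identityʳ _)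
    labelValue-andᴸ (just a) (just b) ν = refl

    labelsProduct-updateAt : ∀ {hs n} (nm : n ∈ hs) (g : Label → Label) (X : Val) → (∀ x ν →
      labelValue (g x) ν ≈ labelValue x ν * X ν) →
      (fs : Labels hs) → ∀ ν → labelsProduct (updateAt nm g fs) ν ≈ labelsProduct fs ν * X ν
    labelsProduct-updateAt (here P.refl) g X gv (f ∷ fs) ν = begin
      labelValue (g f) ν * labelsProduct fs ν ≈⟨ *-cong (gv f ν) refl ⟩
      (labelValue f ν * X ν) * labelsProduct fs ν ≈⟨ *-assoc _ _ _ ⟩
      labelValue f ν * (X ν * labelsProduct fs ν) ≈⟨ *-cong refl (*-comm _ _) ⟩
      labelValue f ν * (labelsProduct fs ν * X ν) ≈⟨ sym (*-assoc _ _ _) ⟩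
      (labelValue f ν * labelsProduct fs ν) * X ν ∎
    labelsProduct-updateAt (there nm) g X gv (f ∷ fs) ν =
      trans (*-cong refl (labelsProduct-updateAt nm g X gv fs ν)) (sym (*-assoc _ _ _))

    privateVars-nothing : ∀ Y D → privateVars Y D nothing ≡ []
    privateVars-nothing [] D = P.refl
    privateVars-nothing (y ∷ Y) D = privateVars-nothing Y D

    sum-privateVars : ∀ Y n f μ →
      sumVars N (privateVars Y n f) (labelValue f) μ ≈ labelValue (exsᴸ (privateVars Y n f) f) μ
    sum-privateVars Y n (just ψ) μ = sym (⟦exs⟧ N db (privateVars Y n (just ψ)) ψ μ)
    sum-privateVars Y n nothing μ rewrite privateVars-nothing Y n = refl

    module EliminationStepSemantics {H h L} (fH fh : Label) (fs : Labels L) (Y : List Var)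
              (n : List Var) (nm : n ∈ (H ∷ L))
              (att : ∀ v → v ∈ h → v ∈ concat (H ∷ L) → v ∈ n)
              (inv : Invariant {H} {h ∷ L} (fH ∷ fh ∷ fs) Y) where
      open EliminationStep fH fh fs Y n nm att inv

      reorder : ∀ μ → labelsProduct old μ ≈ labelsProduct rest μ * labelValue fh μ
      reorder μ = begin
        labelValue fH μ * (labelValue fh μ * labelsProduct fs μ) ≈⟨ *-cong refl (*-comm _ _) ⟩
        labelValue fH μ * (labelsProduct fs μ * labelValue fh μ) ≈⟨ sym (*-assoc _ _ _) ⟩
        (labelValue fH μ * labelsProduct fs μ) * labelValue fh μ ∎

      rest-ignores-private : ∀ μ x d → x ∈ Pv → labelsProduct rest (update μ x d) ≈ labelsProduct rest μ
      rest-ignores-private μ x d xp = labelsProduct-agreeOn rest _ _ (λ v m → update-other μ x d v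
          (λ e → private∉rest x xp (P.subst (_∈ freeLabels rest) e m)))

      -- The private variables of the ear occur in no other label, so their sums factor
      -- out of the rest of the product and into the ear.
      step-sound : ∀ ν → sumVars N Y (labelsProduct old) ν ≈ sumVars N Y′ (labelsProduct new) ν
      step-sound ν = begin
        sumVars N Y (labelsProduct old) ν
          ≈⟨ sumVars-↭ N (labelsProduct old) (labelsProduct-extensional old) (partition-↭ (private? n fh) Y) ν ⟩
        sumVars N (Y′ ++ Pv) (labelsProduct old) ν
          ≈⟨ sumVars-++ N Y′ Pv (labelsProduct old) ν ⟩
        sumVars N Y′ (sumVars N Pv (labelsProduct old)) ν
          ≈⟨ sumVars-cong N Y′ (λ μ → begin
               sumVars N Pv (labelsProduct old) μ
                 ≈⟨ sumVars-cong N Pv reorder μ ⟩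
               sumVars N Pv (λ κ → labelsProduct rest κ * labelValue fh κ) μ
                 ≈⟨ sumVars-factorˡ N Pv (labelsProduct rest) (labelValue fh)
                     (labelValue-extensional fh) rest-ignores-private μ ⟩
               labelsProduct rest μ * sumVars N Pv (labelValue fh) μ
                 ≈⟨ *-cong refl (sum-privateVars Y n fh μ) ⟩
               labelsProduct rest μ * labelValue ear′ μ
                 ≈⟨ sym (labelsProduct-updateAt nm merge (labelValue ear′) (λ x κ → labelValue-andᴸ x ear′ κ) rest μ) ⟩
               labelsProduct new μ ∎) ν ⟩
        sumVars N Y′ (labelsProduct new) ν ∎

    eliminate-sound : ∀ {H L} (e : Ears H L) (fs : Labels (H ∷ L)) Y → Invariant fs Y →
      ∀ ν → sumVars N Y (labelsProduct fs) ν ≈ labelValue (eliminate e fs Y) ν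
    eliminate-sound nil (fH ∷ []) Y inv ν rewrite Invariant-single⇒Y≡[] fH Y inv = *-identityʳ _
    eliminate-sound (snoc e (n , nm , att)) (fH ∷ fh ∷ fs) Y inv ν =
      trans (EliminationStepSemantics.step-sound fH fh fs Y n nm att inv ν)
            (eliminate-sound e _ _ (EliminationStep.invariant′ fH fh fs Y n nm att inv) ν)

module RenamingSemantics {c ℓ} (K : CommutativeSemiring c ℓ) where

  open Elimination
  open TwoVariableRenaming
  open Evaluation K

  open CommutativeSemiring K
  open Semantics K

  map-map-agreeOn : ∀ {n} (xs : Vec Var n) (f : Var → Var) (μ ν : Var → ℕ) → (∀ v → v ∈ toList xs →
    μ (f v) ≡ ν v) →
    Vec.map μ (Vec.map f xs) ≡ Vec.map ν xs
  map-map-agreeOn [] f μ ν a = P.refl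
  map-map-agreeOn (x ∷ xs) f μ ν a = P.cong₂ _∷_ (a x (here P.refl)) (map-map-agreeOn xs f μ ν (λ v m → a v (there m)))

  rename01-sound : ∀ φ ρ N db → WF φ → TwoVariableScopes φ → ∀ μ ν → (∀ v → v ∈ free φ →
    μ (bitVar (ρ v)) ≡ ν v) →
    ⟦ rename01 φ ρ ⟧[ N ] db μ ≈ ⟦ φ ⟧[ N ] db ν
  rename01-sound (atom (relA R xs)) ρ N db w t μ ν a = reflexive (P.cong (rel db R) (map-map-agreeOn xs
      (λ u → bitVar (ρ u)) μ ν a))
  rename01-sound (atom (leqA x k)) ρ N db w t μ ν a rewrite a x (here P.refl) = refl
  rename01-sound (and φ ψ) ρ N db (w1 , w2) (t1 , t2) μ ν a =
    *-cong (rename01-sound φ ρ N db w1 t1 μ ν (λ v m → a v (∈-++⁺ˡ m)))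
           (rename01-sound ψ ρ N db w2 t2 μ ν (λ v m → a v (∈-++⁺ʳ (free φ) m)))
  rename01-sound (ex x φ) ρ N db (xf , w) (sm , t) μ ν a =
    sumBelow-cong N (λ d → rename01-sound φ ρ′ N db w t (update μ (bitVar b) d) (update ν x d) (ag d))
    where
    b : Bool
    b = freshBit ρ (free (ex x φ))
    ρ′ : Var → Bool
    ρ′ = ρ [ x ≔ b ]
    ag : ∀ d v → v ∈ free φ → update μ (bitVar b) d (bitVar (ρ′ v)) ≡ update ν x d v
    ag d v m with v ℕ.≟ x
    ... | yes P.refl rewrite ≔-same ρ x b = P.trans (update-same μ (bitVar b) d) (P.sym (update-same ν x d))
    ... | no nx rewrite ≔-other ρ x b v nx =
      P.trans (update-other μ (bitVar b) d (bitVar (ρ v)) (λ e → freshBit-fresh x φ ρ (xf , w) (sm , t) v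
          (free-ex⁺ x φ v m nx) (bitVar-injective e)))
        (P.trans (a v (free-ex⁺ x φ v m nx)) (P.sym (update-other ν x d v nx)))

module Outputs {c ℓ} (K : CommutativeSemiring c ℓ) where

  open Evaluation K

  open CommutativeSemiring K
  open Semantics K

  allB-true : {A : Set} (p : A → Bool) (xs : List A) → allB p xs ≡ true → ∀ a → a ∈ xs → p a ≡ true
  allB-true p (x ∷ xs) e a (here P.refl) = BP.∧-conicalˡ _ _ e
  allB-true p (x ∷ xs) e a (there m) = allB-true p xs (BP.∧-conicalʳ _ _ e) a m

  allB-cong : {A : Set} (p q : A → Bool) (xs : List A) → (∀ a → a ∈ xs → p a ≡ q a) → allB p xs ≡ allB q xs
  allB-cong p q [] e = P.refl
  allB-cong p q (x ∷ xs) e = P.cong₂ _∧_ (e x (here P.refl)) (allB-cong p q xs (λ a m → e a (there m)))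

  RespectsRepetitions : ∀ {k} → Vec Var k → Vec ℕ k → Set
  RespectsRepetitions {k} xs ds = ∀ i j → lookup xs i ≡ lookup xs j → lookup ds i ≡ lookup ds j

  respects⇒RespectsRepetitions : ∀ {k} (xs : Vec Var k) ds → respects xs ds ≡ true → RespectsRepetitions xs ds
  respects⇒RespectsRepetitions {k} xs ds e i j eq with allB-true _ (allFin k) (allB-true _ (allFin k) e i
      (∈-allFin i)) j (∈-allFin j)
  ... | e2 rewrite eq | ≡ᵇ-refl (lookup xs j) = ≡ᵇ-true⇒≡ _ _ e2

  assign-lookup : ∀ {k} (xs : Vec Var k) ds → RespectsRepetitions xs ds → ∀ i →
    assign xs ds (lookup xs i) ≡ lookup ds i
  assign-lookup (x ∷ xs) (d ∷ ds) r F.zero rewrite ≡ᵇ-refl x = P.refl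
  assign-lookup (x ∷ xs) (d ∷ ds) r (F.suc i) with lookup xs i ≡ᵇ x in eq
  ... | true = r F.zero (F.suc i) (P.sym (≡ᵇ-true⇒≡ _ _ eq))
  ... | false = assign-lookup xs ds (λ i j e → r (F.suc i) (F.suc j) e) i

  lookup-mem : ∀ {k} (xs : Vec Var k) i → lookup xs i ∈ toList xs
  lookup-mem xs i = VecMemP.∈-toList⁺ (VecMemP.∈-lookup i xs)

  InjectiveOn : (Var → Var) → List Var → Set
  InjectiveOn f S = ∀ u v → u ∈ S → v ∈ S → f u ≡ f v → u ≡ v

  ≡ᵇ-inj : (f : Var → Var) (S : List Var) → InjectiveOn f S → ∀ a b → a ∈ S → b ∈ S → (f a ≡ᵇ f b) ≡ (a ≡ᵇ b)
  ≡ᵇ-inj f S inj a b am bm with a ℕ.≟ b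
  ... | yes P.refl rewrite ≡ᵇ-refl a | ≡ᵇ-refl (f a) = P.refl
  ... | no ne rewrite ≢⇒≡ᵇ-false a b ne | ≢⇒≡ᵇ-false (f a) (f b) (λ e → ne (inj a b am bm e)) = P.refl

  respects-map : ∀ {k} (f : Var → Var) (xs : Vec Var k) ds → InjectiveOn f (toList xs) →
    respects (Vec.map f xs) ds ≡ respects xs ds
  respects-map {k} f xs ds inj = allB-cong _ _ (allFin k) (λ i _ → allB-cong _ _ (allFin k) (λ j _ → inner i j))
    where
    inner : ∀ i j → (not (lookup (Vec.map f xs) i ≡ᵇ lookup (Vec.map f xs) j) ∨ (lookup ds i ≡ᵇ lookup ds j))
                  ≡ (not (lookup xs i ≡ᵇ lookup xs j) ∨ (lookup ds i ≡ᵇ lookup ds j))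
    inner i j rewrite VecP.lookup-map i f xs | VecP.lookup-map j f xs
      | ≡ᵇ-inj f (toList xs) inj (lookup xs i) (lookup xs j) (lookup-mem xs i) (lookup-mem xs j) = P.refl

  output-≈ : ∀ {k} (q q′ : Query k) (f : Var → Var) → head q′ ≡ Vec.map f (head q) →
    InjectiveOn f (toList (head q)) →
    (∀ N db → bnd db (body q) ≤ N → bnd db (body q′) ≤ N → ∀ ν ν′ →
       (∀ v → v ∈ toList (head q) → ν′ (f v) ≡ ν v) → ⟦ body q ⟧[ N ] db ν ≈ ⟦ body q′ ⟧[ N ] db ν′) →
    ∀ db ds → output K q db ds ≈ output K q′ db ds
  output-≈ {k} q q′ f eqh inj body-≈ db ds = go (head q′) eqh
    where
    hd : Vec Var k
    hd = head q
    N : ℕ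
    N = bnd db (body q) ⊔ bnd db (body q′)
    go : ∀ h′ → h′ ≡ Vec.map f hd →
      output K q db ds ≈ (if respects h′ ds then ⟦ body q′ ⟧ db (assign h′ ds) else 0#)
    go h′ P.refl rewrite respects-map f hd ds inj with respects hd ds in eq
    ... | false = refl
    ... | true = begin
        ⟦ body q ⟧ db (assign hd ds) ≈⟨ ⟦⟧≈⟦⟧[] (body q) N db _ (wf q) (ℕP.m≤m⊔n _ _) ⟩
        ⟦ body q ⟧[ N ] db (assign hd ds) ≈⟨ body-≈ N db (ℕP.m≤m⊔n _ _) (ℕP.m≤n⊔m _ _) _ _ agree ⟩
        ⟦ body q′ ⟧[ N ] db (assign (Vec.map f hd) ds) ≈⟨ sym (⟦⟧≈⟦⟧[] (body q′) N db _ (wf q′) (ℕP.m≤n⊔m _ _)) ⟩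
        ⟦ body q′ ⟧ db (assign (Vec.map f hd) ds) ∎
      where
      open SetoidReasoning setoid
      r1 : RespectsRepetitions hd ds
      r1 = respects⇒RespectsRepetitions hd ds eq
      r2 : RespectsRepetitions (Vec.map f hd) ds
      r2 = respects⇒RespectsRepetitions (Vec.map f hd) ds (P.trans (respects-map f hd ds inj) eq)
      agree : ∀ v → v ∈ toList hd → assign (Vec.map f hd) ds (f v) ≡ assign hd ds v
      agree v m with ∈-toList⇒lookup hd v m
      ... | i , P.refl = P.trans (P.cong (assign (Vec.map f hd) ds) (P.sym (VecP.lookup-map i f hd)))
                          (P.trans (assign-lookup (Vec.map f hd) ds r2 i) (P.sym (assign-lookup hd ds r1 i)))

module CQLabels where

  open JoinTree
  open Elimination

  free-conjFrom⁻ : ∀ a as v → v ∈ free (conjFrom a as) → Σ Atom λ b → b ∈ (a ∷ as) × v ∈ atomVars b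
  free-conjFrom⁻ a [] v m = a , here P.refl , m
  free-conjFrom⁻ a (b ∷ bs) v m with ∈-++⁻ (atomVars a) m
  ... | inj₁ m1 = a , here P.refl , m1
  ... | inj₂ m2 with free-conjFrom⁻ b bs v m2
  ... | c , cm , vm = c , there cm , vm

  free-conjFrom⁺ : ∀ a as b v → b ∈ (a ∷ as) → v ∈ atomVars b → v ∈ free (conjFrom a as)
  free-conjFrom⁺ a [] b v (here P.refl) m = m
  free-conjFrom⁺ a (c ∷ cs) b v (here P.refl) m = ∈-++⁺ˡ m
  free-conjFrom⁺ a (c ∷ cs) b v (there bm) m = ∈-++⁺ʳ (atomVars a) (free-conjFrom⁺ c cs b v bm m)

  relArities-conjFrom⁻ : ∀ a as b → b ∈ (a ∷ as) → All (_≤ 2) (relArities (conjFrom a as)) →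
    All (_≤ 2) (relArities (atom b))
  relArities-conjFrom⁻ a [] b (here P.refl) r = r
  relArities-conjFrom⁻ a (c ∷ cs) b (here P.refl) r = AllP.++⁻ˡ (relArities (atom a)) r
  relArities-conjFrom⁻ a (c ∷ cs) b (there bm) r = relArities-conjFrom⁻ c cs b bm (AllP.++⁻ʳ (relArities (atom a)) r)

  WF-exs⁻ : ∀ Y C → WF (exs Y C) → Distinct Y × (∀ y → y ∈ Y → y ∈ free C)
  WF-exs⁻ [] C w = [] , λ y ()
  WF-exs⁻ (y ∷ Y) C (ym , w) with WF-exs⁻ Y C w | free-exs⁻ Y C y ym
  ... | u , f | yf , ny = (ny ∷ u) , λ { z (here P.refl) → yf ; z (there m) → f z m }

  atomLabels : (as : List Atom) → Labels (map atomVars as)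
  atomLabels [] = []
  atomLabels (a ∷ as) = just (atom a) ∷ atomLabels as

  atomLabels-free⁻ : ∀ as v → v ∈ freeLabels (atomLabels as) → Σ Atom λ b → b ∈ as × v ∈ atomVars b
  atomLabels-free⁻ (a ∷ as) v m with ∈-++⁻ (atomVars a) m
  ... | inj₁ m1 = a , here P.refl , m1
  ... | inj₂ m2 with atomLabels-free⁻ as v m2
  ... | c , cm , vm = c , there cm , vm

  atomLabels-free⁺ : ∀ as b v → b ∈ as → v ∈ atomVars b → v ∈ freeLabels (atomLabels as)
  atomLabels-free⁺ (a ∷ as) b v (here P.refl) m = ∈-++⁺ˡ m
  atomLabels-free⁺ (a ∷ as) b v (there bm) m = ∈-++⁺ʳ (atomVars a) (atomLabels-free⁺ as b v bm m)

  atomLabels-admissible : ∀ as → (∀ b → b ∈ as → All (_≤ 2) (relArities (atom b))) →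
    AllAdmissible (atomLabels as)
  atomLabels-admissible [] r = tt
  atomLabels-admissible (a ∷ as) r = (tt , tt , r a (here P.refl) , λ v m → m) , atomLabels-admissible as
      (λ b m → r b (there m))

  AtMostTwo-vec : ∀ {k} (xs : Vec Var k) → k ≤ 2 → AtMostTwo (toList xs)
  AtMostTwo-vec [] le = 0 , 0 , λ v ()
  AtMostTwo-vec (x ∷ []) le = x , x , λ { v (here e) → inj₁ e }
  AtMostTwo-vec (x ∷ y ∷ []) le = x , y , λ { v (here e) → inj₁ e ; v (there (here e)) → inj₂ e }
  AtMostTwo-vec (x ∷ y ∷ z ∷ xs) (s≤s (s≤s ()))

  AtMostTwo-atom : ∀ b → All (_≤ 2) (relArities (atom b)) → AtMostTwo (atomVars b)
  AtMostTwo-atom (relA R xs) (le ∷ []) = AtMostTwo-vec xs le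
  AtMostTwo-atom (leqA x k) r = x , x , λ { v (here e) → inj₁ e }

  AtMostTwo-atoms : ∀ as → (∀ b → b ∈ as → All (_≤ 2) (relArities (atom b))) → All AtMostTwo (map atomVars as)
  AtMostTwo-atoms [] r = []
  AtMostTwo-atoms (a ∷ as) r = AtMostTwo-atom a (r a (here P.refl)) ∷ AtMostTwo-atoms as (λ b m → r b (there m))

  IsJust : Label → Set
  IsJust nothing = ⊥
  IsJust (just _) = ⊤

  SomeLabel : ∀ {hs} → Labels hs → Set
  SomeLabel [] = ⊥
  SomeLabel (f ∷ fs) = IsJust f ⊎ SomeLabel fs

  updateAt-SomeLabel : ∀ {hs n} (nm : n ∈ hs) (g : Label → Label) → (∀ x → IsJust x → IsJust (g x)) →
    (fs : Labels hs) → SomeLabel fs → SomeLabel (updateAt nm g fs)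
  updateAt-SomeLabel (here P.refl) g gj (f ∷ fs) (inj₁ j) = inj₁ (gj f j)
  updateAt-SomeLabel (here P.refl) g gj (f ∷ fs) (inj₂ a) = inj₂ a
  updateAt-SomeLabel (there nm) g gj (f ∷ fs) (inj₁ j) = inj₁ j
  updateAt-SomeLabel (there nm) g gj (f ∷ fs) (inj₂ a) = inj₂ (updateAt-SomeLabel nm g gj fs a)

  updateAt-SomeLabel′ : ∀ {hs n} (nm : n ∈ hs) (g : Label → Label) → (∀ x → IsJust (g x)) →
    (fs : Labels hs) → SomeLabel (updateAt nm g fs)
  updateAt-SomeLabel′ (here P.refl) g gj (f ∷ fs) = inj₁ (gj f)
  updateAt-SomeLabel′ (there nm) g gj (f ∷ fs) = inj₂ (updateAt-SomeLabel′ nm g gj fs)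

  andᴸ-justˡ : ∀ x y → IsJust x → IsJust (andᴸ x y)
  andᴸ-justˡ (just a) nothing j = tt
  andᴸ-justˡ (just a) (just b) j = tt

  andᴸ-justʳ : ∀ x y → IsJust y → IsJust (andᴸ x y)
  andᴸ-justʳ nothing (just b) j = tt
  andᴸ-justʳ (just a) (just b) j = tt

  eliminate-just : ∀ {H L} (e : Ears H L) (fs : Labels (H ∷ L)) Y → SomeLabel fs → IsJust (eliminate e fs Y)
  eliminate-just nil (fH ∷ []) Y (inj₁ j) = j
  eliminate-just {H} {h ∷ L} (snoc e (n , nm , att)) (fH ∷ fh ∷ fs) Y a = eliminate-just e _ _ (stepJ fh a)
    where
    rest : Labels (H ∷ L)
    rest = fH ∷ fs
    stepJ : ∀ f → SomeLabel {H ∷ h ∷ L} (fH ∷ f ∷ fs) →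
      SomeLabel (updateAt nm (absorb (privateVars Y n f) f) rest)
    stepJ (just ψ) a = updateAt-SomeLabel′ nm _ (λ x → andᴸ-justʳ x (just (exs _ ψ)) tt) rest
    stepJ nothing (inj₁ j) = updateAt-SomeLabel nm _ (λ x jx → andᴸ-justˡ x nothing jx) rest (inj₁ j)
    stepJ nothing (inj₂ (inj₂ a)) = updateAt-SomeLabel nm _ (λ x jx → andᴸ-justˡ x nothing jx) rest (inj₂ a)

  fromJust : (m : Label) → IsJust m → Formula
  fromJust (just φ) _ = φ

  fromJust-eq : (m : Label) (j : IsJust m) → m ≡ just (fromJust m j)
  fromJust-eq (just φ) _ = P.refl

module FreeConnexToFO2 where

  open JoinTree
  open Elimination
  open TwoVariableRenaming
  open CQLabels

  -- Abstract so that type checking never unfolds the decomposition.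
  abstract
    atomEars : ∀ H (as : List Atom) → Acyclic (H ∷ map atomVars as) →
      Σ (List Atom) λ as′ → (as′ ↭ as) × Ears H (map atomVars as′)
    atomEars H as acyclic-head with Acyclic⇒Ears H (map atomVars as) acyclic-head
    ... | L′ , pL , ears with PermP.↭-map-inv atomVars (Perm.↭-sym pL)
    ... | as′ , P.refl , as′↭as = as′ , Perm.↭-sym as′↭as , ears

  module Construction {k : ℕ} (q : Query k) (fc : BinaryFreeConnexCQ q) where
    bin : BinaryQuery q
    bin = proj₁ fc
    s : CQShape
    s = proj₁ (proj₂ fc)
    body≡ : body q ≡ cqFormula s
    body≡ = proj₁ (proj₂ (proj₂ fc))
    acyclic-head : Acyclic (toList (head q) ∷ map atomVars (cqAtoms s))
    acyclic-head = proj₂ (proj₂ (proj₂ (proj₂ fc)))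
    hd : Vec Var k
    hd = head q
    H : List Var
    H = toList hd
    Y : List Var
    Y = exVars s
    a0 : Atom
    a0 = firstAtom s
    as0 : List Atom
    as0 = moreAtoms s
    as : List Atom
    as = a0 ∷ as0
    C : Formula
    C = conjFrom a0 as0

    wf-body : WF (exs Y C)
    wf-body = P.subst WF body≡ (wf q)
    distinctY : Distinct Y
    distinctY = proj₁ (WF-exs⁻ Y C wf-body)
    Y⊆freeC : ∀ y → y ∈ Y → y ∈ free C
    Y⊆freeC = proj₂ (WF-exs⁻ Y C wf-body)
    C-binary : All (_≤ 2) (relArities C)
    C-binary = P.subst (All (_≤ 2)) (P.trans (P.cong relArities body≡) (relArities-exs Y C)) (proj₂ bin)
    atom-binary : ∀ b → b ∈ as → All (_≤ 2) (relArities (atom b))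
    atom-binary b m = relArities-conjFrom⁻ a0 as0 b m C-binary

    free-body⊆head : ∀ v → v ∈ free (exs Y C) → v ∈ H
    free-body⊆head v m = freeHead q v (P.subst (λ z → v ∈ free z) (P.sym body≡) m)
    head⊆free-body : ∀ v → v ∈ H → v ∈ free (exs Y C)
    head⊆free-body v m = P.subst (λ z → v ∈ free z) body≡ (headFree q v m)

    decomposition : Σ (List Atom) λ as′ → (as′ ↭ as) × Ears H (map atomVars as′)
    decomposition = atomEars H as acyclic-head
    as′ : List Atom
    as′ = proj₁ decomposition
    as′↭as : as′ ↭ as
    as′↭as = proj₁ (proj₂ decomposition)
    ears : Ears H (map atomVars as′)
    ears = proj₂ (proj₂ decomposition)
    to : ∀ {b} → b ∈ as′ → b ∈ as
    to = PermP.∈-resp-↭ as′↭as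
    from : ∀ {b} → b ∈ as → b ∈ as′
    from = PermP.∈-resp-↭ (Perm.↭-sym as′↭as)

    fs₀ : Labels (H ∷ map atomVars as′)
    fs₀ = nothing ∷ atomLabels as′

    inv₀ : Invariant fs₀ Y
    inv₀ = record
      { admissible = tt , atomLabels-admissible as′ (λ b m → atom-binary b (to m))
      ; small = AtMostTwo-vec hd (proj₁ bin) ∷ AtMostTwo-atoms as′ (λ b m → atom-binary b (to m))
      ; free⊆head∪Y = free⊆head∪Y ; Y⊆freeEars = Y⊆freeEars ; head⊆free = head⊆free ; Y∉head = Y∉head ; distinctY = distinctY }
      where
      free⊆head∪Y : ∀ v → v ∈ freeLabels fs₀ → v ∈ H ⊎ v ∈ Y
      free⊆head∪Y v m with atomLabels-free⁻ as′ v m | v ∈? Y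
      ... | _ | yes y = inj₂ y
      ... | b , bm , vb | no ny = inj₁ (free-body⊆head v (free-exs⁺ Y C v (free-conjFrom⁺ a0 as0 b v (to bm) vb) ny))
      Y⊆freeEars : ∀ v → v ∈ Y → v ∈ freeLabels (atomLabels as′)
      Y⊆freeEars v y with free-conjFrom⁻ a0 as0 v (Y⊆freeC v y)
      ... | b , bm , vb = atomLabels-free⁺ as′ b v (from bm) vb
      head⊆free : ∀ v → v ∈ H → v ∈ freeLabels fs₀
      head⊆free v m with free-conjFrom⁻ a0 as0 v (proj₁ (free-exs⁻ Y C v (head⊆free-body v m)))
      ... | b , bm , vb = atomLabels-free⁺ as′ b v (from bm) vb
      Y∉head : ∀ v → v ∈ Y → v ∉ H
      Y∉head v y m = proj₂ (free-exs⁻ Y C v (head⊆free-body v m)) y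

    someLabel₀ : SomeLabel fs₀
    someLabel₀ with as′ | as′↭as
    ... | [] | p with PermP.↭-length p
    ...   | ()
    someLabel₀ | b ∷ bs | p = inj₂ (inj₁ tt)

    R : Label
    R = eliminate ears fs₀ Y
    φ : Formula
    φ = fromJust R (eliminate-just ears fs₀ Y someLabel₀)
    R≡φ : R ≡ just φ
    R≡φ = fromJust-eq R (eliminate-just ears fs₀ Y someLabel₀)
    R-admissible : Admissible H R × (∀ v → v ∈ H → v ∈ freeᴸ R)
    R-admissible = eliminate-admissible ears fs₀ Y inv₀
    φ-admissible : Admissible H (just φ)
    φ-admissible = P.subst (Admissible H) R≡φ (proj₁ R-admissible)
    head⊆freeφ : ∀ v → v ∈ H → v ∈ free φ
    head⊆freeφ v m = P.subst (λ z → v ∈ freeᴸ z) R≡φ (proj₂ R-admissible v m)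
    wfφ : WF φ
    wfφ = proj₁ φ-admissible
    twoφ : TwoVariableScopes φ
    twoφ = proj₁ (proj₂ φ-admissible)
    relφ : All (_≤ 2) (relArities φ)
    relφ = proj₁ (proj₂ (proj₂ φ-admissible))
    freeφ⊆head : ∀ v → v ∈ free φ → v ∈ H
    freeφ⊆head = proj₂ (proj₂ (proj₂ φ-admissible))

    small-head : AtMostTwo H
    small-head = AtMostTwo-vec hd (proj₁ bin)
    a : Var
    a = proj₁ small-head
    ρ : Var → Bool
    ρ v = not (v ≡ᵇ a)
    f : Var → Var
    f v = bitVar (ρ v)

    f-injective : ∀ u v → u ∈ H → v ∈ H → f u ≡ f v → u ≡ v
    f-injective u v um vm e with proj₂ (proj₂ small-head) u um | proj₂ (proj₂ small-head) v vm
    ... | inj₁ P.refl | inj₁ P.refl = P.refl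
    ... | inj₂ P.refl | inj₂ P.refl = P.refl
    ... | inj₁ P.refl | inj₂ P.refl = P.sym (≡ᵇ-true⇒≡ v u (P.trans (BP.not-injective (P.sym
        (bitVar-injective e))) (≡ᵇ-refl u)))
    ... | inj₂ P.refl | inj₁ P.refl = ≡ᵇ-true⇒≡ u v (P.trans (BP.not-injective (bitVar-injective e)) (≡ᵇ-refl v))

    body′ : Formula
    body′ = rename01 φ ρ
    head′ : Vec Var k
    head′ = Vec.map f hd

    q′ : Query k
    q′ = record
      { body = body′
      ; head = head′
      ; headFree = λ x m → let (v , vm , e) = ∈-toList-map⁻ f hd x m in
                     P.subst (_∈ free body′) (P.sym e) (rename01-free⁺ φ ρ wfφ twoφ v (head⊆freeφ v vm))
      ; freeHead = λ x m → let (v , vm , e) = rename01-free⁻ φ ρ x m in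
                     P.subst (_∈ toList head′) (P.sym e) (∈-toList-map⁺ f hd v (freeφ⊆head v vm))
      ; wf = rename01-WF φ ρ wfφ twoφ }

    fo2 : FO2Query q′
    fo2 = (proj₁ bin , P.subst (All (_≤ 2)) (P.sym (relArities-rename01 φ ρ)) relφ) , (0 , 1 , rename01-vars φ ρ)

    module _ {c ℓ} (K : CommutativeSemiring c ℓ) where
      open CommutativeSemiring K
      open Evaluation K
      open EliminationSemantics K
      open RenamingSemantics K
      open Outputs K
      open Semantics K
      open SetoidReasoning setoid

      labelsProduct-atomLabels : ∀ N db bs μ →
        labelsProduct N db (atomLabels bs) μ ≈ prodOver (atomValue N db) bs μ
      labelsProduct-atomLabels N db [] μ = refl
      labelsProduct-atomLabels N db (b ∷ bs) μ = *-cong refl (labelsProduct-atomLabels N db bs μ)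

      body-≈ : ∀ N db → bnd db (body q) ≤ N → bnd db body′ ≤ N → ∀ ν ν′ →
        (∀ v → v ∈ H → ν′ (f v) ≡ ν v) → ⟦ body q ⟧[ N ] db ν ≈ ⟦ body′ ⟧[ N ] db ν′
      body-≈ N db _ _ ν ν′ ag = begin
        ⟦ body q ⟧[ N ] db ν ≡⟨ P.cong (λ z → ⟦ z ⟧[ N ] db ν) body≡ ⟩
        ⟦ exs Y C ⟧[ N ] db ν ≈⟨ ⟦exs⟧ N db Y C ν ⟩
        sumVars N Y (⟦ C ⟧[ N ] db) ν ≈⟨ sumVars-cong N Y (λ μ → ⟦conjFrom⟧ N db a0 as0 μ) ν ⟩
        sumVars N Y (prodOver (atomValue N db) as) ν
          ≈⟨ sumVars-cong N Y (λ μ → prodOver-↭ (atomValue N db) (Perm.↭-sym as′↭as) μ) ν ⟩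
        sumVars N Y (prodOver (atomValue N db) as′) ν
          ≈⟨ sumVars-cong N Y (λ μ → trans (sym (labelsProduct-atomLabels N db as′ μ)) (sym (*-identityˡ _))) ν ⟩
        sumVars N Y (labelsProduct N db fs₀) ν ≈⟨ eliminate-sound N db ears fs₀ Y inv₀ ν ⟩
        labelValue N db R ν ≡⟨ P.cong (λ z → labelValue N db z ν) R≡φ ⟩
        ⟦ φ ⟧[ N ] db ν ≈⟨ sym (rename01-sound φ ρ N db wfφ twoφ ν′ ν (λ v m → ag v (freeφ⊆head v m))) ⟩
        ⟦ body′ ⟧[ N ] db ν′ ∎

      equiv : ∀ db ds → output K q db ds ≈ output K q′ db ds
      equiv = output-≈ q q′ f P.refl f-injective body-≈

  freeConnex⇒FO2 : ∀ (k : ℕ) (q : Query k) → BinaryFreeConnexCQ q → EquivalentIn FO2Query q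
  freeConnex⇒FO2 k q fc = witness (Construction.q′ q fc) (Construction.fo2 q fc)
      (λ K _ db ds → Construction.equiv q fc K db ds)

module ParentAcyclicity where

  open JoinTree
  open import Data.Nat using (_*_)

  maxVar : List Var → Var
  maxVar [] = 0
  maxVar (x ∷ []) = x
  maxVar (x ∷ y ∷ ys) = x ⊔ maxVar (y ∷ ys)

  maxVar-≥ : ∀ h v → v ∈ h → v ≤ maxVar h
  maxVar-≥ (x ∷ []) v (here P.refl) = ℕP.≤-refl
  maxVar-≥ (x ∷ y ∷ ys) v (here P.refl) = ℕP.m≤m⊔n x _
  maxVar-≥ (x ∷ y ∷ ys) v (there m) = ℕP.≤-trans (maxVar-≥ (y ∷ ys) v m) (ℕP.m≤n⊔m x _)

  maxVar-∈ : ∀ x xs → maxVar (x ∷ xs) ∈ (x ∷ xs)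
  maxVar-∈ x [] = here P.refl
  maxVar-∈ x (y ∷ ys) with ℕP.≤-total x (maxVar (y ∷ ys))
  ... | inj₁ le = P.subst (_∈ (x ∷ y ∷ ys)) (P.sym (ℕP.m≤n⇒m⊔n≡n le)) (there (maxVar-∈ y ys))
  ... | inj₂ ge = P.subst (_∈ (x ∷ y ∷ ys)) (P.sym (ℕP.m≥n⇒m⊔n≡m ge)) (here P.refl)

  Binary : List Var → Set
  Binary h = Any (λ v → ¬ v ≡ maxVar h) h

  binary? : ∀ h → Dec (Binary h)
  binary? h = any? (λ v → ¬? (v ℕ.≟ maxVar h)) h

  -- Nodes are attached in increasing rank: {t, par t} has rank 2t and {t} has rank 2t + 1.
  -- When {t, par t} is attached, every earlier node containing t contains par t as well
  -- (rank≤⇒parent), so it can be attached there.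
  rankOf : ∀ {A : Set} → Dec A → ℕ → ℕ
  rankOf (yes _) t = 2 * t
  rankOf (no _) t = suc (2 * t)

  rank : List Var → ℕ
  rank h = rankOf (binary? h) (maxVar h)

  rank-binary : ∀ h → Binary h → rank h ≡ 2 * maxVar h
  rank-binary h b with binary? h
  ... | yes _ = P.refl
  ... | no nb = ⊥-elim (nb b)

  rank-≥ : ∀ h → 2 * maxVar h ≤ rank h
  rank-≥ h with binary? h
  ... | yes _ = ℕP.≤-refl
  ... | no _ = ℕP.n≤1+n _

  -- par is the parent function of a forest on the variables (par t < t), and a node
  -- consists of its largest variable t, possibly together with par t.
  ParentShaped : (Var → Var) → List Var → Set
  ParentShaped par h = ∀ v → v ∈ h → v ≡ maxVar h ⊎ (v ≡ par (maxVar h) × par (maxVar h) < maxVar h)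

  rank≤⇒parent : ∀ par g t → ParentShaped par g → t ∈ g → rank g ≤ 2 * t →
    maxVar g ≡ t × Σ Var λ u → u ∈ g × u ≡ par t
  rank≤⇒parent par g t fc tm kle with ℕP.<-cmp t (maxVar g)
  ... | tri< lt _ _ = ⊥-elim (ℕP.<-irrefl P.refl (ℕP.<-≤-trans
          (ℕP.*-monoʳ-< 2 lt) (ℕP.≤-trans (rank-≥ g) kle)))
  ... | tri> _ _ gt = ⊥-elim (ℕP.<⇒≱ gt (maxVar-≥ g t tm))
  ... | tri≈ _ e _ with binary? g
  ...   | no nb = ⊥-elim (ℕP.<-irrefl P.refl (P.subst (λ z → suc (2 * z) ≤ 2 * t) (P.sym e) kle))
  ...   | yes b with find b
  ...     | u , um , ne with fc u um
  ...       | inj₁ x = ⊥-elim (ne x)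
  ...       | inj₂ (x , _) = P.sym e , u , um , P.trans x (P.cong par (P.sym e))

  HeadClosed : List Var → List Var → Set
  HeadClosed R h = maxVar h ∈ R → ∀ v → v ∈ h → v ∈ R

  ∉-concat : ∀ t (R : List Var) rest → t ∉ R → ¬ Any (t ∈_) rest → t ∉ concat (R ∷ rest)
  ∉-concat t R rest nR nA m with ∈-concat⁻′ (R ∷ rest) m
  ... | x , tx , here P.refl = nR tx
  ... | x , tx , there xm = nA (Any.map (λ { P.refl → tx }) xm)

  attach-unary : ∀ R rest h t → (∀ v → v ∈ h → v ≡ t) → Attach R rest h
  attach-unary R rest h t h≡t with t ∈? concat (R ∷ rest)
  ... | yes m = let (n , tn , nm) = ∈-concat⁻′ (R ∷ rest) m in
                n , nm , λ v vh _ → P.subst (_∈ n) (P.sym (h≡t v vh)) tn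
  ... | no nm = R , here P.refl , λ v vh vc → ⊥-elim (nm (P.subst (_∈ concat (R ∷ rest)) (h≡t v vh) vc))

  attach-binary : ∀ par R rest h t → (∀ v → v ∈ h → v ≡ t ⊎ v ≡ par t) →
    (∀ g → g ∈ rest → ParentShaped par g) → All (λ g → rank g ≤ 2 * t) rest →
    (t ∈ R → ∀ v → v ∈ h → v ∈ R) → Attach R rest h
  attach-binary par R rest h t h⊆tp rest-shaped rest-ranks t∈R⇒h⊆R with any? (t ∈?_) rest
  ... | yes t∈rest = let (g , gm , tg) = find t∈rest
                         (_ , u , um , u≡pt) = rank≤⇒parent par g t (rest-shaped g gm) tg (All.lookup rest-ranks gm) in
                     g , there gm , λ v vh _ → Sum.[ (λ { P.refl → tg }) , (λ { P.refl → P.subst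
                         (_∈ g) u≡pt um }) ] (h⊆tp v vh)
  ... | no t∉rest with t ∈? R
  ...   | yes tR = R , here P.refl , λ v vh _ → t∈R⇒h⊆R tR v vh
  ...   | no t∉R = parent-or-head (par t ∈? concat (R ∷ rest))
    where
    t∉ : t ∉ concat (R ∷ rest)
    t∉ = ∉-concat t R rest t∉R t∉rest
    parent-or-head : Dec (par t ∈ concat (R ∷ rest)) → Attach R rest h
    parent-or-head (yes m) = let (n , pn , nm) = ∈-concat⁻′ (R ∷ rest) m in
      n , nm , λ v vh vc → Sum.[ (λ { P.refl → ⊥-elim (t∉ vc) }) , (λ { P.refl → pn }) ] (h⊆tp v vh)
    parent-or-head (no p∉) =
      R , here P.refl , λ v vh vc → Sum.[ (λ { P.refl → ⊥-elim (t∉ vc) }) , (λ { P.refl → ⊥-elim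
          (p∉ vc) }) ] (h⊆tp v vh)

  attach-by-rank : ∀ par R rest h → ParentShaped par h → (∀ g → g ∈ rest → ParentShaped par g) →
    All (λ g → rank g ≤ rank h) rest → HeadClosed R h → Attach R rest h
  attach-by-rank par R rest h h-shaped rest-shaped rest-ranks closed with binary? h
  ... | no unary = attach-unary R rest h (maxVar h) h≡max
    where
    h≡max : ∀ v → v ∈ h → v ≡ maxVar h
    h≡max v vh with v ℕ.≟ maxVar h
    ... | yes e = e
    ... | no ne = ⊥-elim (unary (Any.map (λ { P.refl → ne }) vh))
  ... | yes binary = attach-binary par R rest h (maxVar h) h⊆tp rest-shaped rest-ranks closed
    where
    h⊆tp : ∀ v → v ∈ h → v ≡ maxVar h ⊎ v ≡ par (maxVar h)
    h⊆tp v vh = Sum.map₂ proj₁ (h-shaped v vh)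

  data RankDescending : List (List Var) → Set where
    []  : RankDescending []
    _∷_ : ∀ {h r} → All (λ g → rank g ≤ rank h) r → RankDescending r → RankDescending (h ∷ r)

  insertByRank : List Var → List (List Var) → List (List Var)
  insertByRank x [] = x ∷ []
  insertByRank x (h ∷ r) with rank h ℕ.≤? rank x
  ... | yes _ = x ∷ h ∷ r
  ... | no _ = h ∷ insertByRank x r

  insertByRank-↭ : ∀ x T → insertByRank x T ↭ x ∷ T
  insertByRank-↭ x [] = Perm.refl
  insertByRank-↭ x (h ∷ r) with rank h ℕ.≤? rank x
  ... | yes _ = Perm.refl
  ... | no _ = Perm.trans (Perm.prep h (insertByRank-↭ x r)) (Perm.swap h x Perm.refl)

  All-↭ : ∀ {P : List Var → Set} {xs ys} → xs ↭ ys → All P ys → All P xs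
  All-↭ p a = All.tabulate (λ m → All.lookup a (PermP.∈-resp-↭ p m))

  insertByRank-descending : ∀ x T → RankDescending T → RankDescending (insertByRank x T)
  insertByRank-descending x [] [] = [] ∷ []
  insertByRank-descending x (h ∷ r) (a ∷ d) with rank h ℕ.≤? rank x
  ... | yes le = (le ∷ All.map (λ g → ℕP.≤-trans g le) a) ∷ (a ∷ d)
  ... | no nle = All-↭ (insertByRank-↭ x r) (ℕP.<⇒≤ (ℕP.≰⇒> nle) ∷ a) ∷ insertByRank-descending x r d

  sortByRank : List (List Var) → List (List Var)
  sortByRank [] = []
  sortByRank (x ∷ xs) = insertByRank x (sortByRank xs)

  sortByRank-↭ : ∀ T → sortByRank T ↭ T
  sortByRank-↭ [] = Perm.refl
  sortByRank-↭ (x ∷ xs) = Perm.trans (insertByRank-↭ x (sortByRank xs)) (Perm.prep x (sortByRank-↭ xs))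

  sortByRank-descending : ∀ T → RankDescending (sortByRank T)
  sortByRank-descending [] = []
  sortByRank-descending (x ∷ xs) = insertByRank-descending x (sortByRank xs) (sortByRank-descending xs)

  ears-by-rank : ∀ par R T → RankDescending T → All (ParentShaped par) T → All (HeadClosed R) T → Ears R T
  ears-by-rank par R [] [] _ _ = nil
  ears-by-rank par R (h ∷ r) (a ∷ d) (fh ∷ fr) (rh ∷ rr) =
    snoc (ears-by-rank par R r d fr rr) (attach-by-rank par R r h fh (λ g m → All.lookup fr m) a rh)

  acyclic-with-head : ∀ par H L → (∀ h → h ∈ L → ParentShaped par h) → (∀ h → h ∈ L →
    HeadClosed H h) → Acyclic (H ∷ L)
  acyclic-with-head par H L fc rt = Acyclic-↭ (Perm.prep H (sortByRank-↭ L))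
    (Ears⇒Acyclic H (sortByRank L) (ears-by-rank par H (sortByRank L) (sortByRank-descending L)
       (All.tabulate (λ m → fc _ (PermP.∈-resp-↭ (sortByRank-↭ L) m)))
       (All.tabulate (λ m → rt _ (PermP.∈-resp-↭ (sortByRank-↭ L) m)))))

  split-lowest : ∀ (T : List (List Var)) → RankDescending T → ¬ T ≡ [] →
    Σ (List (List Var)) λ I → Σ (List Var) λ l → (T ≡ I ∷ʳ l) × RankDescending I × All (λ g → rank l ≤ rank g) I
  split-lowest [] d ne = ⊥-elim (ne P.refl)
  split-lowest (h ∷ []) d ne = [] , h , P.refl , [] , []
  split-lowest (h ∷ g ∷ r) (a ∷ d) ne with split-lowest (g ∷ r) d (λ ())
  ... | I , l , e , dI , al =
    h ∷ I , l , P.cong (h ∷_) e , AllP.++⁻ˡ I below-h ∷ dI , All.head (AllP.++⁻ʳ I below-h) ∷ al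
    where
    below-h : All (λ g → rank g ≤ rank h) (I ∷ʳ l)
    below-h = P.subst (All (λ g → rank g ≤ rank h)) e a

  -- Without the head, the node of least rank takes its role.
  acyclic-headless : ∀ par L → ¬ L ≡ [] → (∀ h → h ∈ L → ParentShaped par h) → Acyclic L
  acyclic-headless par L ne fc with split-lowest (sortByRank L) (sortByRank-descending L) (ne ∘ sorted-empty)
    where
    sorted-empty : sortByRank L ≡ [] → L ≡ []
    sorted-empty e = PermP.↭-empty-inv (Perm.↭-sym (P.subst (_↭ L) e (sortByRank-↭ L)))
  ... | I , l , e , dI , al = Acyclic-↭ perm (Ears⇒Acyclic l I (ears-by-rank par l I dI fI rI))
    where
    memT : ∀ {g} → g ∈ sortByRank L → g ∈ L
    memT = PermP.∈-resp-↭ (sortByRank-↭ L)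
    memI : ∀ {g} → g ∈ I → g ∈ L
    memI m = memT (P.subst (_ ∈_) (P.sym e) (∈-++⁺ˡ m))
    fl : ParentShaped par l
    fl = fc l (memT (P.subst (l ∈_) (P.sym e) (∈-++⁺ʳ I (here P.refl))))
    fI : All (ParentShaped par) I
    fI = All.tabulate (λ m → fc _ (memI m))
    rI : All (HeadClosed l) I
    rI = All.tabulate l-closed
      where
      l-closed : ∀ {h} → h ∈ I → HeadClosed l h
      l-closed {h} hm tl v vh with binary? h
      ... | yes b = let (_ , u , um , ue) = rank≤⇒parent par l (maxVar h) fl tl
                           (P.subst (rank l ≤_) (rank-binary h b) (All.lookup al hm)) in
                    two (fc h (memI hm) v vh) um ue
        where
        two : v ≡ maxVar h ⊎ (v ≡ par (maxVar h) × par (maxVar h) < maxVar h) → ∀ {u} → u ∈ l →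
          u ≡ par (maxVar h) → v ∈ l
        two (inj₁ P.refl) um ue = tl
        two (inj₂ (P.refl , _)) um P.refl = um
      ... | no nb with v ℕ.≟ maxVar h
      ...   | yes P.refl = tl
      ...   | no ne = ⊥-elim (nb (Any.map (λ { P.refl → ne }) vh))
    perm : l ∷ I ↭ L
    perm = Perm.trans (PermP.∷↭∷ʳ l I) (P.subst (_↭ L) e (sortByRank-↭ L))

module Flattening where

  open Elimination
  open ParentAcyclicity

  <ᵇ-true : ∀ x y → x < y → (x <ᵇ y) ≡ true
  <ᵇ-true x y lt with x <ᵇ y in eq
  ... | true = P.refl
  ... | false = ⊥-elim (P.subst T eq (ℕP.<⇒<ᵇ lt))

  <ᵇ-false : ∀ x y → y ≤ x → (x <ᵇ y) ≡ false
  <ᵇ-false x y le with x <ᵇ y in eq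
  ... | false = P.refl
  ... | true = ⊥-elim (ℕP.<⇒≱ (ℕP.<ᵇ⇒< x y (P.subst T (P.sym eq) tt)) le)

  renameAtom : (Var → Var) → Atom → Atom
  renameAtom ρ (relA R xs) = relA R (Vec.map ρ xs)
  renameAtom ρ (leqA x k) = leqA (ρ x) k

  renameAtom-vars⁻ : ∀ ρ α v → v ∈ atomVars (renameAtom ρ α) → Σ Var λ n → n ∈ atomVars α × v ≡ ρ n
  renameAtom-vars⁻ ρ (relA R xs) v m = ∈-map⁻ ρ (P.subst (v ∈_) (VecP.toList-map ρ xs) m)
  renameAtom-vars⁻ ρ (leqA x k) v (here P.refl) = x , here P.refl , P.refl

  renameAtom-vars⁺ : ∀ ρ α n → n ∈ atomVars α → ρ n ∈ atomVars (renameAtom ρ α)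
  renameAtom-vars⁺ ρ (relA R xs) n m = P.subst (ρ n ∈_) (P.sym (VecP.toList-map ρ xs)) (∈-map⁺ ρ m)
  renameAtom-vars⁺ ρ (leqA x k) n (here P.refl) = here P.refl

  relArities-renameAtom : ∀ ρ α → relArities (atom (renameAtom ρ α)) ≡ relArities (atom α)
  relArities-renameAtom ρ (relA R xs) = P.refl
  relArities-renameAtom ρ (leqA x k) = P.refl

  record Flattened : Set where
    constructor flattened
    field
      boundVars : List Var
      atoms : List Atom
      next : ℕ
      parent : Var → Var
  open Flattened public

  module Flatten (a b : Var) where
    other : Var → Var
    other x = if x ≡ᵇ a then b else a

    -- flatten φ ρ c renames the free variables of φ by ρ and its quantified variables to
    -- fresh c, c + 1, … below next; a fresh variable's parent is the image of the other of
    -- a and b, the only other variable that can be free in its scope.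
    flatten : Formula → (Var → Var) → ℕ → Flattened
    flatten (atom α) ρ c = flattened [] (renameAtom ρ α ∷ []) c (λ v → v)
    flatten (and φ ψ) ρ c =
      flattened (boundVars r1 ++ boundVars r2) (atoms r1 ++ atoms r2) (next r2)
          (λ v → if v <ᵇ next r1 then parent r1 v else parent r2 v)
      where
      r1 r2 : Flattened
      r1 = flatten φ ρ c
      r2 = flatten ψ ρ (next r1)
    flatten (ex x φ) ρ c =
      flattened (c ∷ boundVars r) (atoms r) (next r) (λ v → if v ≡ᵇ c then ρ (other x) else parent r v)
      where
      r : Flattened
      r = flatten φ (ρ [ x ≔ c ]) (suc c)

    OccursIn : List Atom → Var → Set
    OccursIn as v = Σ Atom λ h → h ∈ as × v ∈ atomVars h

    OccursIn-++ˡ : ∀ as bs v → OccursIn as v → OccursIn (as ++ bs) v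
    OccursIn-++ˡ as bs v (h , hm , vm) = h , ∈-++⁺ˡ hm , vm
    OccursIn-++ʳ : ∀ as bs v → OccursIn bs v → OccursIn (as ++ bs) v
    OccursIn-++ʳ as bs v (h , hm , vm) = h , ∈-++⁺ʳ as hm , vm
    OccursIn-++⁻ : ∀ as bs v → OccursIn (as ++ bs) v → OccursIn as v ⊎ OccursIn bs v
    OccursIn-++⁻ as bs v (h , hm , vm) with ∈-++⁻ as hm
    ... | inj₁ m = inj₁ (h , m , vm)
    ... | inj₂ m = inj₂ (h , m , vm)

    RenamedBelow : (Var → Var) → Formula → ℕ → Set
    RenamedBelow ρ φ c = ∀ n → n ∈ allVars φ → ρ n < c

    next-≥ : ∀ φ ρ c → c ≤ next (flatten φ ρ c)
    next-≥ (atom α) ρ c = ℕP.≤-refl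
    next-≥ (and φ ψ) ρ c = ℕP.≤-trans (next-≥ φ ρ c) (next-≥ ψ ρ _)
    next-≥ (ex x φ) ρ c = ℕP.≤-trans (ℕP.n≤1+n c) (next-≥ φ _ (suc c))

    next->-ex : ∀ x φ ρ c → c < next (flatten (ex x φ) ρ c)
    next->-ex x φ ρ c = next-≥ φ _ (suc c)

    boundVars-range : ∀ φ ρ c y → y ∈ boundVars (flatten φ ρ c) → c ≤ y × y < next (flatten φ ρ c)
    boundVars-range (and φ ψ) ρ c y m with ∈-++⁻ (boundVars (flatten φ ρ c)) m
    ... | inj₁ m1 = let (l , u) = boundVars-range φ ρ c y m1 in l , ℕP.<-≤-trans u (next-≥ ψ ρ _)
    ... | inj₂ m2 = let (l , u) = boundVars-range ψ ρ _ y m2 in ℕP.≤-trans (next-≥ φ ρ c) l , u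
    boundVars-range (ex x φ) ρ c y (here P.refl) = ℕP.≤-refl , next->-ex x φ ρ c
    boundVars-range (ex x φ) ρ c y (there m) = let (l , u) = boundVars-range φ _ (suc c) y m in ℕP.<⇒≤ l , u

    occurs-range : ∀ φ ρ c v → OccursIn (atoms (flatten φ ρ c)) v →
      (Σ Var λ n → n ∈ allVars φ × v ≡ ρ n) ⊎ (c ≤ v × v < next (flatten φ ρ c))
    occurs-range (atom α) ρ c v (h , here P.refl , vm) = inj₁ (renameAtom-vars⁻ ρ α v vm)
    occurs-range (and φ ψ) ρ c v av with OccursIn-++⁻ (atoms (flatten φ ρ c)) _ v av
    ... | inj₁ a1 with occurs-range φ ρ c v a1
    ...   | inj₁ (n , nm , e) = inj₁ (n , ∈-++⁺ˡ nm , e)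
    ...   | inj₂ (l , u) = inj₂ (l , ℕP.<-≤-trans u (next-≥ ψ ρ _))
    occurs-range (and φ ψ) ρ c v av | inj₂ a2 with occurs-range ψ ρ _ v a2
    ...   | inj₁ (n , nm , e) = inj₁ (n , ∈-++⁺ʳ (allVars φ) nm , e)
    ...   | inj₂ (l , u) = inj₂ (ℕP.≤-trans (next-≥ φ ρ c) l , u)
    occurs-range (ex x φ) ρ c v av with occurs-range φ (ρ [ x ≔ c ]) (suc c) v av
    ... | inj₂ (l , u) = inj₂ (ℕP.<⇒≤ l , u)
    ... | inj₁ (n , nm , e) with n ℕ.≟ x
    ...   | yes P.refl = inj₂ (ℕP.≤-reflexive (P.sym (P.trans e (≔-same ρ n c))) ,
                               P.subst (_< _) (P.sym (P.trans e (≔-same ρ n c))) (next->-ex x φ ρ c))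
    ...   | no nx = inj₁ (n , there nm , P.trans e (≔-other ρ x c n nx))

    RenamedBelow-ex : ∀ x φ ρ c → RenamedBelow ρ (ex x φ) c → RenamedBelow (ρ [ x ≔ c ]) φ (suc c)
    RenamedBelow-ex x φ ρ c rl n nm with n ℕ.≟ x
    ... | yes P.refl rewrite ≔-same ρ n c = ℕP.≤-refl
    ... | no nx rewrite ≔-other ρ x c n nx = ℕP.m≤n⇒m≤1+n (rl n (there nm))

    RenamedBelow-andˡ : ∀ φ ψ ρ c → RenamedBelow ρ (and φ ψ) c → RenamedBelow ρ φ c
    RenamedBelow-andˡ φ ψ ρ c rl n m = rl n (∈-++⁺ˡ m)
    RenamedBelow-andʳ : ∀ φ ψ ρ c c′ → c ≤ c′ → RenamedBelow ρ (and φ ψ) c → RenamedBelow ρ ψ c′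
    RenamedBelow-andʳ φ ψ ρ c c′ le rl n m = ℕP.<-≤-trans (rl n (∈-++⁺ʳ (allVars φ) m)) le

    free⊆all : ∀ φ n → n ∈ free φ → n ∈ allVars φ
    free⊆all (atom α) n m = m
    free⊆all (and φ ψ) n m with ∈-++⁻ (free φ) m
    ... | inj₁ m1 = ∈-++⁺ˡ (free⊆all φ n m1)
    ... | inj₂ m2 = ∈-++⁺ʳ (allVars φ) (free⊆all ψ n m2)
    free⊆all (ex x φ) n m = there (free⊆all φ n (proj₁ (free-exs⁻ (x ∷ []) φ n m)))

    free-right∉bound-left : ∀ φ ψ ρ c → RenamedBelow ρ (and φ ψ) c →
      ∀ n → n ∈ free ψ → ρ n ∉ boundVars (flatten φ ρ c)
    free-right∉bound-left φ ψ ρ c rl n m y =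
      ℕP.<⇒≱ (rl n (∈-++⁺ʳ (allVars φ) (free⊆all ψ n m))) (proj₁ (boundVars-range φ ρ c _ y))

    free-left∉bound-right : ∀ φ ψ ρ c → RenamedBelow ρ (and φ ψ) c →
      ∀ n → n ∈ free φ → ρ n ∉ boundVars (flatten ψ ρ (next (flatten φ ρ c)))
    free-left∉bound-right φ ψ ρ c rl n m y =
      ℕP.<⇒≱ (ℕP.<-≤-trans (rl n (∈-++⁺ˡ (free⊆all φ n m))) (next-≥ φ ρ c)) (proj₁ (boundVars-range ψ ρ _ _ y))

    occurs-left∉bound-right : ∀ φ ψ ρ c → RenamedBelow ρ (and φ ψ) c →
      ∀ v → OccursIn (atoms (flatten φ ρ c)) v → v ∉ boundVars (flatten ψ ρ (next (flatten φ ρ c)))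
    occurs-left∉bound-right φ ψ ρ c rl v av vy with occurs-range φ ρ c v av | boundVars-range ψ ρ _ v vy
    ... | inj₁ (n , nm , P.refl) | (l , _) = ℕP.<⇒≱ (ℕP.<-≤-trans (rl n (∈-++⁺ˡ nm)) (next-≥ φ ρ c)) l
    ... | inj₂ (_ , u) | (l , _) = ℕP.<⇒≱ u l

    free⇒occurs : ∀ φ ρ c → RenamedBelow ρ φ c → ∀ n → n ∈ free φ →
      OccursIn (atoms (flatten φ ρ c)) (ρ n) × ρ n ∉ boundVars (flatten φ ρ c)
    free⇒occurs (atom α) ρ c rl n m = (renameAtom ρ α , here P.refl , renameAtom-vars⁺ ρ α n m) , λ ()
    free⇒occurs (and φ ψ) ρ c rl n m with ∈-++⁻ (free φ) m
    ... | inj₁ m1 = let (av , ny) = free⇒occurs φ ρ c (RenamedBelow-andˡ φ ψ ρ c rl) n m1 in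
      OccursIn-++ˡ _ _ _ av ,
      Sum.[ ny , free-left∉bound-right φ ψ ρ c rl n m1 ] ∘ ∈-++⁻ (boundVars (flatten φ ρ c))
    ... | inj₂ m2 = let (av , ny) = free⇒occurs ψ ρ _ (RenamedBelow-andʳ φ ψ ρ c _ (next-≥ φ ρ c) rl) n m2 in
      OccursIn-++ʳ (atoms (flatten φ ρ c)) _ _ av ,
      Sum.[ free-right∉bound-left φ ψ ρ c rl n m2 , ny ] ∘ ∈-++⁻ (boundVars (flatten φ ρ c))
    free⇒occurs (ex x φ) ρ c rl n m with free-exs⁻ (x ∷ []) φ n m
    ... | mφ , nx′ = P.subst Goal (≔-other ρ x c n nx) (av , ny′)
      where
      Goal : Var → Set
      Goal z = OccursIn (atoms (flatten φ (ρ [ x ≔ c ]) (suc c))) z × z ∉ boundVars (flatten (ex x φ) ρ c)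
      nx : ¬ n ≡ x
      nx e = nx′ (here e)
      r : OccursIn (atoms (flatten φ (ρ [ x ≔ c ]) (suc c))) ((ρ [ x ≔ c ]) n) ×
          (ρ [ x ≔ c ]) n ∉ boundVars (flatten φ (ρ [ x ≔ c ]) (suc c))
      r = free⇒occurs φ (ρ [ x ≔ c ]) (suc c) (RenamedBelow-ex x φ ρ c rl) n mφ
      av : OccursIn (atoms (flatten φ (ρ [ x ≔ c ]) (suc c))) ((ρ [ x ≔ c ]) n)
      av = proj₁ r
      ny′ : (ρ [ x ≔ c ]) n ∉ (c ∷ boundVars (flatten φ (ρ [ x ≔ c ]) (suc c)))
      ny′ (here e) = ℕP.<-irrefl (P.trans (P.sym (≔-other ρ x c n nx)) e) (rl n (there (free⊆all φ n mφ)))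
      ny′ (there y) = proj₂ r y

    occurs⇒free : ∀ φ ρ c → RenamedBelow ρ φ c → ∀ v → OccursIn (atoms (flatten φ ρ c)) v →
      v ∉ boundVars (flatten φ ρ c) → Σ Var λ n → n ∈ free φ × v ≡ ρ n
    occurs⇒free (atom α) ρ c rl v (h , here P.refl , vm) ny = renameAtom-vars⁻ ρ α v vm
    occurs⇒free (and φ ψ) ρ c rl v av ny with OccursIn-++⁻ (atoms (flatten φ ρ c)) _ v av
    ... | inj₁ a1 = let (n , nm , e) = occurs⇒free φ ρ c (RenamedBelow-andˡ φ ψ ρ c rl) v a1 (λ y → ny (∈-++⁺ˡ y)) in n , ∈-++⁺ˡ nm , e
    ... | inj₂ a2 = let (n , nm , e) = occurs⇒free ψ ρ _ (RenamedBelow-andʳ φ ψ ρ c _ (next-≥ φ ρ c) rl) v a2 (λ y → ny (∈-++⁺ʳ (boundVars (flatten φ ρ c)) y)) in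
                    n , ∈-++⁺ʳ (free φ) nm , e
    occurs⇒free (ex x φ) ρ c rl v av ny with occurs⇒free φ (ρ [ x ≔ c ]) (suc c)
        (RenamedBelow-ex x φ ρ c rl) v av (λ y → ny (there y))
    ... | n , nm , e with n ℕ.≟ x
    ...   | yes P.refl = ⊥-elim (ny (here (P.trans e (≔-same ρ n c))))
    ...   | no nx = n , free-exs⁺ (x ∷ []) φ n nm (λ { (here q) → nx q }) , P.trans e (≔-other ρ x c n nx)

    distinct-++ : ∀ xs boundVars → Distinct xs → Distinct boundVars → (∀ v → v ∈ xs → v ∉ boundVars) →
      Distinct (xs ++ boundVars)
    distinct-++ [] boundVars [] u d = u
    distinct-++ (x ∷ xs) boundVars (nx ∷ u1) u2 d =
      (λ m → Sum.[ nx , d x (here P.refl) ] (∈-++⁻ xs m)) ∷ distinct-++ xs boundVars u1 u2 (λ v m → d v (there m))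

    boundVars-distinct : ∀ φ ρ c → Distinct (boundVars (flatten φ ρ c))
    boundVars-distinct (atom α) ρ c = []
    boundVars-distinct (and φ ψ) ρ c = distinct-++ _ _ (boundVars-distinct φ ρ c) (boundVars-distinct ψ ρ _)
      (λ v m1 m2 → ℕP.<⇒≱ (proj₂ (boundVars-range φ ρ c v m1)) (proj₁ (boundVars-range ψ ρ _ v m2)))
    boundVars-distinct (ex x φ) ρ c = (λ m → ℕP.<⇒≱ (proj₁ (boundVars-range φ _
        (suc c) c m)) ℕP.≤-refl) ∷ boundVars-distinct φ _ (suc c)

    boundVars-occur : ∀ φ ρ c → WF φ → RenamedBelow ρ φ c → ∀ y → y ∈ boundVars (flatten φ ρ c) →
      OccursIn (atoms (flatten φ ρ c)) y
    boundVars-occur (and φ ψ) ρ c (w1 , w2) rl y m with ∈-++⁻ (boundVars (flatten φ ρ c)) m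
    ... | inj₁ m1 = OccursIn-++ˡ _ _ _ (boundVars-occur φ ρ c w1 (RenamedBelow-andˡ φ ψ ρ c rl) y m1)
    ... | inj₂ m2 = OccursIn-++ʳ (atoms (flatten φ ρ c)) _ _ (boundVars-occur ψ ρ _ w2
        (RenamedBelow-andʳ φ ψ ρ c _ (next-≥ φ ρ c) rl) y m2)
    boundVars-occur (ex x φ) ρ c (xf , w) rl y (here P.refl) =
      P.subst (OccursIn _) (≔-same ρ x c) (proj₁ (free⇒occurs φ (ρ [ x ≔ c ]) (suc c)
          (RenamedBelow-ex x φ ρ c rl) x xf))
    boundVars-occur (ex x φ) ρ c (xf , w) rl y (there m) = boundVars-occur φ _ (suc c) w
        (RenamedBelow-ex x φ ρ c rl) y m

    atoms-nonempty : ∀ φ ρ c → Σ Atom λ f → Σ (List Atom) λ r → atoms (flatten φ ρ c) ≡ f ∷ r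
    atoms-nonempty (atom α) ρ c = _ , _ , P.refl
    atoms-nonempty (and φ ψ) ρ c with atoms-nonempty φ ρ c
    ... | f , r , e = f , r ++ atoms (flatten ψ ρ (next (flatten φ ρ c))) , P.cong (_++ atoms
        (flatten ψ ρ (next (flatten φ ρ c)))) e
    atoms-nonempty (ex x φ) ρ c = atoms-nonempty φ _ (suc c)

    atoms-binary : ∀ φ ρ c → All (_≤ 2) (relArities φ) → ∀ h → h ∈ atoms (flatten φ ρ c) →
      All (_≤ 2) (relArities (atom h))
    atoms-binary (atom α) ρ c r h (here P.refl) = P.subst (All (_≤ 2)) (P.sym (relArities-renameAtom ρ α)) r
    atoms-binary (and φ ψ) ρ c r h m with ∈-++⁻ (atoms (flatten φ ρ c)) m
    ... | inj₁ m1 = atoms-binary φ ρ c (AllP.++⁻ˡ (relArities φ) r) h m1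
    ... | inj₂ m2 = atoms-binary ψ ρ _ (AllP.++⁻ʳ (relArities φ) r) h m2
    atoms-binary (ex x φ) ρ c r h m = atoms-binary φ _ (suc c) r h m

    ParentPair : (Var → Var) → Var → Var → Set
    ParentPair pf p r = p ≡ r ⊎ (r < p × pf p ≡ r) ⊎ (p < r × pf r ≡ p)

    parentPair-shape : ∀ pf p r T v → v ≤ T → ¬ v ≡ T → (T ≡ p ⊎ T ≡ r) → (v ≡ p ⊎ v ≡ r) →
      ParentPair pf p r →
      v ≡ pf T × pf T < T
    parentPair-shape pf p r T v le ne iT iv (inj₁ pr) = ⊥-elim (ne (P.trans (eqp iv) (P.sym (eqp iT))))
      where
      eqp : ∀ {w} → w ≡ p ⊎ w ≡ r → w ≡ p
      eqp (inj₁ e) = e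
      eqp (inj₂ e) = P.trans e (P.sym pr)
    parentPair-shape pf p r T v le ne (inj₁ Tp) (inj₁ vp) (inj₂ (inj₁ _)) = ⊥-elim (ne (P.trans vp (P.sym Tp)))
    parentPair-shape pf p r T v le ne (inj₁ Tp) (inj₂ vr) (inj₂ (inj₁ (lt , e))) =
      P.trans vr (P.sym (P.trans (P.cong pf Tp) e)) ,
      P.subst₂ _<_ (P.sym (P.trans (P.cong pf Tp) e)) (P.sym Tp) lt
    parentPair-shape pf p r T v le ne (inj₂ Tr) (inj₂ vr) (inj₂ (inj₁ _)) = ⊥-elim (ne (P.trans vr (P.sym Tr)))
    parentPair-shape pf p r T v le ne (inj₂ Tr) (inj₁ vp) (inj₂ (inj₁ (lt , e))) =
      ⊥-elim (ℕP.<⇒≱ lt (P.subst₂ _≤_ vp Tr le))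
    parentPair-shape pf p r T v le ne (inj₂ Tr) (inj₂ vr) (inj₂ (inj₂ _)) = ⊥-elim (ne (P.trans vr (P.sym Tr)))
    parentPair-shape pf p r T v le ne (inj₂ Tr) (inj₁ vp) (inj₂ (inj₂ (lt , e))) =
      P.trans vp (P.sym (P.trans (P.cong pf Tr) e)) ,
      P.subst₂ _<_ (P.sym (P.trans (P.cong pf Tr) e)) (P.sym Tr) lt
    parentPair-shape pf p r T v le ne (inj₁ Tp) (inj₁ vp) (inj₂ (inj₂ _)) = ⊥-elim (ne (P.trans vp (P.sym Tp)))
    parentPair-shape pf p r T v le ne (inj₁ Tp) (inj₂ vr) (inj₂ (inj₂ (lt , e))) =
      ⊥-elim (ℕP.<⇒≱ lt (P.subst₂ _≤_ vr Tp le))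

    ParentPair⇒ParentShaped : ∀ pf p r h → ParentPair pf p r → (∀ v → v ∈ h → v ≡ p ⊎ v ≡ r) →
      ParentShaped pf h
    ParentPair⇒ParentShaped pf p r (x ∷ xs) ok inh v vh with v ℕ.≟ maxVar (x ∷ xs)
    ... | yes e = inj₁ e
    ... | no ne = inj₂ (parentPair-shape pf p r (maxVar (x ∷ xs)) v (maxVar-≥ (x ∷ xs) v vh) ne
                          (inh _ (maxVar-∈ x xs)) (inh v vh) ok)

    parent-andˡ : ∀ φ ψ ρ c v → v < next (flatten φ ρ c) →
      parent (flatten (and φ ψ) ρ c) v ≡ parent (flatten φ ρ c) v
    parent-andˡ φ ψ ρ c v u =
      P.cong (λ z → if z then parent (flatten φ ρ c) v else parent (flatten ψ ρ (next
          (flatten φ ρ c))) v) (<ᵇ-true v _ u)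

    parent-andʳ : ∀ φ ψ ρ c v → next (flatten φ ρ c) ≤ v →
      parent (flatten (and φ ψ) ρ c) v ≡ parent (flatten ψ ρ (next (flatten φ ρ c))) v
    parent-andʳ φ ψ ρ c v l =
      P.cong (λ z → if z then parent (flatten φ ρ c) v else parent (flatten ψ ρ (next
          (flatten φ ρ c))) v) (<ᵇ-false v _ l)

    parent-ex-fresh : ∀ x φ ρ c → parent (flatten (ex x φ) ρ c) c ≡ ρ (other x)
    parent-ex-fresh x φ ρ c =
      P.cong (λ z → if z then ρ (other x) else parent (flatten φ (ρ [ x ≔ c ]) (suc c)) c) (≡ᵇ-refl c)

    parent-ex-inner : ∀ x φ ρ c v → suc c ≤ v →
      parent (flatten (ex x φ) ρ c) v ≡ parent (flatten φ (ρ [ x ≔ c ]) (suc c)) v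
    parent-ex-inner x φ ρ c v l =
      P.cong (λ z → if z then ρ (other x) else parent (flatten φ (ρ [ x ≔ c ]) (suc c)) v)
             (≢⇒≡ᵇ-false v c (λ e → ℕP.<-irrefl (P.sym e) l))

    -- Quantifying x ∈ {a, b} as the fresh c makes c the image of x, and the parent of c is
    -- the image of the other variable, which is older.
    ParentPair-≔ : ∀ pf ρ x c → (x ≡ a ⊎ x ≡ b) → ρ a < c → ρ b < c → pf c ≡ ρ (other x) →
      ParentPair pf ((ρ [ x ≔ c ]) a) ((ρ [ x ≔ c ]) b)
    ParentPair-≔ pf ρ x c x∈ab la lb pfc with a ℕ.≟ b
    ... | yes e = inj₁ (P.cong (ρ [ x ≔ c ]) e)
    ParentPair-≔ pf ρ x c (inj₁ P.refl) la lb pfc | no x≢b =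
      P.subst₂ (ParentPair pf) (P.sym (≔-same ρ x c)) (P.sym (≔-other ρ x c b (x≢b ∘ P.sym)))
        (inj₂ (inj₁ (lb , P.trans pfc (P.cong (λ z → ρ (if z then b else x)) (≡ᵇ-refl x)))))
    ParentPair-≔ pf ρ x c (inj₂ P.refl) la lb pfc | no a≢x =
      P.subst₂ (ParentPair pf) (P.sym (≔-other ρ x c a a≢x)) (P.sym (≔-same ρ x c))
        (inj₂ (inj₂ (la , P.trans pfc (P.cong (λ z → ρ (if z then x else a)) (≢⇒≡ᵇ-false x a (a≢x ∘ P.sym))))))

    flatten-parentShaped : ∀ φ ρ c pf → (∀ n → n ∈ allVars φ → n ≡ a ⊎ n ≡ b) → ρ a < c → ρ b < c →
      ParentPair pf (ρ a) (ρ b) → (∀ v → c ≤ v → v < next (flatten φ ρ c) → pf v ≡ parent (flatten φ ρ c) v) →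
      ∀ h → h ∈ atoms (flatten φ ρ c) → ParentShaped pf (atomVars h)
    flatten-parentShaped (atom α) ρ c pf nms la lb ok ag h (here P.refl) = ParentPair⇒ParentShaped pf
        (ρ a) (ρ b) _ ok inh
      where
      inh : ∀ v → v ∈ atomVars (renameAtom ρ α) → v ≡ ρ a ⊎ v ≡ ρ b
      inh v m with renameAtom-vars⁻ ρ α v m
      ... | n , nm , e with nms n nm
      ...   | inj₁ P.refl = inj₁ e
      ...   | inj₂ P.refl = inj₂ e
    flatten-parentShaped (and φ ψ) ρ c pf nms la lb ok ag h m with ∈-++⁻ (atoms (flatten φ ρ c)) m
    ... | inj₁ m1 = flatten-parentShaped φ ρ c pf (λ n nm → nms n (∈-++⁺ˡ nm)) la lb ok
                      (λ v l u → P.trans (ag v l (ℕP.<-≤-trans u (next-≥ ψ ρ _))) (parent-andˡ φ ψ ρ c v u)) h m1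
    ... | inj₂ m2 = flatten-parentShaped ψ ρ _ pf (λ n nm → nms n (∈-++⁺ʳ (allVars φ) nm))
                      (ℕP.<-≤-trans la (next-≥ φ ρ c)) (ℕP.<-≤-trans lb (next-≥ φ ρ c)) ok
                      (λ v l u → P.trans (ag v (ℕP.≤-trans (next-≥ φ ρ c) l) u) (parent-andʳ φ ψ ρ c v l)) h m2
    flatten-parentShaped (ex x φ) ρ c pf nms la lb ok ag h m =
      flatten-parentShaped φ (ρ [ x ≔ c ]) (suc c) pf (λ n nm → nms n (there nm)) (below a la) (below b lb)
        (ParentPair-≔ pf ρ x c (nms x (here P.refl)) la lb
          (P.trans (ag c ℕP.≤-refl (next->-ex x φ ρ c)) (parent-ex-fresh x φ ρ c)))
        (λ v l u → P.trans (ag v (ℕP.<⇒≤ l) u) (parent-ex-inner x φ ρ c v l)) h m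
      where
      below : ∀ n → ρ n < c → (ρ [ x ≔ c ]) n < suc c
      below n l with n ℕ.≟ x
      ... | yes P.refl rewrite ≔-same ρ n c = ℕP.≤-refl
      ... | no nx rewrite ≔-other ρ x c n nx = ℕP.m≤n⇒m≤1+n l

module FlatteningSemantics {c ℓ} (K : CommutativeSemiring c ℓ) where

  open Elimination
  open Flattening
  open Evaluation K

  open CommutativeSemiring K
  open SetoidReasoning setoid
  open Semantics K

  AgreeOutside : List Var → (Var → ℕ) → (Var → ℕ) → Set
  AgreeOutside xs κ ν = ∀ v → v ∉ xs → κ v ≡ ν v

  sumVars-cong-outside : ∀ N xs (f g : Val) ν → (∀ κ → AgreeOutside xs κ ν → f κ ≈ g κ) →
    sumVars N xs f ν ≈ sumVars N xs g ν
  sumVars-cong-outside N [] f g ν h = h ν (λ v _ → P.refl)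
  sumVars-cong-outside N (x ∷ xs) f g ν h = sumBelow-cong N (λ d → sumVars-cong-outside N xs f g (update ν x d)
    (λ κ o → h κ (λ v nv → P.trans (o v (λ m → nv (there m))) (update-other ν x d v (λ e → nv (here e))))))

  sumVars-*ʳ : ∀ N xs (f : Val) D ν → sumVars N xs (λ κ → f κ * D) ν ≈ sumVars N xs f ν * D
  sumVars-*ʳ N [] f D ν = refl
  sumVars-*ʳ N (x ∷ xs) f D ν = trans (sumBelow-cong N (λ d → sumVars-*ʳ N xs f D _)) (sym (sumBelow-*ʳ N D _))

  map-renaming : ∀ {n} (xs : Vec Var n) (ρ : Var → Var) (μ ν : Var → ℕ) → (∀ v → v ∈ toList xs →
    μ v ≡ ν (ρ v)) →
    Vec.map μ xs ≡ Vec.map ν (Vec.map ρ xs)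
  map-renaming [] ρ μ ν a = P.refl
  map-renaming (x ∷ xs) ρ μ ν a = P.cong₂ _∷_ (a x (here P.refl)) (map-renaming xs ρ μ ν (λ v m → a v (there m)))

  prodOver-agreeOn : ∀ N db (as : List Atom) ν ν′ → (∀ v → (Σ Atom λ h → h ∈ as × v ∈ atomVars h) →
    ν v ≡ ν′ v) →
    prodOver (atomValue N db) as ν ≈ prodOver (atomValue N db) as ν′
  prodOver-agreeOn N db [] ν ν′ a = refl
  prodOver-agreeOn N db (h ∷ as) ν ν′ a =
    *-cong (⟦⟧[]-agreeOn (atom h) N db ν ν′ (λ v m → a v (h , here P.refl , m)))
           (prodOver-agreeOn N db as ν ν′ (λ v (g , gm , vm) → a v (g , there gm , vm)))

  module _ (a b : Var) where
    open Flatten a b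

    -- In a conjunction the quantified variables of each side are fresh for the other side,
    -- so their sums factor past it.
    flatten-sound : ∀ φ ρ c N db → RenamedBelow ρ φ c → ∀ ν μ → (∀ n → n ∈ free φ → μ n ≡ ν (ρ n)) →
      ⟦ φ ⟧[ N ] db μ ≈ sumVars N (boundVars (flatten φ ρ c)) (prodOver (atomValue N db) (atoms (flatten φ ρ c))) ν
    flatten-sound (atom (relA R xs)) ρ c N db rl ν μ ag =
      trans (reflexive (P.cong (rel db R) (map-renaming xs ρ μ ν ag))) (sym (*-identityʳ _))
    flatten-sound (atom (leqA x k)) ρ c N db rl ν μ ag rewrite ag x (here P.refl) = sym (*-identityʳ _)
    flatten-sound (and φ ψ) ρ c N db rl ν μ ag = sym (begin
      sumVars N (ys₁ ++ ys₂) (prodOver (atomValue N db) (atoms (flatten (and φ ψ) ρ c))) ν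
        ≈⟨ sumVars-cong N (ys₁ ++ ys₂) (prodOver-++ (atomValue N db) (atoms (flatten φ ρ c)) _) ν ⟩
      sumVars N (ys₁ ++ ys₂) (λ κ → P₁ κ * P₂ κ) ν
        ≈⟨ sumVars-++ N ys₁ ys₂ _ ν ⟩
      sumVars N ys₁ (sumVars N ys₂ (λ κ → P₁ κ * P₂ κ)) ν
        ≈⟨ sumVars-cong N ys₁ (sumVars-factorˡ N ys₂ P₁ P₂ P₂-extensional P₁-ignores-ys₂) ν ⟩
      sumVars N ys₁ (λ κ → P₁ κ * sumVars N ys₂ P₂ κ) ν
        ≈⟨ sumVars-cong-outside N ys₁ _ _ ν (λ κ o → *-cong refl (sym (flatten-sound ψ ρ c₁ N db rl₂ κ μ
             (λ n m → P.trans (ag n (∈-++⁺ʳ (free φ) m)) (P.sym (o (ρ n) (free-right∉bound-left φ ψ ρ c rl n m))))))) ⟩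
      sumVars N ys₁ (λ κ → P₁ κ * ⟦ ψ ⟧[ N ] db μ) ν
        ≈⟨ sumVars-*ʳ N ys₁ P₁ _ ν ⟩
      sumVars N ys₁ P₁ ν * ⟦ ψ ⟧[ N ] db μ
        ≈⟨ *-cong (sym (flatten-sound φ ρ c N db (RenamedBelow-andˡ φ ψ ρ c rl) ν μ (λ n m → ag n (∈-++⁺ˡ m)))) refl ⟩
      ⟦ φ ⟧[ N ] db μ * ⟦ ψ ⟧[ N ] db μ ∎)
      where
      c₁ : ℕ
      c₁ = next (flatten φ ρ c)
      ys₁ ys₂ : List Var
      ys₁ = boundVars (flatten φ ρ c)
      ys₂ = boundVars (flatten ψ ρ c₁)
      P₁ P₂ : Val
      P₁ = prodOver (atomValue N db) (atoms (flatten φ ρ c))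
      P₂ = prodOver (atomValue N db) (atoms (flatten ψ ρ c₁))
      rl₂ : RenamedBelow ρ ψ c₁
      rl₂ = RenamedBelow-andʳ φ ψ ρ c c₁ (next-≥ φ ρ c) rl
      P₂-extensional : Extensional P₂
      P₂-extensional = prodOver-extensional (atomValue N db) (λ h → ⟦⟧[]-cong (atom h) N db) (atoms (flatten ψ ρ c₁))
      P₁-ignores-ys₂ : ∀ κ y d → y ∈ ys₂ → P₁ (update κ y d) ≈ P₁ κ
      P₁-ignores-ys₂ κ y d y∈ = prodOver-agreeOn N db _ _ _ λ v av →
        update-other κ y d v (λ e → occurs-left∉bound-right φ ψ ρ c rl v av (P.subst (_∈ ys₂) (P.sym e) y∈))
    flatten-sound (ex x φ) ρ c N db rl ν μ ag =
      sumBelow-cong N (λ d → flatten-sound φ (ρ [ x ≔ c ]) (suc c) N db (RenamedBelow-ex x φ ρ c rl)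
          (update ν c d) (update μ x d) (ag′ d))
      where
      ag′ : ∀ d n → n ∈ free φ → update μ x d n ≡ update ν c d ((ρ [ x ≔ c ]) n)
      ag′ d n m with n ℕ.≟ x
      ... | yes P.refl rewrite ≔-same ρ n c = P.trans (update-same μ n d) (P.sym (update-same ν c d))
      ... | no nx rewrite ≔-other ρ x c n nx =
        P.trans (update-other μ x d n nx) (P.trans (ag n (free-exs⁺ (x ∷ []) φ n m (λ { (here q) → nx q })))
          (P.sym (update-other ν c d (ρ n) (λ e → ℕP.<-irrefl e (rl n (there (free⊆all φ n m)))))))

module FO2ToFreeConnex where

  open JoinTree
  open Elimination
  open ParentAcyclicity
  open CQLabels using (free-conjFrom⁺; free-conjFrom⁻)
  open Flattening

  WF-conjFrom : ∀ a as → WF (conjFrom a as)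
  WF-conjFrom a [] = tt
  WF-conjFrom a (b ∷ bs) = tt , WF-conjFrom b bs

  relArities-conjFrom⁺ : ∀ a as → (∀ h → h ∈ (a ∷ as) → All (_≤ 2) (relArities (atom h))) →
    All (_≤ 2) (relArities (conjFrom a as))
  relArities-conjFrom⁺ a [] r = r a (here P.refl)
  relArities-conjFrom⁺ a (b ∷ bs) r = AllP.++⁺ (r a (here P.refl)) (relArities-conjFrom⁺ b bs (λ h m → r h (there m)))

  module Construction {k : ℕ} (q : Query k) (fo2 : FO2Query q) where
    bin : BinaryQuery q
    bin = proj₁ fo2
    a : Var
    a = proj₁ (proj₂ fo2)
    b : Var
    b = proj₁ (proj₂ (proj₂ fo2))
    open Flatten a b
    φ : Formula
    φ = body q
    H : List Var
    H = toList (head q)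

    twoVars : ∀ n → n ∈ allVars φ → n ≡ a ⊎ n ≡ b
    twoVars n m = All.lookup (proj₂ (proj₂ (proj₂ fo2))) m

    -- Fresh variables start above both variables of φ, which are left unrenamed.
    c₀ : ℕ
    c₀ = suc (a ⊔ b)
    r : Flattened
    r = flatten φ id c₀
    Ys : List Var
    Ys = boundVars r

    below-c₀ : ∀ n → n ≡ a ⊎ n ≡ b → n < c₀
    below-c₀ n (inj₁ P.refl) = s≤s (ℕP.m≤m⊔n a b)
    below-c₀ n (inj₂ P.refl) = s≤s (ℕP.m≤n⊔m a b)
    renamed-below : RenamedBelow id φ c₀
    renamed-below n m = below-c₀ n (twoVars n m)

    nonempty : Σ Atom λ f₀ → Σ (List Atom) λ rs → atoms r ≡ f₀ ∷ rs
    nonempty = atoms-nonempty φ id c₀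
    f₀ : Atom
    f₀ = proj₁ nonempty
    rs : List Atom
    rs = proj₁ (proj₂ nonempty)
    atoms≡ : atoms r ≡ f₀ ∷ rs
    atoms≡ = proj₂ (proj₂ nonempty)
    C : Formula
    C = conjFrom f₀ rs
    body′ : Formula
    body′ = exs Ys C

    occurs⇒∈atoms : ∀ v → OccursIn (atoms r) v → Σ Atom λ h → h ∈ (f₀ ∷ rs) × v ∈ atomVars h
    occurs⇒∈atoms v (h , hm , vm) = h , P.subst (h ∈_) atoms≡ hm , vm
    ∈atoms⇒occurs : ∀ v → (Σ Atom λ h → h ∈ (f₀ ∷ rs) × v ∈ atomVars h) → OccursIn (atoms r) v
    ∈atoms⇒occurs v (h , hm , vm) = h , P.subst (h ∈_) (P.sym atoms≡) hm , vm

    free⊆free-body′ : ∀ x → x ∈ free φ → x ∈ free body′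
    free⊆free-body′ x m = let (av , ny) = free⇒occurs φ id c₀ renamed-below x m
                              (h , hm , vm) = occurs⇒∈atoms x av in
                          free-exs⁺ Ys C x (free-conjFrom⁺ f₀ rs h x hm vm) ny
    free-body′⊆free : ∀ x → x ∈ free body′ → x ∈ free φ
    free-body′⊆free x m = let (mc , ny) = free-exs⁻ Ys C x m
                              (n , nm , e) = occurs⇒free φ id c₀ renamed-below x (∈atoms⇒occurs x
                                  (free-conjFrom⁻ f₀ rs x mc)) ny in
                          P.subst (_∈ free φ) (P.sym e) nm

    q′ : Query k
    q′ = record
      { body = body′
      ; head = head q
      ; headFree = λ x m → free⊆free-body′ x (headFree q x m)
      ; freeHead = λ x m → freeHead q x (free-body′⊆free x m)
      ; wf = WF-exs Ys C (boundVars-distinct φ id c₀)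
               (λ y m → let (h , hm , vm) = occurs⇒∈atoms y (boundVars-occur φ id c₀ (wf q) renamed-below y m) in
                        free-conjFrom⁺ f₀ rs h y hm vm)
               (WF-conjFrom f₀ rs) }

    atoms-binary′ : ∀ h → h ∈ (f₀ ∷ rs) → All (_≤ 2) (relArities (atom h))
    atoms-binary′ h m = atoms-binary φ id c₀ (proj₂ bin) h (P.subst (h ∈_) (P.sym atoms≡) m)

    binary : BinaryQuery q′
    binary = proj₁ bin , P.subst (All (_≤ 2)) (P.sym (relArities-exs Ys C)) (relArities-conjFrom⁺ f₀ rs atoms-binary′)

    -- Fresh variables point as computed by flatten; of the two original variables the
    -- larger points to the smaller.
    pf : Var → Var
    pf v = if v <ᵇ c₀ then (if v ≡ᵇ (a ⊔ b) then a ⊓ b else v) else parent r v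

    pair₀ : ParentPair pf a b
    pair₀ with ℕP.<-cmp a b
    ... | tri≈ _ e _ = inj₁ e
    ... | tri< lt _ _ = inj₂ (inj₂ (lt , pfb))
      where
      pfb : pf b ≡ a
      pfb rewrite <ᵇ-true b c₀ (below-c₀ b (inj₂ P.refl)) | ℕP.m≤n⇒m⊔n≡n (ℕP.<⇒≤ lt) | ≡ᵇ-refl b = ℕP.m≤n⇒m⊓n≡m (ℕP.<⇒≤ lt)
    ... | tri> _ _ gt = inj₂ (inj₁ (gt , pfa))
      where
      pfa : pf a ≡ b
      pfa rewrite <ᵇ-true a c₀ (below-c₀ a (inj₁ P.refl)) | ℕP.m≥n⇒m⊔n≡m (ℕP.<⇒≤ gt) | ≡ᵇ-refl a = ℕP.m≥n⇒m⊓n≡n (ℕP.<⇒≤ gt)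

    pf-fresh : ∀ v → c₀ ≤ v → v < next r → pf v ≡ parent r v
    pf-fresh v l u rewrite <ᵇ-false v c₀ l = P.refl

    nodes-parentShaped : ∀ g → g ∈ map atomVars (f₀ ∷ rs) → ParentShaped pf g
    nodes-parentShaped g m with ∈-map⁻ atomVars m
    ... | h , hm , P.refl = flatten-parentShaped φ id c₀ pf twoVars (below-c₀ a (inj₁ P.refl))
        (below-c₀ b (inj₂ P.refl))
                              pair₀ pf-fresh h (P.subst (h ∈_) (P.sym atoms≡) hm)

    nodes-headClosed : ∀ g → g ∈ map atomVars (f₀ ∷ rs) → HeadClosed H g
    nodes-headClosed g m max∈H v vg with ∈-map⁻ atomVars m
    ... | h , hm , P.refl = freeHead q v v∈φ
      where
      v<c₀ : v < c₀
      v<c₀ = ℕP.≤-<-trans (maxVar-≥ g v vg) (renamed-below (maxVar g) (free⊆all φ (maxVar g) (headFree q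
          (maxVar g) max∈H)))
      v∈φ : v ∈ free φ
      v∈φ = let (n , nm , ev) = occurs⇒free φ id c₀ renamed-below v (∈atoms⇒occurs v (h , hm , vg))
                                  (λ y → ℕP.<⇒≱ v<c₀ (proj₁ (boundVars-range φ id c₀ v y))) in
            P.subst (_∈ free φ) (P.sym ev) nm

    freeConnex : FreeConnexCQ q′
    freeConnex = cqShape Ys f₀ rs , P.refl ,
                 acyclic-headless pf (map atomVars (f₀ ∷ rs)) (λ ()) nodes-parentShaped ,
                 acyclic-with-head pf H (map atomVars (f₀ ∷ rs)) nodes-parentShaped nodes-headClosed

    module _ {c ℓ} (K : CommutativeSemiring c ℓ) where
      open CommutativeSemiring K
      open Evaluation K
      open FlatteningSemantics K
      open Outputs K
      open Semantics K
      open SetoidReasoning setoid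

      body-≈ : ∀ N db → bnd db (body q) ≤ N → bnd db body′ ≤ N → ∀ ν ν′ →
        (∀ v → v ∈ H → ν′ v ≡ ν v) → ⟦ body q ⟧[ N ] db ν ≈ ⟦ body′ ⟧[ N ] db ν′
      body-≈ N db _ _ ν ν′ ag = begin
        ⟦ φ ⟧[ N ] db ν
          ≈⟨ flatten-sound a b φ id c₀ N db renamed-below ν′ ν (λ n m → P.sym (ag n (freeHead q n m))) ⟩
        sumVars N Ys (prodOver (atomValue N db) (atoms r)) ν′
          ≡⟨ P.cong (λ z → sumVars N Ys (prodOver (atomValue N db) z) ν′) atoms≡ ⟩
        sumVars N Ys (prodOver (atomValue N db) (f₀ ∷ rs)) ν′
          ≈⟨ sumVars-cong N Ys (λ μ → sym (⟦conjFrom⟧ N db f₀ rs μ)) ν′ ⟩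
        sumVars N Ys (⟦ C ⟧[ N ] db) ν′
          ≈⟨ sym (⟦exs⟧ N db Ys C ν′) ⟩
        ⟦ body′ ⟧[ N ] db ν′ ∎

      equiv : ∀ db ds → output K q db ds ≈ output K q′ db ds
      equiv = output-≈ q q′ id (P.sym (VecP.map-id (head q))) (λ u v _ _ e → e) body-≈

  FO2⇒freeConnex : ∀ (k : ℕ) (q : Query k) → FO2Query q → EquivalentIn BinaryFreeConnexCQ q
  FO2⇒freeConnex k q fo2 =
    witness (Construction.q′ q fo2) (Construction.binary q fo2 , Construction.freeConnex q fo2)
            (λ K _ db ds → Construction.equiv q fo2 K db ds)

theorem6 : (∀ (k : ℕ) (q : Query k) → BinaryFreeConnexCQ q → EquivalentIn FO2Query q)
    ×ω (∀ (k : ℕ) (q : Query k) → FO2Query q → EquivalentIn BinaryFreeConnexCQ q)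
theorem6 = FreeConnexToFO2.freeConnex⇒FO2 ,ω FO2ToFreeConnex.FO2⇒freeConnex
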